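{- Let $n$ and $d$ be integers with $2\le d\le n$ and let $\mathcal{D}$ be a Ferrers diagram of order $n$. If the pair $(\mathcal{D},d)$ is MDS-constructible, then for every finite field $\mathbb{F}$ there exists a $[\mathcal{D},\nu_{\min}(\mathcal{D},d),d]_{\mathbb{F}}$ MFD code.
   Context: Write $[n]=\{1,\ldots,n\}$. A (top-right justified) Ferrers diagram of order $n$ is a subset $\mathcal{D}\subseteq[n]^2$ such that: if $(i,j)\in\mathcal{D}$ and $j\le j'\le n$, then $(i,j')\in\mathcal{D}$; and if $(i,j)\in\mathcal{D}$ and $1\le i'\le i$, then $(i',j)\in\mathcal{D}$. It is identified with the vector $(c_1,\ldots,c_n)$, $c_j=|\{i\in[n]:(i,j)\in\mathcal{D}\}|$, so $0\le c_1\le\cdots\le c_n\le n$ and $\mathcal{D}=\{(i,j)\in[n]^2: i\le c_j\}$. For a field $\mathbb{F}$, $\mathbb{F}^{\mathcal{D}}$ is the space of matrices $(a_{i,j})\in\mathbb{F}^{n\times n}$ with $a_{i,j}=0$ for all $(i,j)\notin\mathcal{D}$. A $[\mathcal{D},k,d]_{\mathbb{F}}$ (Ferrers diagram rank-metric) code is a $k$-dimensional $\mathbb{F}$-subspace $\mathcal{C}\subseteq\mathbb{F}^{\mathcal{D}}$ whose minimum rank distance $\min\{\operatorname{rk}(A):A\in\mathcal{C},A\ne0\}$ equals $d$. (Convention: for $k=0$ the zero subspace counts as a $[\mathcal{D},0,d]_{\mathbb{F}}$ code.) Define $$\nu_{\min}(\mathcal{D},d)=\min_{0\le j\le d-1}\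 \sum_{i=1}^{n-j}\max\{0,c_i-d+1+j\}.$$ A $[\mathcal{D},k,d]_{\mathbb{F}}$ code with $k=\nu_{\min}(\mathcal{D},d)$ is called a maximum Ferrers diagram (MFD) code. For $i\in[n]$ let $\Delta_i^n=\{(j,j+i-1): j\in[n-i+1]\}$ be the $i$-th diagonal. The pair $(\mathcal{D},d)$ is MDS-constructible if $$\nu_{\min}(\mathcal{D},d)=\sum_{i=1}^n\max\{0,|\mathcal{D}\cap\Delta_i^n|-d+1\}.$$ -}

module Defs where

open import Algebra.Apartness.Bundles using (HeytingField; HeytingCommutativeRing)
open import Algebra.Bundles using (CommutativeRing)
open import Algebra.Module.Bundles using (Module)
open import Algebra.Module.Construct.TensorUnit using () renaming (⟨module⟩ to ring-module)
import Algebra.Properties.CommutativeMonoid.Sum as Summation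
open import Data.Fin.Base using (Fin; toℕ) renaming (_≤_ to _≤ᶠ_; zero to fzero; suc to fsuc)
open import Data.List.Base using (allFin; cartesianProduct; filter; length; map; take; upTo)
open import Data.List.Extrema.Nat using (min)
open import Data.Nat.Base using (ℕ; zero; suc; _+_; _∸_; _≤_)
open import Data.Nat.ListAction using (sum)
open import Data.Nat.Properties using (_≟_)
open import Data.Product.Base using (∃-syntax; _×_; _,_)
open import Data.Sum.Base using (_⊎_)
open import Function.Bundles using (Inverse)
open import Level using (Level; _⊔_; 0ℓ) renaming (suc to lsuc)
open import Relation.Binary.PropositionalEquality using (_≡_; setoid)
open import Relation.Unary using (Pred; Decidable; _∈_; _∉_; _⊆_)
open import Relation.Unary.Properties using (_∩?_)

-- Ferrers diagrams.  Rows, columns and diagonals are indexed by Fin n, so the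
-- 1-based index i of [n] is the element of Fin n whose toℕ is i - 1.

record FerrersDiagram (n : ℕ) : Set₁ where
  field
    Cell         : Pred (Fin n × Fin n) 0ℓ
    cell?        : Decidable Cell
    right-closed : ∀ {i j j′} → (i , j) ∈ Cell → j ≤ᶠ j′ → (i , j′) ∈ Cell
    up-closed    : ∀ {i i′ j} → (i , j) ∈ Cell → i′ ≤ᶠ i → (i′ , j) ∈ Cell

  columnHeight : Fin n → ℕ
  columnHeight j = length (filter (λ i → cell? (i , j)) (allFin n))

-- (a , b) lies on the (1-based) i-th diagonal iff b = a + i - 1.
Diagonal : ∀ {n} → Fin n → Pred (Fin n × Fin n) 0ℓ
Diagonal i (a , b) = toℕ b ≡ toℕ a + toℕ i

diagonal? : ∀ {n} (i : Fin n) → Decidable (Diagonal i)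
diagonal? i (a , b) = toℕ b ≟ toℕ a + toℕ i

card : ∀ {n} {P : Pred (Fin n × Fin n) 0ℓ} → Decidable P → ℕ
card {n} P? = length (filter P? (cartesianProduct (allFin n) (allFin n)))

module _ {n : ℕ} (D : FerrersDiagram n) (d : ℕ) where
  open FerrersDiagram D

  -- max{0 , c - d + 1 + j} is the truncated difference (c + 1 + j) ∸ d.
  ν-term : ℕ → ℕ
  ν-term j = sum (map (λ i → (columnHeight i + 1 + j) ∸ d) (take (n ∸ j) (allFin n)))

  -- For d ≥ 1, j = 0 is among the indices 0 ≤ j ≤ d - 1, so using ν-term 0 as
  -- the default value of min does not change the minimum.
  ν-min : ℕ
  ν-min = min (ν-term 0) (map ν-term (upTo d))

  MDSConstructible : Set
  MDSConstructible =
    ν-min ≡ sum (map (λ i → (card (cell? ∩? diagonal? i) + 1) ∸ d) (allFin n))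

module _ {c ℓ : Level} {R : CommutativeRing c ℓ} where

  -- The module of n-tuples of elements of M, with pointwise operations.
  power : ∀ {m ℓm} → ℕ → Module R m ℓm → Module R m ℓm
  power n M = record
    { Carrierᴹ = Fin n → M.Carrierᴹ
    ; _≈ᴹ_     = λ x y → ∀ i → x i M.≈ᴹ y i
    ; _+ᴹ_     = λ x y i → x i M.+ᴹ y i
    ; _*ₗ_     = λ a x i → a M.*ₗ x i
    ; _*ᵣ_     = λ x a i → x i M.*ᵣ a
    ; 0ᴹ       = λ _ → M.0ᴹ
    ; -ᴹ_      = λ x i → M.-ᴹ x i
    ; isModule = record
      { isBimodule = record
        { isBisemimodule = record
          { +ᴹ-isCommutativeMonoid = record
            { isMonoid = record
              { isSemigroup = record
                { isMagma = record
                  { isEquivalence = record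
                    { refl  = λ _ → M.≈ᴹ-refl
                    ; sym   = λ p i → M.≈ᴹ-sym (p i)
                    ; trans = λ p q i → M.≈ᴹ-trans (p i) (q i)
                    }
                  ; ∙-cong = λ p q i → M.+ᴹ-cong (p i) (q i)
                  }
                ; assoc = λ x y z i → M.+ᴹ-assoc (x i) (y i) (z i)
                }
              ; identity = (λ x i → M.+ᴹ-identityˡ (x i)) , (λ x i → M.+ᴹ-identityʳ (x i))
              }
            ; comm = λ x y i → M.+ᴹ-comm (x i) (y i)
            }
          ; isPreleftSemimodule = record
            { *ₗ-cong      = λ p q i → M.*ₗ-cong p (q i)
            ; *ₗ-zeroˡ     = λ x i → M.*ₗ-zeroˡ (x i)
            ; *ₗ-distribʳ  = λ x a b i → M.*ₗ-distribʳ (x i) a b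
            ; *ₗ-identityˡ = λ x i → M.*ₗ-identityˡ (x i)
            ; *ₗ-assoc     = λ a b x i → M.*ₗ-assoc a b (x i)
            ; *ₗ-zeroʳ     = λ a i → M.*ₗ-zeroʳ a
            ; *ₗ-distribˡ  = λ a x y i → M.*ₗ-distribˡ a (x i) (y i)
            }
          ; isPrerightSemimodule = record
            { *ᵣ-cong      = λ p q i → M.*ᵣ-cong (p i) q
            ; *ᵣ-zeroʳ     = λ x i → M.*ᵣ-zeroʳ (x i)
            ; *ᵣ-distribˡ  = λ x a b i → M.*ᵣ-distribˡ (x i) a b
            ; *ᵣ-identityʳ = λ x i → M.*ᵣ-identityʳ (x i)
            ; *ᵣ-assoc     = λ x a b i → M.*ᵣ-assoc (x i) a b
            ; *ᵣ-zeroˡ     = λ a i → M.*ᵣ-zeroˡ a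
            ; *ᵣ-distribʳ  = λ a x y i → M.*ᵣ-distribʳ a (x i) (y i)
            }
          ; *ₗ-*ᵣ-assoc = λ a x b i → M.*ₗ-*ᵣ-assoc a (x i) b
          }
        ; -ᴹ‿cong    = λ p i → M.-ᴹ‿cong (p i)
        ; -ᴹ‿inverse = (λ x i → M.-ᴹ‿inverseˡ (x i)) , (λ x i → M.-ᴹ‿inverseʳ (x i))
        }
      ; *ₗ-*ᵣ-coincident = λ a x i → M.*ₗ-*ᵣ-coincident a (x i)
      }
    } where module M = Module M

module LinearAlgebra {c ℓ m ℓm : Level} {R : CommutativeRing c ℓ} (M : Module R m ℓm) where
  private module R = CommutativeRing R
  open Module M
  private module S = Summation +ᴹ-commutativeMonoid

  record Subspace (p : Level) : Set (c ⊔ m ⊔ ℓm ⊔ lsuc p) where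
    field
      Member    : Pred Carrierᴹ p
      ≈ᴹ-closed : ∀ {x y} → x ≈ᴹ y → x ∈ Member → y ∈ Member
      0ᴹ-closed : 0ᴹ ∈ Member
      +ᴹ-closed : ∀ {x y} → x ∈ Member → y ∈ Member → x +ᴹ y ∈ Member
      *ₗ-closed : ∀ a {x} → x ∈ Member → a *ₗ x ∈ Member

  open Subspace

  linearCombination : ∀ {k} → (Fin k → R.Carrier) → (Fin k → Carrierᴹ) → Carrierᴹ
  linearCombination a v = S.sum (λ i → a i *ₗ v i)

  LinearlyIndependent : ∀ {k} → (Fin k → Carrierᴹ) → Set (c ⊔ ℓ ⊔ ℓm)
  LinearlyIndependent v = ∀ a → linearCombination a v ≈ᴹ 0ᴹ → ∀ i → a i R.≈ R.0#

  IsLinearCombination : ∀ {k} → (Fin k → Carrierᴹ) → Pred Carrierᴹ (c ⊔ ℓm)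
  IsLinearCombination v x = ∃[ a ] x ≈ᴹ linearCombination a v

  IsBasis : ∀ {k p} → Subspace p → (Fin k → Carrierᴹ) → Set (c ⊔ ℓ ⊔ m ⊔ ℓm ⊔ p)
  IsBasis U v = (∀ i → v i ∈ Member U) × LinearlyIndependent v × Member U ⊆ IsLinearCombination v

  HasDimension : ∀ {p} → Subspace p → ℕ → Set (c ⊔ ℓ ⊔ m ⊔ ℓm ⊔ p)
  HasDimension U k = ∃[ v ] IsBasis {k} U v

  combination-0 : ∀ {k} (v : Fin k → Carrierᴹ) → linearCombination (λ _ → R.0#) v ≈ᴹ 0ᴹ
  combination-0 {k} v = ≈ᴹ-trans (S.sum-cong-≋ (λ i → *ₗ-zeroˡ (v i))) (S.sum-replicate-zero k)

  combination-+ : ∀ {k} (a b : Fin k → R.Carrier) (v : Fin k → Carrierᴹ) →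
    linearCombination (λ i → a i R.+ b i) v ≈ᴹ linearCombination a v +ᴹ linearCombination b v
  combination-+ a b v = ≈ᴹ-trans (S.sum-cong-≋ (λ i → *ₗ-distribʳ (v i) (a i) (b i)))
    (S.∑-distrib-+ (λ i → a i *ₗ v i) (λ i → b i *ₗ v i))

  combination-* : ∀ {k} b (a : Fin k → R.Carrier) (v : Fin k → Carrierᴹ) →
    linearCombination (λ i → b R.* a i) v ≈ᴹ b *ₗ linearCombination a v
  combination-* {zero}  b a v = ≈ᴹ-sym (*ₗ-zeroʳ b)
  combination-* {suc k} b a v = ≈ᴹ-trans
    (+ᴹ-cong (*ₗ-assoc b (a fzero) (v fzero))
             (combination-* b (λ i → a (fsuc i)) (λ i → v (fsuc i))))
    (≈ᴹ-sym (*ₗ-distribˡ b _ _))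

  span : ∀ {k} → (Fin k → Carrierᴹ) → Subspace (c ⊔ ℓm)
  span v .Member = IsLinearCombination v
  span v .≈ᴹ-closed x≈y (a , x≈a) = a , ≈ᴹ-trans (≈ᴹ-sym x≈y) x≈a
  span v .0ᴹ-closed = (λ _ → R.0#) , ≈ᴹ-sym (combination-0 v)
  span v .+ᴹ-closed (a , x≈a) (b , y≈b) =
    (λ i → a i R.+ b i) , ≈ᴹ-trans (+ᴹ-cong x≈a y≈b) (≈ᴹ-sym (combination-+ a b v))
  span v .*ₗ-closed b (a , x≈a) =
    (λ i → b R.* a i) , ≈ᴹ-trans (*ₗ-congˡ x≈a) (≈ᴹ-sym (combination-* b a v))

-- The carrier of a finite field is finite up to its equality.  Equality is then
-- decidable and the apartness relation of the Heyting field is inequality, so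
-- this is a field in the classical sense.
record FiniteField (c ℓ₁ ℓ₂ : Level) : Set (lsuc (c ⊔ ℓ₁ ⊔ ℓ₂)) where
  field
    heytingField : HeytingField c ℓ₁ ℓ₂

  open HeytingField heytingField public using (heytingCommutativeRing)
  open HeytingCommutativeRing heytingCommutativeRing public using (commutativeRing)

  field
    order  : ℕ
    finite : Inverse (CommutativeRing.setoid commutativeRing) (setoid (Fin order))

IsMinimum : ∀ {p} → Pred ℕ p → ℕ → Set p
IsMinimum P k = k ∈ P × (∀ {r} → r ∈ P → k ≤ r)

module Codes {c ℓ₁ ℓ₂ : Level} (F : FiniteField c ℓ₁ ℓ₂) (n : ℕ) where
  open FiniteField F using (commutativeRing)
  open CommutativeRing commutativeRing using (_≈_; 0#)

  column-module : Module commutativeRing c ℓ₁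
  column-module = power n ring-module

  matrix-module : Module commutativeRing c ℓ₁
  matrix-module = power n column-module

  open Module matrix-module using (_≉ᴹ_; 0ᴹ) renaming (Carrierᴹ to Matrix) public

  private
    module Vec = LinearAlgebra column-module
    module Mat = LinearAlgebra matrix-module

  HasRank : Matrix → ℕ → Set (c ⊔ ℓ₁)
  HasRank A r = Vec.HasDimension (Vec.span (λ j i → A i j)) r

  Code : Set (lsuc (c ⊔ ℓ₁))
  Code = Mat.Subspace (c ⊔ ℓ₁)

  SupportedOn : FerrersDiagram n → Pred Matrix ℓ₁
  SupportedOn D A = ∀ i j → (i , j) ∉ FerrersDiagram.Cell D → A i j ≈ 0#

  module _ (C : Code) where
    open Mat.Subspace C using (Member)

    NonzeroRank : Pred ℕ (c ⊔ ℓ₁)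
    NonzeroRank r = ∃[ A ] A ∈ Member × A ≉ᴹ 0ᴹ × HasRank A r

    HasMinimumRankDistance : ℕ → Set (c ⊔ ℓ₁)
    HasMinimumRankDistance = IsMinimum NonzeroRank

    -- The zero code, whose minimum distance is undefined, counts as a
    -- [D , 0 , d] code for every d.
    IsCode : FerrersDiagram n → ℕ → ℕ → Set (c ⊔ ℓ₁)
    IsCode D k d =
      Member ⊆ SupportedOn D ×
      Mat.HasDimension C k ×
      (k ≡ 0 ⊎ HasMinimumRankDistance d)

    IsMFDCode : FerrersDiagram n → ℕ → ℕ → Set (c ⊔ ℓ₁)
    IsMFDCode D k d = IsCode D k d × k ≡ ν-min D d

{-# OPTIONS --safe #-}

-- Let q = |F|, φ x = x^q and θ = φ - 1.  In a field K over F with elements y_0 = 1, θ y_{i+1} = y_i, the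
-- spaces V_i = ker θ^i = ⟨y_0, ..., y_{i-1}⟩ satisfy V_i V_j ⊆ V_{i+j-1}.  Hence an operator Σ a_k θ^k with
-- a_k ∈ V_{k+1} has an upper triangular matrix over F in the basis y_0, ..., y_{n-1}, and, unless it is 0,
-- it has rank at least d if its θ-degree is at most n - d, because its kernel contains at most n - d
-- elements independent over F (a Moore determinant argument).  To get K, adjoin roots of Y^q - Y - y_i one
-- after the other; φ has finite order on the resulting finite ring, which is therefore von Neumann
-- regular, and a primitive idempotent cuts a field out of it.
--
-- Let ν_min(D, d) be attained at j and put s = d - 1 - j.  Deleting s rows and j columns removes at most
-- d - 1 positions from every diagonal, so MDS-constructibility forces every diagonal that meets the
-- residue of D to meet the deleted rows and columns inside D.  A triangular operator as above is
-- determined by its entries outside the deleted rows and columns, and by counting these can be prescribed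
-- freely.  Prescribing zero outside D gives a code of dimension ν_min(D, d), and prescribing a single
-- nonzero entry gives a word of rank at most s + j + 1 = d.

module Submission where

open import Defs
open import Data.Nat.Base using (ℕ; _≤_)
open import Data.Product.Base using (∃-syntax)
open import Level using (Level)

open import Algebra.Apartness.Bundles using (HeytingField)
open import Algebra.Bundles using (CommutativeRing)
open import Algebra.Module.Bundles using (Module)
open import Algebra.Module.Construct.TensorUnit using () renaming (⟨module⟩ to ring-module)
import Algebra.Properties.CommutativeMonoid.Sum as MonoidSum
import Algebra.Properties.CommutativeSemigroup as CommutativeSemigroupProperties
import Algebra.Properties.CommutativeSemiring.Binomial as Binomial
import Algebra.Properties.CommutativeSemiring.Exp as Exp
import Algebra.Properties.Ring as RingProperties
import Algebra.Properties.Semiring.Exp as SemiringExp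
import Algebra.Properties.Semiring.Mult as SemiringMult
import Algebra.Properties.Semiring.Sum as SemiringSum
open import Data.Bool.Base using (true; false; if_then_else_)
open import Data.Empty using (⊥-elim)
open import Data.Fin.Base using (Fin; toℕ; fromℕ; fromℕ<; inject₁; punchIn; finToFun; funToFin; combine; remQuot)
  renaming (zero to fzero; suc to fsuc)
open import Data.Fin.Permutation using (Permutation; permutation)
open import Data.Fin.Properties using
  (suc-injective; 0≢1+n; any?; all?; punchInᵢ≢i; toℕ<n; toℕ-injective; toℕ-inject₁; toℕ-fromℕ; toℕ-fromℕ<;
   combine-remQuot; remQuot-combine; finToFun-funToFin)
  renaming (_≟_ to _≟ᶠ_)
open import Data.List.Base using
  (List; []; _∷_; _++_; allFin; cartesianProduct; filter; length; lookup; map; tabulate; take; upTo)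
import Data.List.Extrema as Extrema
open import Data.List.Membership.Propositional using () renaming (_∈_ to _∈ᴸ_)
open import Data.List.Membership.Propositional.Properties using
  (∈-tabulate⁺; ∈-map⁺; ∈-map⁻; ∈-upTo⁻; ∈-lookup; ∈-filter⁻)
open import Data.List.Properties using (filter-++; length-++; map-tabulate)
import Data.List.Relation.Unary.All as All
open import Data.List.Relation.Unary.AllPairs using (_∷_)
open import Data.List.Relation.Unary.Any using (here; there)
open import Data.List.Relation.Unary.Unique.Propositional using (Unique)
open import Data.List.Relation.Unary.Unique.Propositional.Properties using (filter⁺; cartesianProduct⁺; allFin⁺)
open import Data.Nat.Base using (zero; suc; z≤n; s≤s; _<_)
  renaming (_+_ to _+ᴺ_; _*_ to _*ᴺ_; _^_ to _^ᴺ_; _∸_ to _∸ᴺ_)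
open import Data.Nat.Combinatorics using (nCn≡1; nC1≡n) renaming (_C_ to _choose_)
open import Data.Nat.GeneralisedArithmetic using (fold; fold-+)
import Data.Nat.ListAction as ListAction
import Data.Nat.Properties as ℕₚ
open import Data.Product.Base using (_×_; _,_; proj₁; proj₂)
open import Data.Sum.Base using (_⊎_; inj₁; inj₂)
open import Data.Vec.Functional using () renaming (_∷_ to _∷ᵛ_)
open import Function.Bundles using (Inverse)
open import Level using (0ℓ; _⊔_) renaming (suc to lsuc)
open import Relation.Binary.PropositionalEquality as ≡ using (_≡_)
import Relation.Binary.Reasoning.Setoid as SetoidReasoning
open import Relation.Nullary using (¬_; Dec; yes; no; does)
open import Relation.Nullary.Decidable using (map′; _×-dec_; ¬?)
open import Relation.Unary using (Pred; Decidable)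
open import Relation.Unary.Properties using (_∩?_)

-- Putting a separate MDS code on every diagonal works over large fields only, because MDS codes of
-- the required lengths need not exist over small ones. So the diagonals are not filled
-- independently: a single space of operators serves them all. Expanding in powers of θ instead of φ
-- is essential. In the basis y_i the map φ is unitriangular and lowers no index, whereas θ^k lowers
-- indices by k, which leaves room for a coefficient that raises them again; the twisted product
-- rule θ(xz) = θ(x) φ(z) + x θ(z) limits how far. The operators are restricted further, to those
-- lowering indices by at least a fixed offset, the distance from the main diagonal of the first
-- diagonal that meets the residue. Nearer diagonals may leave D inside the deleted rows and
-- columns, so the words must vanish on them. Irreducibility of Y^q - Y - y_i is never tested, so
-- the rings on the way may have zero divisors. The hypothesis on D is one equation between two
-- sums. It speaks about single diagonals because the inequality behind it holds on each diagonal.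

record DiscreteField (c ℓ : Level) : Set (lsuc (c ⊔ ℓ)) where
  field
    commutativeRing : CommutativeRing c ℓ
  open CommutativeRing commutativeRing public
  field
    zero⊎unit : ∀ x → x ≈ 0# ⊎ ∃[ y ] x * y ≈ 1#
    1≉0       : ¬ 1# ≈ 0#

-- Linear maps between coordinate spaces.

module _ {c ℓ : Level} (R : CommutativeRing c ℓ) where
  open CommutativeRing R

  -- Functions with linearity proofs rather than matrices, so that selections and compositions are
  -- linear by construction; `apply-basis` recovers the entries where they matter.
  record LinearMap (m k : ℕ) : Set (c ⊔ ℓ) where
    field
      apply  : (Fin m → Carrier) → Fin k → Carrier
      cong   : ∀ {u v} → (∀ i → u i ≈ v i) → ∀ i → apply u i ≈ apply v i
      +-homo : ∀ u v i → apply (λ j → u j + v j) i ≈ apply u i + apply v i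
      *-homo : ∀ a u i → apply (λ j → a * u j) i ≈ a * apply u i

module LinearMaps {c ℓ : Level} (R : CommutativeRing c ℓ) where
  open CommutativeRing R
  open LinearMap
  open SetoidReasoning setoid
  open SemiringSum semiring using (sum; sum-cong-≋; sum-replicate-zero; ∑-distrib-+; *-distribˡ-sum)
  open CommutativeSemigroupProperties +-commutativeSemigroup using (interchange)

  private variable
    l m k : ℕ

  Injective : LinearMap R m k → Set (c ⊔ ℓ)
  Injective A = ∀ u → (∀ i → apply A u i ≈ 0#) → ∀ i → u i ≈ 0#

  apply-0 : (A : LinearMap R m k) → ∀ {u} → (∀ i → u i ≈ 0#) → ∀ i → apply A u i ≈ 0#
  apply-0 A {u} u≈0 i = begin
    apply A u i                 ≈⟨ cong A (λ j → trans (u≈0 j) (sym (zeroˡ (u j)))) i ⟩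
    apply A (λ j → 0# * u j) i  ≈⟨ *-homo A 0# u i ⟩
    0# * apply A u i            ≈⟨ zeroˡ _ ⟩
    0#                          ∎

  infixr 9 _∘ₗ_
  _∘ₗ_ : LinearMap R m k → LinearMap R l m → LinearMap R l k
  A ∘ₗ B = record
    { apply  = λ u → apply A (apply B u)
    ; cong   = λ p → cong A (cong B p)
    ; +-homo = λ u v i → trans (cong A (+-homo B u v) i) (+-homo A _ _ i)
    ; *-homo = λ a u i → trans (cong A (*-homo B a u) i) (*-homo A _ _ i)
    }

  select : (Fin k → Fin m) → LinearMap R m k
  select f = record
    { apply  = λ u i → u (f i)
    ; cong   = λ p i → p (f i)
    ; +-homo = λ _ _ _ → refl
    ; *-homo = λ _ _ _ → refl
    }

  cons : LinearMap R m 1 → LinearMap R m k → LinearMap R m (suc k)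
  cons A B = record
    { apply  = λ u → apply A u fzero ∷ᵛ apply B u
    ; cong   = λ p → λ { fzero → cong A p fzero ; (fsuc i) → cong B p i }
    ; +-homo = λ u v → λ { fzero → +-homo A u v fzero ; (fsuc i) → +-homo B u v i }
    ; *-homo = λ a u → λ { fzero → *-homo A a u fzero ; (fsuc i) → *-homo B a u i }
    }

  append : ∀ {j} → LinearMap R m j → LinearMap R m k → LinearMap R m (j +ᴺ k)
  append {j = zero}  A B = B
  append {j = suc j} A B = cons (select (λ _ → fzero) ∘ₗ A) (append (select fsuc ∘ₗ A) B)

  append-kernel : ∀ {j} (A : LinearMap R m j) (B : LinearMap R m k) {u} → (∀ i → apply (append A B) u i ≈ 0#) →
    (∀ i → apply A u i ≈ 0#) × (∀ i → apply B u i ≈ 0#)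
  append-kernel {j = zero}  A B p = (λ ()) , p
  append-kernel {j = suc j} A B p with append-kernel (select fsuc ∘ₗ A) B (λ i → p (fsuc i))
  ... | A≈0 , B≈0 = (λ { fzero → p fzero ; (fsuc i) → A≈0 i }) , B≈0

  zeroₗ : LinearMap R m k
  zeroₗ = record
    { apply  = λ _ _ → 0#
    ; cong   = λ _ _ → refl
    ; +-homo = λ _ _ _ → sym (+-identityˡ 0#)
    ; *-homo = λ a _ _ → sym (zeroʳ a)
    }

  combination-+ : ∀ (u v w : Fin m → Carrier) →
    sum (λ j → (u j + v j) * w j) ≈ sum (λ j → u j * w j) + sum (λ j → v j * w j)
  combination-+ u v w = trans (sum-cong-≋ (λ j → distribʳ (w j) (u j) (v j))) (∑-distrib-+ (λ j → u j * w j) (λ j → v j * w j))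

  combination-* : ∀ a (u w : Fin m → Carrier) →
    sum (λ j → (a * u j) * w j) ≈ a * sum (λ j → u j * w j)
  combination-* a u w = trans (sum-cong-≋ (λ j → *-assoc a (u j) (w j))) (sym (*-distribˡ-sum a (λ j → u j * w j)))

  fromMatrix : (Fin k → Fin m → Carrier) → LinearMap R m k
  fromMatrix M = record
    { apply  = λ u i → sum (λ j → u j * M i j)
    ; cong   = λ p i → sum-cong-≋ (λ j → *-congʳ (p j))
    ; +-homo = λ u v i → combination-+ u v (M i)
    ; *-homo = λ a u i → combination-* a u (M i)
    }

  infixl 6 _+ₗ_
  _+ₗ_ : LinearMap R m k → LinearMap R m k → LinearMap R m k
  A +ₗ B = record
    { apply  = λ u i → apply A u i + apply B u i
    ; cong   = λ p i → +-cong (cong A p i) (cong B p i)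
    ; +-homo = λ u v i → trans (+-cong (+-homo A u v i) (+-homo B u v i)) (interchange _ _ _ _)
    ; *-homo = λ a u i → trans (+-cong (*-homo A a u i) (*-homo B a u i)) (sym (distribˡ a _ _))
    }

  -- Truncates when `k` exceeds `m`. It parametrises a coordinate subspace in `kernel` and gives the
  -- coordinates of a short polynomial in `act-1`.
  pad : ∀ {k m} → (Fin k → Carrier) → Fin m → Carrier
  pad {zero}  u _        = 0#
  pad {suc k} u fzero    = u fzero
  pad {suc k} u (fsuc i) = pad (λ j → u (fsuc j)) i

  padₗ : LinearMap R k m
  padₗ = record { apply = pad ; cong = pad-cong ; +-homo = pad-+ ; *-homo = pad-* }
    where
    pad-cong : ∀ {k m} {u v : Fin k → Carrier} → (∀ i → u i ≈ v i) → ∀ (i : Fin m) → pad u i ≈ pad v i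
    pad-cong {zero}  p i        = refl
    pad-cong {suc k} p fzero    = p fzero
    pad-cong {suc k} p (fsuc i) = pad-cong (λ j → p (fsuc j)) i
    pad-+ : ∀ {k m} (u v : Fin k → Carrier) (i : Fin m) → pad (λ j → u j + v j) i ≈ pad u i + pad v i
    pad-+ {zero}  u v i        = sym (+-identityˡ 0#)
    pad-+ {suc k} u v fzero    = refl
    pad-+ {suc k} u v (fsuc i) = pad-+ (λ j → u (fsuc j)) (λ j → v (fsuc j)) i
    pad-* : ∀ {k m} a (u : Fin k → Carrier) (i : Fin m) → pad (λ j → a * u j) i ≈ a * pad u i
    pad-* {zero}  a u i        = sym (zeroʳ a)
    pad-* {suc k} a u fzero    = refl
    pad-* {suc k} a u (fsuc i) = pad-* a (λ j → u (fsuc j)) i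

  pad-injective : k ≤ m → Injective (padₗ {k} {m})
  pad-injective (s≤s k≤m) u u≈0 fzero    = u≈0 fzero
  pad-injective (s≤s k≤m) u u≈0 (fsuc i) = pad-injective k≤m (λ j → u (fsuc j)) (λ j → u≈0 (fsuc j)) i

  e₀ : Fin (suc m) → Carrier
  e₀ = 1# ∷ᵛ λ _ → 0#

  δ : Fin m → Fin m → Carrier
  δ fzero    fzero    = 1#
  δ fzero    (fsuc j) = 0#
  δ (fsuc i) fzero    = 0#
  δ (fsuc i) (fsuc j) = δ i j

  sum-δ : ∀ (a : Fin m → Carrier) k → sum (λ j → a j * δ k j) ≈ a k
  sum-δ {suc m} a fzero = trans
    (+-cong (*-identityʳ _) (trans (sum-cong-≋ (λ j → zeroʳ (a (fsuc j)))) (sum-replicate-zero m))) (+-identityʳ _)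
  sum-δ {suc m} a (fsuc k) = trans (+-cong (zeroʳ _) (sum-δ (λ j → a (fsuc j)) k)) (+-identityˡ _)

  apply-basis : (A : LinearMap R m k) → ∀ u i → apply A u i ≈ sum (λ j → u j * apply A (δ j) i)
  apply-basis {zero}  A u i = apply-0 A (λ ()) i
  apply-basis {suc m} A u i = begin
    apply A u i                                                ≈⟨ cong A split i ⟩
    apply A (λ j → u fzero * δ fzero j + (0# ∷ᵛ u′) j) i         ≈⟨ +-homo A _ _ i ⟩
    apply A (λ j → u fzero * δ fzero j) i + apply A (0# ∷ᵛ u′) i ≈⟨ +-cong (*-homo A (u fzero) (δ fzero) i) rest ⟩
    sum (λ j → u j * apply A (δ j) i)                          ∎
    where
    u′ : Fin m → Carrier
    u′ j = u (fsuc j)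
    split : ∀ j → u j ≈ u fzero * δ fzero j + (0# ∷ᵛ u′) j
    split fzero    = sym (trans (+-identityʳ _) (*-identityʳ _))
    split (fsuc j) = sym (trans (+-congʳ (zeroʳ _)) (+-identityˡ _))
    rest : apply A (0# ∷ᵛ u′) i ≈ sum (λ j → u′ j * apply A (δ (fsuc j)) i)
    rest = trans (cong A (λ { fzero → refl ; (fsuc j) → refl }) i)
      (trans (apply-basis A′ u′ i) (sum-cong-≋ column))
      where
      A′ : LinearMap R m _
      A′ = A ∘ₗ cons zeroₗ (select (λ j → j))
      column : ∀ j → u′ j * apply A′ (δ j) i ≈ u′ j * apply A (δ (fsuc j)) i
      column j = *-congˡ (cong A (λ { fzero → refl ; (fsuc j) → refl }) i)

  apply-∷ : (A : LinearMap R (suc m) k) → ∀ x v i → apply A (x ∷ᵛ v) i ≈ x * apply A e₀ i + apply A (0# ∷ᵛ v) i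
  apply-∷ A x v i = begin
    apply A (x ∷ᵛ v) i                                      ≈⟨ cong A split i ⟩
    apply A (λ j → x * e₀ j + (0# ∷ᵛ v) j) i                ≈⟨ +-homo A _ _ i ⟩
    apply A (λ j → x * e₀ j) i + apply A (0# ∷ᵛ v) i        ≈⟨ +-congʳ (*-homo A x e₀ i) ⟩
    x * apply A e₀ i + apply A (0# ∷ᵛ v) i                  ∎
    where
    split : ∀ j → (x ∷ᵛ v) j ≈ x * e₀ j + (0# ∷ᵛ v) j
    split fzero    = sym (trans (+-identityʳ _) (*-identityʳ x))
    split (fsuc j) = sym (trans (+-congʳ (zeroʳ x)) (+-identityˡ _))

-- Kernels of linear maps and roots of polynomials over a field.

module FieldLinearAlgebra {c ℓ : Level} (K : DiscreteField c ℓ) where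
  open DiscreteField K
  open LinearMap
  open LinearMaps commutativeRing
  open SetoidReasoning setoid
  open RingProperties ring using
    (-‿distribˡ-*; -‿distribʳ-*; -‿involutive; x∙y⁻¹≈ε⇒x≈y; x≈y⇒x∙y⁻¹≈ε; [y-z]x≈yx-zx; +-inverseʳ-unique)
  open SemiringSum semiring using (sum-cong-≋; sum-replicate-zero)
  open CommutativeSemigroupProperties +-commutativeSemigroup using (interchange)
  open CommutativeSemigroupProperties *-commutativeSemigroup using (x∙yz≈y∙xz)

  private
    L : ℕ → ℕ → Set (c ⊔ ℓ)
    L = LinearMap commutativeRing

  ≈0? : ∀ x → Dec (x ≈ 0#)
  ≈0? x with zero⊎unit x
  ... | inj₁ x≈0       = yes x≈0
  ... | inj₂ (y , xy≈1) = no λ x≈0 → 1≉0 (trans (sym xy≈1) (trans (*-congʳ x≈0) (zeroˡ y)))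

  ≈? : ∀ x y → Dec (x ≈ y)
  ≈? x y with ≈0? (x - y)
  ... | yes p = yes (x∙y⁻¹≈ε⇒x≈y x y p)
  ... | no ¬p = no λ x≈y → ¬p (x≈y⇒x∙y⁻¹≈ε x≈y)

  *-cancel-0 : ∀ {x y} → ¬ x ≈ 0# → x * y ≈ 0# → y ≈ 0#
  *-cancel-0 {x} {y} x≉0 xy≈0 with zero⊎unit x
  ... | inj₁ x≈0        = ⊥-elim (x≉0 x≈0)
  ... | inj₂ (z , xz≈1) = begin
    y            ≈⟨ *-identityˡ y ⟨
    1# * y       ≈⟨ *-congʳ (trans (sym xz≈1) (*-comm x z)) ⟩
    z * x * y    ≈⟨ *-assoc z x y ⟩
    z * (x * y)  ≈⟨ *-congˡ xy≈0 ⟩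
    z * 0#       ≈⟨ zeroʳ z ⟩
    0#           ∎

  *-cancelʳ-distinct : ∀ {x y z} → ¬ x ≈ y → x * z ≈ y * z → z ≈ 0#
  *-cancelʳ-distinct {x} {y} {z} x≉y xz≈yz = *-cancel-0 (λ p → x≉y (x∙y⁻¹≈ε⇒x≈y x y p))
    (trans ([y-z]x≈yx-zx z x y) (x≈y⇒x∙y⁻¹≈ε xz≈yz))

  -- One step of Gaussian elimination. An invertible first coefficient expresses the first
  -- coordinate through the others; a zero one leaves that coordinate free and the search moves on.
  -- If all coefficients vanish, the last coordinate is set to 0, so exactly one parameter is given
  -- up in every case.
  hyperplane : ∀ {m} (w : L (suc m) 1) →
    ∃[ J ] Injective {m} {suc m} J × (∀ u → apply w (apply J u) fzero ≈ 0#)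
  hyperplane {m} w with zero⊎unit (apply w e₀ fzero)
  ... | inj₂ (z , w₀z≈1) = J , (λ u p i → p (fsuc i)) , J-kernel
    where
    w₀ = apply w e₀ fzero
    shift : L m (suc m)
    shift = cons zeroₗ (select (λ i → i))
    J : L m (suc m)
    J = cons (fromMatrix (λ _ _ → - z) ∘ₗ (w ∘ₗ shift)) (select (λ i → i))
    J-kernel : ∀ u → apply w (apply J u) fzero ≈ 0#
    J-kernel u = begin
      apply w (apply J u) fzero                ≈⟨ apply-∷ w _ u fzero ⟩
      (t * - z + 0#) * w₀ + apply w (0# ∷ᵛ u) fzero ≈⟨ +-cong (*-congʳ (+-identityʳ _)) (cong w (λ { fzero → refl ; (fsuc i) → refl }) fzero) ⟩
      t * - z * w₀ + t                         ≈⟨ +-congʳ (*-assoc t (- z) w₀) ⟩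
      t * (- z * w₀) + t                       ≈⟨ +-congʳ (*-congˡ (trans (sym (-‿distribˡ-* z w₀)) (-‿cong (trans (*-comm z w₀) w₀z≈1)))) ⟩
      t * - 1# + t                             ≈⟨ +-congˡ (*-identityʳ t) ⟨
      t * - 1# + t * 1#                        ≈⟨ distribˡ t (- 1#) 1# ⟨
      t * (- 1# + 1#)                          ≈⟨ *-congˡ (-‿inverseˡ 1#) ⟩
      t * 0#                                   ≈⟨ zeroʳ t ⟩
      0#                                       ∎
      where t = apply w (apply shift u) fzero
  hyperplane {zero}  w | inj₁ _    = zeroₗ , (λ u p ()) , λ u → apply-0 w (λ _ → refl) fzero
  hyperplane {suc m} w | inj₁ w₀≈0 with hyperplane (w ∘ₗ cons zeroₗ (select (λ i → i)))
  ... | J′ , J′-injective , J′-kernel = J , J-injective , J-kernel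
    where
    J : L (suc m) (suc (suc m))
    J = cons (select (λ _ → fzero)) (J′ ∘ₗ select fsuc)
    J-injective : Injective J
    J-injective u p fzero    = p fzero
    J-injective u p (fsuc i) = J′-injective (λ j → u (fsuc j)) (λ j → p (fsuc j)) i
    J-kernel : ∀ u → apply w (apply J u) fzero ≈ 0#
    J-kernel u = begin
      apply w (apply J u) fzero                         ≈⟨ apply-∷ w _ _ fzero ⟩
      u fzero * apply w e₀ fzero + apply w (0# ∷ᵛ v) fzero ≈⟨ +-cong (trans (*-congˡ w₀≈0) (zeroʳ _))
                                                              (trans (cong w (λ { fzero → refl ; (fsuc i) → refl }) fzero) (J′-kernel (λ j → u (fsuc j)))) ⟩
      0# + 0#                                           ≈⟨ +-identityˡ 0# ⟩
      0#                                                ∎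
      where v = apply J′ (λ j → u (fsuc j))

  -- Each equation is imposed on the parametrised solutions of the previous ones and costs one
  -- parameter. Every rank estimate below is an instance of this count.
  kernel : ∀ k r {m} → k +ᴺ r ≤ m → (A : L m k) →
    ∃[ J ] Injective {r} {m} J × (∀ u i → apply A (apply J u) i ≈ 0#)
  kernel zero    r r≤m A = padₗ , pad-injective r≤m , λ u ()
  kernel (suc k) r (s≤s k+r≤m) A with hyperplane (select (λ _ → fzero) ∘ₗ A)
  ... | J , J-injective , J-kernel with kernel k r k+r≤m (select fsuc ∘ₗ A ∘ₗ J)
  ... | J′ , J′-injective , J′-kernel = J ∘ₗ J′ , (λ u p → J′-injective u (J-injective _ p)) ,
    λ u → λ { fzero → J-kernel _ ; (fsuc i) → J′-kernel u i }

  -- The system A u = t b has m equations in the m + 1 unknowns (t, u), hence a nonzero solution.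
  -- Injectivity excludes t = 0, and dividing by t solves A u = b.
  injective⇒surjective : ∀ {m} (A : L m m) → Injective A → ∀ (b : Fin m → Carrier) → ∃[ u ] (∀ i → apply A u i ≈ b i)
  injective⇒surjective {m} A A-injective b = solution
    where
    B : L (suc m) m
    B = fromMatrix (λ i → - b i ∷ᵛ λ _ → 0#) +ₗ A ∘ₗ select fsuc

    B-apply : ∀ (v : Fin (suc m) → Carrier) i → apply B v i ≈ v fzero * - b i + apply A (λ j → v (fsuc j)) i
    B-apply v i = +-congʳ (trans (+-congˡ (trans (sum-cong-≋ (λ j → zeroʳ (v (fsuc j)))) (sum-replicate-zero m))) (+-identityʳ _))

    solution : ∃[ u ] (∀ i → apply A u i ≈ b i)
    solution with kernel m 1 (ℕₚ.≤-reflexive (ℕₚ.+-comm m 1)) B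
    ... | J , J-injective , J-kernel = go (zero⊎unit (v fzero))
      where
      v = apply J e₀
      v≉0 : ¬ (∀ i → v i ≈ 0#)
      v≉0 p = 1≉0 (J-injective e₀ p fzero)
      relation : ∀ i → v fzero * - b i + apply A (λ j → v (fsuc j)) i ≈ 0#
      relation i = trans (sym (B-apply v i)) (J-kernel e₀ i)
      go : v fzero ≈ 0# ⊎ ∃[ z ] v fzero * z ≈ 1# → ∃[ u ] (∀ i → apply A u i ≈ b i)
      go (inj₁ v₀≈0) = ⊥-elim (v≉0 λ { fzero → v₀≈0 ; (fsuc i) → A-injective (λ j → v (fsuc j)) tail-kernel i })
        where
        tail-kernel : ∀ i → apply A (λ j → v (fsuc j)) i ≈ 0#
        tail-kernel i = begin
          apply A (λ j → v (fsuc j)) i                       ≈⟨ +-identityˡ _ ⟨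
          0# + apply A (λ j → v (fsuc j)) i                  ≈⟨ +-congʳ (trans (*-congʳ v₀≈0) (zeroˡ _)) ⟨
          v fzero * - b i + apply A (λ j → v (fsuc j)) i     ≈⟨ relation i ⟩
          0#                                                 ∎
      go (inj₂ (z , v₀z≈1)) = (λ j → z * v (fsuc j)) , λ i → begin
        apply A (λ j → z * v (fsuc j)) i    ≈⟨ *-homo A z (λ j → v (fsuc j)) i ⟩
        z * apply A (λ j → v (fsuc j)) i    ≈⟨ *-congˡ (+-inverseʳ-unique _ _ (relation i)) ⟩
        z * - (v fzero * - b i)             ≈⟨ *-congˡ (trans (-‿distribʳ-* _ _) (*-congˡ (-‿involutive (b i)))) ⟩
        z * (v fzero * b i)                 ≈⟨ *-assoc z _ _ ⟨
        z * v fzero * b i                   ≈⟨ *-congʳ (trans (*-comm z _) v₀z≈1) ⟩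
        1# * b i                            ≈⟨ *-identityˡ (b i) ⟩
        b i                                 ∎

  -- Horner's scheme, constant term first.
  eval : ∀ {m} → (Fin m → Carrier) → Carrier → Carrier
  eval {zero}  p x = 0#
  eval {suc m} p x = p fzero + x * eval (λ i → p (fsuc i)) x

  -- Synthetic division by X - r: the coefficients are the Horner values at r.
  quotient : ∀ {m} → (Fin (suc m) → Carrier) → Carrier → Fin m → Carrier
  quotient {suc m} p r fzero    = eval (λ i → p (fsuc i)) r
  quotient {suc m} p r (fsuc i) = quotient (λ j → p (fsuc j)) r i

  -- This is p(x) - p(r) = (x - r) Q(x) with the negative terms moved across, so that the induction
  -- runs without subtraction.
  eval-division : ∀ {m} (p : Fin (suc m) → Carrier) r x →
    eval p x + r * eval (quotient p r) x ≈ eval p r + x * eval (quotient p r) x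
  eval-division {zero}  p r x = trans (+-cong (+-congˡ (zeroʳ x)) (zeroʳ r))
    (sym (+-cong (+-congˡ (zeroʳ r)) (zeroʳ x)))
  eval-division {suc m} p r x = begin
    p₀ + x * A x + r * (A r + x * Q)       ≈⟨ +-congˡ (distribˡ r _ _) ⟩
    p₀ + x * A x + (r * A r + r * (x * Q)) ≈⟨ interchange _ _ _ _ ⟩
    p₀ + r * A r + (x * A x + r * (x * Q)) ≈⟨ +-congˡ (+-congˡ (x∙yz≈y∙xz r x Q)) ⟩
    p₀ + r * A r + (x * A x + x * (r * Q)) ≈⟨ +-congˡ (distribˡ x _ _) ⟨
    p₀ + r * A r + x * (A x + r * Q)       ≈⟨ +-congˡ (*-congˡ (eval-division tail r x)) ⟩
    p₀ + r * A r + x * (A r + x * Q)       ∎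
    where
    p₀ = p fzero
    tail : Fin (suc m) → Carrier
    tail i = p (fsuc i)
    A : Carrier → Carrier
    A = eval tail
    Q = eval (quotient tail r) x

  -- The Horner values satisfy h_i = p_i + r h_(i+1); when all of them vanish, so does every p_i.
  quotient≈0⇒≈0 : ∀ {m} (p : Fin (suc m) → Carrier) r →
    eval p r ≈ 0# → (∀ i → quotient p r i ≈ 0#) → ∀ i → p i ≈ 0#
  quotient≈0⇒≈0 {m} p r p≈0 q≈0 fzero = begin
    p fzero                                      ≈⟨ +-identityʳ _ ⟨
    p fzero + 0#                                 ≈⟨ +-congˡ (trans (*-congˡ (tail≈0 m p q≈0)) (zeroʳ r)) ⟨
    eval p r                                     ≈⟨ p≈0 ⟩
    0#                                           ∎
    where
    tail≈0 : ∀ m (p : Fin (suc m) → Carrier) → (∀ i → quotient p r i ≈ 0#) → eval (λ i → p (fsuc i)) r ≈ 0#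
    tail≈0 zero    p q≈0 = refl
    tail≈0 (suc m) p q≈0 = q≈0 fzero
  quotient≈0⇒≈0 {suc m} p r p≈0 q≈0 (fsuc i) =
    quotient≈0⇒≈0 (λ j → p (fsuc j)) r (q≈0 fzero) (λ j → q≈0 (fsuc j)) i

  -- Dividing by X - r₀ removes one coefficient and one root together, so counting coefficients
  -- replaces the degree.
  root-bound : ∀ {m} (p r : Fin m → Carrier) → (∀ {i j} → r i ≈ r j → i ≡ j) →
    (∀ i → eval p (r i) ≈ 0#) → ∀ i → p i ≈ 0#
  root-bound {suc m} p r distinct roots = quotient≈0⇒≈0 p r₀ (roots fzero)
    (root-bound (quotient p r₀) (λ i → r (fsuc i)) (λ e → suc-injective (distinct e)) λ i →
      *-cancelʳ-distinct (λ e → 0≢1+n (distinct e)) (begin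
        r₀ * eval (quotient p r₀) (r (fsuc i))                           ≈⟨ +-identityˡ _ ⟨
        0# + r₀ * eval (quotient p r₀) (r (fsuc i))                      ≈⟨ +-congʳ (roots (fsuc i)) ⟨
        eval p (r (fsuc i)) + r₀ * eval (quotient p r₀) (r (fsuc i))     ≈⟨ eval-division p r₀ (r (fsuc i)) ⟩
        eval p r₀ + r (fsuc i) * eval (quotient p r₀) (r (fsuc i))       ≈⟨ +-congʳ (roots fzero) ⟩
        0# + r (fsuc i) * eval (quotient p r₀) (r (fsuc i))              ≈⟨ +-identityˡ _ ⟩
        r (fsuc i) * eval (quotient p r₀) (r (fsuc i))                   ∎))
    where r₀ = r fzero

-- Ring homomorphisms, and the Frobenius map of a finite field.

record RingHom {c ℓ c′ ℓ′} (R : CommutativeRing c ℓ) (S : CommutativeRing c′ ℓ′) : Set (c ⊔ ℓ ⊔ c′ ⊔ ℓ′) where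
  private
    module R = CommutativeRing R
    module S = CommutativeRing S
  field
    ι      : R.Carrier → S.Carrier
    ι-cong : ∀ {x y} → x R.≈ y → ι x S.≈ ι y
    ι-+    : ∀ x y → ι (x R.+ y) S.≈ ι x S.+ ι y
    ι-*    : ∀ x y → ι (x R.* y) S.≈ ι x S.* ι y
    ι-1    : ι R.1# S.≈ S.1#

  ι-0 : ι R.0# S.≈ S.0#
  ι-0 = +-identityʳ-unique _ _ (S.trans (S.sym (ι-+ R.0# R.0#)) (ι-cong (R.+-identityˡ R.0#)))
    where open RingProperties S.ring using (+-identityʳ-unique)

  ι-‿ : ∀ x → ι (R.- x) S.≈ S.- ι x
  ι-‿ x = +-inverseʳ-unique _ _ (S.trans (S.sym (ι-+ x (R.- x))) (S.trans (ι-cong (R.-‿inverseʳ x)) ι-0))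
    where open RingProperties S.ring using (+-inverseʳ-unique)

  open SemiringSum R.semiring using () renaming (sum to sumᴿ)
  open SemiringSum S.semiring using () renaming (sum to sumˢ)
  ι-sum : ∀ {n} (f : Fin n → R.Carrier) → ι (sumᴿ f) S.≈ sumˢ (λ i → ι (f i))
  ι-sum {zero}  f = ι-0
  ι-sum {suc n} f = S.trans (ι-+ _ _) (S.+-congˡ (ι-sum (λ i → f (fsuc i))))

  open SemiringMult R.semiring using () renaming (_×_ to _×ᴿ_)
  open SemiringMult S.semiring using () renaming (_×_ to _×ˢ_)
  ι-× : ∀ n x → ι (n ×ᴿ x) S.≈ n ×ˢ ι x
  ι-× zero    x = ι-0
  ι-× (suc n) x = S.trans (ι-+ _ _) (S.+-congˡ (ι-× n x))

  open Exp R.commutativeSemiring using () renaming (_^_ to _^ᴿ_)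
  open Exp S.commutativeSemiring using () renaming (_^_ to _^ˢ_)
  ι-^ : ∀ x n → ι (x ^ᴿ n) S.≈ ι x ^ˢ n
  ι-^ x zero    = ι-1
  ι-^ x (suc n) = S.trans (ι-* _ _) (S.*-congˡ (ι-^ x n))

module _ {c ℓ : Level} (R : CommutativeRing c ℓ) where
  open CommutativeRing R
  open Exp commutativeSemiring using (_^_; ^-congʳ)
  open SemiringMult semiring using (×-congˡ; ×-homo-1)

  lastBinomialTerm : ∀ x y n → Binomial.binomialTerm commutativeSemiring x y n (fromℕ n) ≈ x ^ n
  lastBinomialTerm x y n = trans
    (×-congˡ (≡.trans (≡.cong (n choose_) (toℕ-fromℕ n)) (nCn≡1 n)))
    (trans (×-homo-1 _) (trans
      (*-cong (^-congʳ x (toℕ-fromℕ n))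
              (^-congʳ y (≡.trans (≡.cong (n ∸ᴺ_) (toℕ-fromℕ n)) (ℕₚ.n∸n≡0 n))))
      (*-identityʳ _)))

module FiniteFieldIsDiscrete {c ℓ₁ ℓ₂ : Level} (F : FiniteField c ℓ₁ ℓ₂) where
  open FiniteField F
  open HeytingField heytingField
  open Inverse finite

  private
    ≈?′ : ∀ x y → Dec (x ≈ y)
    ≈?′ x y with to x ≟ᶠ to y
    ... | yes p = yes (trans (sym (strictlyInverseʳ x)) (trans (from-cong p) (strictlyInverseʳ y)))
    ... | no ¬p = no λ x≈y → ¬p (to-cong x≈y)

    x-0≈x : ∀ x → x - 0# ≈ x
    x-0≈x x = trans (+-congˡ -0#≈0#) (+-identityʳ x)
      where open RingProperties (CommutativeRing.ring commutativeRing) using (-0#≈0#)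

  discreteField : DiscreteField c ℓ₁
  discreteField = record
    { commutativeRing = commutativeRing
    ; zero⊎unit = decide
    ; 1≉0 = λ 1≈0 → #-irrefl 1≈0 (invertible⇒# (1# , trans (*-identityˡ _) (x-0≈x 1#) , trans (*-identityʳ _) (x-0≈x 1#)))
    }
    where
    decide : ∀ x → x ≈ 0# ⊎ ∃[ y ] x * y ≈ 1#
    -- The inverse is found by exhaustive search. If the search fails, `x` is not apart from 0, and
    -- tightness makes it 0.
    decide x with any? (λ i → ≈?′ (x * from i) 1#)
    ... | yes (i , p) = inj₂ (from i , p)
    ... | no ¬unit    = inj₁ (proj₁ (tight x 0#) λ x#0 → not-unit (#⇒invertible x#0))
      where
      not-unit : ¬ _
      not-unit (y , _ , p) = ¬unit (to y , trans (*-congˡ (strictlyInverseʳ y)) (trans (*-congʳ (sym (x-0≈x x))) p))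

module FiniteDiscreteField {c ℓ : Level} (K : DiscreteField c ℓ) (q″ : ℕ)
  (finite : Inverse (DiscreteField.setoid K) (≡.setoid (Fin (suc (suc q″))))) where
  open DiscreteField K
  open FieldLinearAlgebra K
  open Inverse finite
  open SetoidReasoning setoid
  open RingProperties ring using (+-identityˡ-unique; +-cancelˡ)
  open Exp commutativeSemiring using (_^_; ^-congˡ)
  open SemiringMult semiring using (×-assoc-*; ×-congʳ; ×-homo-1) renaming (_×_ to _·_)
  open SemiringSum semiring using (sum; sum-cong-≋; sum-init-last)
  open MonoidSum *-commutativeMonoid using () renaming
    (sum to ∏; sum-cong-≋ to ∏-cong; ∑-distrib-+ to ∏-distrib-*; sum-permute to ∏-permute; sum-remove to ∏-remove; sum-replicate to ∏-replicate)

  q : ℕ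
  q = suc (suc q″)

  private
    nonzeroPart : (x : Carrier) → Dec (x ≈ 0#) → Carrier
    nonzeroPart x (yes _) = 1#
    nonzeroPart x (no _)  = x

    -- Replacing 0 by 1 lets the product of the nonzero elements run over all of `Fin q`.
    -- Multiplication by `a` then contributes a factor `a` at every index except that of 0, which
    -- `unitFactor` records.
    h : Carrier → Carrier
    h x = nonzeroPart x (≈0? x)

    unitFactor : (x a : Carrier) → Dec (x ≈ 0#) → Carrier
    unitFactor x a (yes _) = 1#
    unitFactor x a (no _)  = a

    h-scale : ∀ {a} → ¬ a ≈ 0# → ∀ x y → y ≈ a * x → h y ≈ unitFactor x a (≈0? x) * h x
    h-scale {a} a≉0 x y y≈ax with ≈0? x | ≈0? y
    ... | yes _   | yes _   = sym (*-identityˡ 1#)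
    ... | yes x≈0 | no y≉0  = ⊥-elim (y≉0 (trans y≈ax (trans (*-congˡ x≈0) (zeroʳ a))))
    ... | no x≉0  | yes y≈0 = ⊥-elim (x≉0 (*-cancel-0 a≉0 (trans (sym y≈ax) y≈0)))
    ... | no _    | no _    = y≈ax

    h≉0 : ∀ x → ¬ h x ≈ 0#
    h≉0 x with ≈0? x
    ... | yes _  = 1≉0
    ... | no x≉0 = x≉0

    ∏≉0 : ∀ {n} (f : Fin n → Carrier) → (∀ i → ¬ f i ≈ 0#) → ¬ ∏ f ≈ 0#
    ∏≉0 {zero}  f f≉0 p = 1≉0 p
    ∏≉0 {suc n} f f≉0 p = ∏≉0 (λ i → f (fsuc i)) (λ i → f≉0 (fsuc i)) (*-cancel-0 (f≉0 fzero) p)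

  -- Multiplication by `a` permutes the field, so the product of the nonzero elements equals a^(q-1)
  -- times itself, and it can be cancelled.
  fermat-unit : ∀ a → ¬ a ≈ 0# → a ^ q ≈ a
  fermat-unit a a≉0 with zero⊎unit a
  ... | inj₁ a≈0 = ⊥-elim (a≉0 a≈0)
  ... | inj₂ (b , ab≈1) = trans (*-congˡ a^q-1≈1) (*-identityʳ a)
    where
    scale : Carrier → Fin q → Fin q
    scale x i = to (x * from i)
    scale-inverse : ∀ x y → x * y ≈ 1# → ∀ i → scale x (scale y i) ≡ i
    scale-inverse x y xy≈1 i = ≡.trans (to-cong (begin
      x * from (to (y * from i))  ≈⟨ *-congˡ (strictlyInverseʳ _) ⟩
      x * (y * from i)            ≈⟨ *-assoc x y _ ⟨
      x * y * from i              ≈⟨ *-congʳ xy≈1 ⟩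
      1# * from i                 ≈⟨ *-identityˡ _ ⟩
      from i                      ∎)) (strictlyInverseˡ i)
    π : Permutation q q
    π = permutation (scale a) (scale b) (scale-inverse a b ab≈1) (scale-inverse b a (trans (*-comm b a) ab≈1))
    g P : Fin q → Carrier
    g i = unitFactor (from i) a (≈0? (from i))
    P i = h (from i)
    P≈gP : ∏ P ≈ ∏ g * ∏ P
    P≈gP = begin
      ∏ P                        ≈⟨ ∏-permute P π ⟩
      ∏ (λ i → P (scale a i))    ≈⟨ ∏-cong (λ i → h-scale a≉0 (from i) _ (strictlyInverseʳ _)) ⟩
      ∏ (λ i → g i * P i)        ≈⟨ ∏-distrib-* g P ⟩
      ∏ g * ∏ P                  ∎
    i₀ : Fin q
    i₀ = to 0#
    g-zero : ∀ {i} → i ≡ i₀ → g i ≈ 1#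
    g-zero {i} i≡i₀ with ≈0? (from i)
    ... | yes _ = refl
    ... | no ¬p = ⊥-elim (¬p (trans (from-cong i≡i₀) (strictlyInverseʳ 0#)))
    g-nonzero : ∀ {i} → ¬ i ≡ i₀ → g i ≈ a
    g-nonzero {i} i≢i₀ with ≈0? (from i)
    ... | yes p = ⊥-elim (i≢i₀ (≡.trans (≡.sym (strictlyInverseˡ i)) (to-cong p)))
    ... | no _  = refl
    ∏g≈a^q-1 : ∏ g ≈ a ^ suc q″
    ∏g≈a^q-1 = begin
      ∏ g                                    ≈⟨ ∏-remove {i = i₀} g ⟩
      g i₀ * ∏ (λ j → g (punchIn i₀ j))      ≈⟨ *-cong (g-zero ≡.refl) (∏-cong (λ j → g-nonzero (punchInᵢ≢i i₀ j))) ⟩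
      1# * ∏ {suc q″} (λ _ → a)              ≈⟨ *-identityˡ _ ⟩
      ∏ {suc q″} (λ _ → a)                   ≈⟨ ∏-replicate (suc q″) ⟩
      a ^ suc q″                             ∎
    a^q-1≈1 : a ^ suc q″ ≈ 1#
    a^q-1≈1 with ≈? (a ^ suc q″) 1#
    ... | yes p = p
    ... | no ¬p = ⊥-elim (∏≉0 P (λ i → h≉0 (from i))
      (*-cancelʳ-distinct ¬p (trans (*-congʳ (sym ∏g≈a^q-1)) (trans (sym P≈gP) (sym (*-identityˡ _))))))

  fermat : ∀ a → a ^ q ≈ a
  fermat a with ≈0? a
  ... | no a≉0  = fermat-unit a a≉0
  ... | yes a≈0 = trans (*-congʳ a≈0) (trans (zeroˡ _) (sym a≈0))

  1^n≈1 : ∀ n → 1# ^ n ≈ 1#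
  1^n≈1 zero    = refl
  1^n≈1 (suc n) = trans (*-identityˡ _) (1^n≈1 n)

  eval≈sum : ∀ {m} (p : Fin m → Carrier) x → eval p x ≈ sum (λ i → p i * x ^ toℕ i)
  eval≈sum {zero}  p x = refl
  eval≈sum {suc m} p x = +-cong (sym (*-identityʳ _)) (begin
    x * eval (λ i → p (fsuc i)) x                       ≈⟨ *-congˡ (eval≈sum (λ i → p (fsuc i)) x) ⟩
    x * sum (λ i → p (fsuc i) * x ^ toℕ i)              ≈⟨ *-distribˡ-sum x (λ i → p (fsuc i) * x ^ toℕ i) ⟩
    sum (λ i → x * (p (fsuc i) * x ^ toℕ i))            ≈⟨ sum-cong-≋ (λ i → x∙yz≈y∙xz x (p (fsuc i)) _) ⟩
    sum (λ i → p (fsuc i) * x ^ toℕ (fsuc i))           ∎)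
    where
    open SemiringSum semiring using (*-distribˡ-sum)
    open CommutativeSemigroupProperties *-commutativeSemigroup using (x∙yz≈y∙xz)

  -- (X + 1)^q - X^q - 1 has degree below q and vanishes on all q elements of K.
  binomial-vanishes : ∀ (i : Fin (suc q″)) → (q choose toℕ (fsuc (inject₁ i))) · 1# ≈ 0#
  binomial-vanishes i = root-bound coefficient from
    (λ {i} {j} e → ≡.trans (≡.sym (strictlyInverseˡ i)) (≡.trans (to-cong e) (strictlyInverseˡ j)))
    (λ j → middle≈0 (from j)) (fsuc i)
    where
    coefficient : Fin q → Carrier
    coefficient = 0# ∷ᵛ λ i → (q choose toℕ (fsuc (inject₁ i))) · 1#
    middle≈0 : ∀ x → eval coefficient x ≈ 0#
    middle≈0 x = +-identityˡ-unique _ (x ^ q) (+-cancelˡ 1# _ _ (sym (begin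
      1# + x ^ q                               ≈⟨ +-comm 1# _ ⟩
      x ^ q + 1#                               ≈⟨ +-congʳ (fermat x) ⟩
      x + 1#                                   ≈⟨ fermat (x + 1#) ⟨
      (x + 1#) ^ q                             ≈⟨ Binomial.theorem commutativeSemiring q x 1# ⟩
      sum term                                 ≈⟨ +-cong head (trans (sum-init-last (λ i → term (fsuc i))) (+-cong middle last)) ⟩
      1# + (eval coefficient x + x ^ q)        ∎)))
      where
      term : Fin (suc q) → Carrier
      term = Binomial.binomialTerm commutativeSemiring x 1# q
      head : term fzero ≈ 1#
      head = trans (×-homo-1 _) (trans (*-identityˡ _) (1^n≈1 q))
      middle : sum (λ i → term (fsuc (inject₁ i))) ≈ eval coefficient x
      middle = begin
        sum (λ i → term (fsuc (inject₁ i)))                           ≈⟨ sum-cong-≋ summand ⟩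
        sum (λ i → coefficient (fsuc i) * x ^ toℕ (fsuc i))           ≈⟨ +-identityˡ _ ⟨
        0# + sum (λ i → coefficient (fsuc i) * x ^ toℕ (fsuc i))      ≈⟨ +-congʳ (zeroˡ _) ⟨
        sum (λ i → coefficient i * x ^ toℕ i)                         ≈⟨ eval≈sum coefficient x ⟨
        eval coefficient x                                            ∎
        where
        summand : ∀ i → term (fsuc (inject₁ i)) ≈ coefficient (fsuc i) * x ^ toℕ (fsuc i)
        summand i = begin
          m · (x ^ k * 1# ^ (q ∸ᴺ k))    ≈⟨ ×-congʳ m (trans (*-congˡ (1^n≈1 (q ∸ᴺ k))) (*-comm _ 1#)) ⟩
          m · (1# * x ^ k)               ≈⟨ ×-assoc-* m 1# (x ^ k) ⟨
          m · 1# * x ^ k                 ≡⟨ ≡.cong (λ k′ → m · 1# * x ^ suc k′) (toℕ-inject₁ i) ⟩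
          m · 1# * x ^ toℕ (fsuc i)      ∎
          where
          k = toℕ (fsuc (inject₁ i))
          m = q choose k
      last : term (fsuc (fromℕ (suc q″))) ≈ x ^ q
      last = lastBinomialTerm commutativeRing x 1# q

  module Frobenius {c′ ℓ′ : Level} {A : CommutativeRing c′ ℓ′} (hom : RingHom commutativeRing A) where
    open RingHom hom
    private
      module A = CommutativeRing A
      module AE = Exp A.commutativeSemiring
      module AM = SemiringMult A.semiring
      module AS = SemiringSum A.semiring
      module AR = SetoidReasoning A.setoid

    φ : A.Carrier → A.Carrier
    φ x = x AE.^ q

    φ-cong : ∀ {x y} → x A.≈ y → φ x A.≈ φ y
    φ-cong = AE.^-congˡ q

    φ-* : ∀ x y → φ (x A.* y) A.≈ φ x A.* φ y
    φ-* x y = AE.^-distrib-* x y q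

    φ-ι : ∀ a → φ (ι a) A.≈ ι a
    φ-ι a = A.trans (A.sym (ι-^ a q)) (ι-cong (fermat a))

    vanishing-multiple : ∀ m → m · 1# ≈ 0# → ∀ x → m AM.× x A.≈ A.0#
    vanishing-multiple m m≈0 x = AR.begin
      m AM.× x                 AR.≈⟨ AM.×-congʳ m (A.*-identityˡ x) ⟨
      m AM.× (A.1# A.* x)      AR.≈⟨ AM.×-assoc-* m A.1# x ⟨
      (m AM.× A.1#) A.* x      AR.≈⟨ A.*-congʳ (AM.×-congʳ m ι-1) ⟨
      (m AM.× ι 1#) A.* x      AR.≈⟨ A.*-congʳ (ι-× m 1#) ⟨
      ι (m · 1#) A.* x         AR.≈⟨ A.*-congʳ (A.trans (ι-cong m≈0) ι-0) ⟩
      A.0# A.* x               AR.≈⟨ A.zeroˡ x ⟩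
      A.0#                     AR.∎

    -- Here q enters as the binomial coefficient q choose 1.
    q×≈0 : ∀ x → q AM.× x A.≈ A.0#
    q×≈0 = vanishing-multiple q (trans (reflexive (≡.cong (_· 1#) (≡.sym (nC1≡n q)))) (binomial-vanishes fzero))

    -- The inner binomial coefficients of the exponent q vanish in the field, hence in every algebra
    -- over it.
    φ-+ : ∀ x y → φ (x A.+ y) A.≈ φ x A.+ φ y
    φ-+ x y = AR.begin
      φ (x A.+ y)                 AR.≈⟨ Binomial.theorem A.commutativeSemiring q x y ⟩
      AS.sum term                 AR.≈⟨ A.+-cong head (A.trans (AS.sum-init-last (λ i → term (fsuc i))) (A.+-cong middle last)) ⟩
      φ y A.+ (A.0# A.+ φ x)      AR.≈⟨ A.+-congˡ (A.+-identityˡ _) ⟩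
      φ y A.+ φ x                 AR.≈⟨ A.+-comm _ _ ⟩
      φ x A.+ φ y                 AR.∎
      where
      term : Fin (suc q) → A.Carrier
      term = Binomial.binomialTerm A.commutativeSemiring x y q
      head : term fzero A.≈ φ y
      head = A.trans (AM.×-homo-1 _) (A.*-identityˡ _)
      middle : AS.sum (λ i → term (fsuc (inject₁ i))) A.≈ A.0#
      middle = A.trans (AS.sum-cong-≋ (λ i → vanishing-multiple (q choose k i) (binomial-vanishes i) (x AE.^ k i A.* y AE.^ (q ∸ᴺ k i)))) (AS.sum-replicate-zero (suc q″))
        where
        k : Fin (suc q″) → ℕ
        k i = toℕ (fsuc (inject₁ i))
      last : term (fsuc (fromℕ (suc q″))) A.≈ φ x
      last = lastBinomialTerm A x y q

    frobenius : RingHom A A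
    frobenius = record
      { ι = φ ; ι-cong = φ-cong ; ι-+ = φ-+ ; ι-* = φ-*
      ; ι-1 = A.trans (A.sym (φ-cong ι-1)) (A.trans (φ-ι 1#) ι-1)
      }

-- Artin-Schreier extensions as rings of tuples.

module PolynomialAction {c ℓ : Level} {S : CommutativeRing c ℓ} {n : ℕ} (Y : LinearMap S n n) where
  open CommutativeRing S
  open LinearMap
  open LinearMaps S using (apply-0)
  open SetoidReasoning setoid
  open CommutativeSemigroupProperties +-commutativeSemigroup using (interchange)
  open CommutativeSemigroupProperties *-commutativeSemigroup using (x∙yz≈y∙xz)

  private
    V : Set c
    V = Fin n → Carrier

  -- The polynomial with coefficients `x`, constant term first, evaluated at the operator `Y`. Its
  -- length `k` is independent of `n` so that inductions can peel off coefficients.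
  act : ∀ {k} → (Fin k → Carrier) → V → V
  act {zero}  x v _ = 0#
  act {suc k} x v i = x fzero * v i + apply Y (act (λ j → x (fsuc j)) v) i

  act-cong : ∀ {k} {x x′ : Fin k → Carrier} {v v′} → (∀ i → x i ≈ x′ i) → (∀ i → v i ≈ v′ i) → ∀ i → act x v i ≈ act x′ v′ i
  act-cong {zero}  p q i = refl
  act-cong {suc k} p q i = +-cong (*-cong (p fzero) (q i)) (cong Y (act-cong (λ j → p (fsuc j)) q) i)

  act-+ˡ : ∀ {k} (x z : Fin k → Carrier) v i → act (λ j → x j + z j) v i ≈ act x v i + act z v i
  act-+ˡ {zero}  x z v i = sym (+-identityˡ 0#)
  act-+ˡ {suc k} x z v i = trans
    (+-cong (distribʳ (v i) _ _)
            (trans (cong Y (act-+ˡ (λ j → x (fsuc j)) (λ j → z (fsuc j)) v) i) (+-homo Y _ _ i)))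
    (interchange _ _ _ _)

  act-+ʳ : ∀ {k} (x : Fin k → Carrier) u v i → act x (λ j → u j + v j) i ≈ act x u i + act x v i
  act-+ʳ {zero}  x u v i = sym (+-identityˡ 0#)
  act-+ʳ {suc k} x u v i = trans
    (+-cong (distribˡ (x fzero) _ _)
            (trans (cong Y (act-+ʳ (λ j → x (fsuc j)) u v) i) (+-homo Y _ _ i)))
    (interchange _ _ _ _)

  act-*ʳ : ∀ {k} (x : Fin k → Carrier) a v i → act x (λ j → a * v j) i ≈ a * act x v i
  act-*ʳ {zero}  x a v i = sym (zeroʳ a)
  act-*ʳ {suc k} x a v i = trans
    (+-cong (x∙yz≈y∙xz (x fzero) a (v i))
            (trans (cong Y (act-*ʳ (λ j → x (fsuc j)) a v) i) (*-homo Y a _ i)))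
    (sym (distribˡ a _ _))

  act-0 : ∀ {k} (x : Fin k → Carrier) i → act x (λ _ → 0#) i ≈ 0#
  act-0 x i = trans (act-cong {x = x} (λ _ → refl) (λ _ → sym (zeroˡ 0#)) i)
    (trans (act-*ʳ x 0# (λ _ → 0#) i) (zeroˡ _))

  act-Y : ∀ {k} (x : Fin k → Carrier) v i → act x (apply Y v) i ≈ apply Y (act x v) i
  act-Y {zero}  x v i = sym (apply-0 Y (λ _ → refl) i)
  act-Y {suc k} x v i = begin
    x fzero * apply Y v i + apply Y (act x′ (apply Y v)) i
      ≈⟨ +-cong (sym (*-homo Y (x fzero) v i)) (cong Y (act-Y x′ v) i) ⟩
    apply Y (λ j → x fzero * v j) i + apply Y (apply Y (act x′ v)) i
      ≈⟨ +-homo Y _ _ i ⟨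
    apply Y (act x v) i ∎
    where
    x′ : Fin k → Carrier
    x′ j = x (fsuc j)

  -- Polynomials in one operator commute. Commutativity and associativity of the extension ring both
  -- rest on this.
  act-comm : ∀ {k l} (x : Fin k → Carrier) (z : Fin l → Carrier) v i → act x (act z v) i ≈ act z (act x v) i
  act-comm {zero}  x z v i = sym (act-0 z i)
  act-comm {suc k} x z v i = begin
    x fzero * act z v i + apply Y (act x′ (act z v)) i
      ≈⟨ +-cong (sym (act-*ʳ z (x fzero) v i)) (trans (cong Y (act-comm x′ z v) i) (sym (act-Y z (act x′ v) i))) ⟩
    act z (λ j → x fzero * v j) i + act z (apply Y (act x′ v)) i
      ≈⟨ act-+ʳ z _ _ i ⟨
    act z (act x v) i ∎
    where
    x′ : Fin k → Carrier
    x′ j = x (fsuc j)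

-- S[Y]/(Y^q - Y - s) in the basis 1, Y, ..., Y^(q-1), with q = q″ + 2.  Multiplication by Y is
-- the companion operator Y·, and the product of x and v is x(Y·) applied to v.
module ArtinSchreier {c ℓ : Level} (S : CommutativeRing c ℓ) (q″ : ℕ) (s : CommutativeRing.Carrier S) where
  open CommutativeRing S
  open LinearMap
  open LinearMaps S
  open SetoidReasoning setoid

  q : ℕ
  q = suc (suc q″)

  V : Set c
  V = Fin q → Carrier

  module V = Module (power {R = S} q ring-module)

  infix 4 _≋_
  _≋_ : V → V → Set ℓ
  u ≋ v = ∀ i → u i ≈ v i

  1ⱽ : V
  1ⱽ = e₀

  Y·_ : LinearMap S q q
  Y·_ = cons zeroₗ (select inject₁) +ₗ record
    { apply  = λ u i → u (fromℕ (suc q″)) * relation i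
    ; cong   = λ p i → *-congʳ (p _)
    ; +-homo = λ u v i → distribʳ (relation i) _ _
    ; *-homo = λ a u i → *-assoc a _ (relation i)
    }
    where
    -- The last coefficient would move to Y^q, which is rewritten as s + Y.
    relation : V
    relation = s ∷ᵛ 1# ∷ᵛ λ _ → 0#

  open PolynomialAction Y·_

  private
    pad-inject₁ : ∀ {k m} (x : Fin k → Carrier) (i : Fin m) → pad x (inject₁ i) ≈ pad x i
    pad-inject₁ {zero}  x i        = refl
    pad-inject₁ {suc k} x fzero    = refl
    pad-inject₁ {suc k} x (fsuc i) = pad-inject₁ (λ j → x (fsuc j)) i

    pad-last : ∀ {k m} (x : Fin k → Carrier) → k ≤ m → pad x (fromℕ m) ≈ 0#
    pad-last {zero}  x _         = refl
    pad-last {suc k} x (s≤s k≤m) = pad-last (λ j → x (fsuc j)) k≤m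

    pad-id : ∀ {k} (x : Fin k → Carrier) i → pad x i ≈ x i
    pad-id x fzero    = refl
    pad-id x (fsuc i) = pad-id (λ j → x (fsuc j)) i

  -- With at most q coefficients no shift overflows past Y^(q-1): the last coordinate of the padded
  -- tail is 0, so `relation` never contributes.
  act-1 : ∀ {k} (x : Fin k → Carrier) → k ≤ q → act x 1ⱽ ≋ pad x
  act-1 {zero}  x _ i = refl
  act-1 {suc k} x (s≤s k≤) i = trans (+-congˡ (trans (cong Y·_ (act-1 x′ (ℕₚ.m≤n⇒m≤1+n k≤)) i)
    (trans (+-congˡ (trans (*-congʳ (pad-last x′ k≤)) (zeroˡ _))) (+-identityʳ _)))) (shifted i)
    where
    x′ : Fin k → Carrier
    x′ j = x (fsuc j)
    shifted : ∀ i → x fzero * 1ⱽ i + apply {m = q} (cons zeroₗ (select inject₁)) (pad x′) i ≈ pad x i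
    shifted fzero    = trans (+-identityʳ _) (*-identityʳ _)
    shifted (fsuc i) = trans (+-congʳ (zeroʳ _)) (trans (+-identityˡ _) (pad-inject₁ x′ i))

  act-1-id : ∀ x → act x 1ⱽ ≋ x
  act-1-id x i = trans (act-1 x ℕₚ.≤-refl i) (pad-id x i)

  act-swap : ∀ x z → act x z ≋ act z x
  act-swap x z i = begin
    act x z i            ≈⟨ act-cong {x = x} (λ _ → refl) (act-1-id z) i ⟨
    act x (act z 1ⱽ) i   ≈⟨ act-comm x z 1ⱽ i ⟩
    act z (act x 1ⱽ) i   ≈⟨ act-cong {x = z} (λ _ → refl) (act-1-id x) i ⟩
    act z x i            ∎

  extension : CommutativeRing c ℓ
  extension = record
    { Carrier = V
    ; _≈_ = _≋_
    ; _+_ = V._+ᴹ_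
    ; _*_ = act
    ; -_ = V.-ᴹ_
    ; 0# = V.0ᴹ
    ; 1# = 1ⱽ
    ; isCommutativeRing = record
      { isRing = record
        { +-isAbelianGroup = V.+ᴹ-isAbelianGroup
        ; *-cong = act-cong
        ; *-assoc = assoc
        ; *-identity = (λ x → V.≈ᴹ-trans (act-swap 1ⱽ x) (act-1-id x)) , act-1-id
        ; distrib = act-+ʳ , λ x y z → act-+ˡ y z x
        }
      ; *-comm = act-swap
      }
    }
    where
    assoc : ∀ x y z → act (act x y) z ≋ act x (act y z)
    assoc x y z i = begin
      act (act x y) z i  ≈⟨ act-swap (act x y) z i ⟩
      act z (act x y) i  ≈⟨ act-comm z x y i ⟩
      act x (act z y) i  ≈⟨ act-cong {x = x} (λ _ → refl) (act-swap z y) i ⟩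
      act x (act y z) i  ∎

  module E = CommutativeRing extension
  open SemiringExp E.semiring using (_^_)

  private
    embed : Carrier → V
    embed a i = a * 1ⱽ i

    embed-* : ∀ a v → act (embed a) v ≋ (λ i → a * v i)
    embed-* a v i = begin
      act (embed a) v i    ≈⟨ act-swap (embed a) v i ⟩
      act v (embed a) i    ≈⟨ act-*ʳ v a 1ⱽ i ⟩
      a * act v 1ⱽ i       ≈⟨ *-congˡ (act-1-id v i) ⟩
      a * v i              ∎

  embedding : RingHom S extension
  embedding = record
    { ι      = embed
    ; ι-cong = λ p i → *-congʳ p
    ; ι-+    = λ a b i → distribʳ (1ⱽ i) a b
    ; ι-*    = λ a b i → trans (*-assoc a b _) (sym (embed-* a (embed b) i))
    ; ι-1    = λ i → *-identityˡ _
    }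

  root : V
  root = apply Y·_ 1ⱽ

  root-* : ∀ v → act root v ≋ apply Y·_ v
  root-* v i = trans (act-swap root v i) (trans (act-Y v 1ⱽ i) (cong Y·_ (act-1-id v) i))

  private
    unitLast : ∀ k → Fin (suc k) → Carrier
    unitLast zero    _        = 1#
    unitLast (suc k) fzero    = 0#
    unitLast (suc k) (fsuc i) = unitLast k i

    unitLast-last : ∀ k → unitLast k (fromℕ k) ≈ 1#
    unitLast-last zero    = refl
    unitLast-last (suc k) = unitLast-last k

    unitLast-inject₁ : ∀ k i → unitLast k (inject₁ i) ≈ 0#
    unitLast-inject₁ (suc k) fzero    = refl
    unitLast-inject₁ (suc k) (fsuc i) = unitLast-inject₁ k i

    act-unitLast : ∀ k → act (unitLast k) 1ⱽ ≋ root ^ k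
    act-unitLast zero i = trans (+-cong (*-identityˡ _) (apply-0 Y·_ (λ _ → refl) i)) (+-identityʳ _)
    act-unitLast (suc k) i = begin
      0# * 1ⱽ i + apply Y·_ (act (unitLast k) 1ⱽ) i  ≈⟨ +-cong (zeroˡ _) (cong Y·_ (act-unitLast k) i) ⟩
      0# + apply Y·_ (root ^ k) i                    ≈⟨ +-identityˡ _ ⟩
      apply Y·_ (root ^ k) i                         ≈⟨ root-* (root ^ k) i ⟨
      (root ^ suc k) i                               ∎

  -- The power q - 1 of the root is still the last basis vector; one more multiplication triggers
  -- `relation` exactly once.
  root-equation : root ^ q E.≈ root E.+ embed s
  root-equation i = begin
    (root ^ q) i                               ≈⟨ root-* (root ^ suc q″) i ⟩
    apply Y·_ (root ^ suc q″) i                ≈⟨ cong Y·_ (λ j → trans (sym (act-unitLast (suc q″) j)) (act-1-id (unitLast (suc q″)) j)) i ⟩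
    apply Y·_ (unitLast (suc q″)) i            ≈⟨ unfold i ⟩
    root i + embed s i                         ∎
    where
    unfold : ∀ i → apply Y·_ (unitLast (suc q″)) i ≈ root i + embed s i
    unfold fzero = begin
      0# + unitLast q″ (fromℕ q″) * s   ≈⟨ trans (+-identityˡ _) (*-congʳ (unitLast-last q″)) ⟩
      1# * s                            ≈⟨ *-comm 1# s ⟩
      s * 1#                            ≈⟨ +-identityˡ _ ⟨
      0# + s * 1#                       ≈⟨ +-congʳ (trans (+-identityˡ _) (zeroˡ s)) ⟨
      0# + 0# * s + s * 1#              ∎
    unfold (fsuc fzero) = begin
      unitLast (suc q″) (inject₁ fzero) + unitLast q″ (fromℕ q″) * 1#  ≈⟨ +-congˡ (*-congʳ (unitLast-last q″)) ⟩
      0# + 1# * 1#                                 ≈⟨ trans (+-identityˡ _) (*-identityʳ 1#) ⟩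
      1#                                           ≈⟨ +-identityʳ 1# ⟨
      1# + 0#                                      ≈⟨ +-cong (+-identityʳ 1#) (zeroʳ s) ⟨
      1# + 0# + s * 0#                             ≈⟨ +-congʳ (+-congˡ (zeroˡ 1#)) ⟨
      1# + 0# * 1# + s * 0#                        ∎
    unfold (fsuc (fsuc i)) = begin
      unitLast (suc q″) (inject₁ (fsuc i)) + unitLast q″ (fromℕ q″) * 0#  ≈⟨ +-cong (unitLast-inject₁ (suc q″) (fsuc i)) (zeroʳ _) ⟩
      0# + 0#                            ≈⟨ +-cong (+-identityˡ 0#) (zeroʳ s) ⟨
      0# + 0# + s * 0#                   ≈⟨ +-congʳ (+-congˡ (zeroˡ 0#)) ⟨
      0# + 0# * 0# + s * 0#              ∎

  -- Every element is a polynomial in `root` over `S`. Applied to an iterate of the Frobenius, this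
  -- bounds its order by looking at `S` and `root` alone.
  endomorphism-id : (ψ : RingHom extension extension) → (∀ a → RingHom.ι ψ (embed a) ≋ embed a) →
    RingHom.ι ψ root ≋ root → ∀ x → RingHom.ι ψ x ≋ x
  endomorphism-id ψ ψ-embed ψ-root x = E.trans (ψ.ι-cong (E.sym (act-1-id x))) (E.trans (fixes-act x) (act-1-id x))
    where
    module ψ = RingHom ψ
    fixes-act : ∀ {k} (x : Fin k → Carrier) → ψ.ι (act x 1ⱽ) ≋ act x 1ⱽ
    fixes-act {zero}  x = ψ.ι-0
    fixes-act {suc k} x = E.trans (ψ.ι-cong split) (E.trans (ψ.ι-+ _ _) (E.trans
      (E.+-cong (ψ-embed (x fzero)) (E.trans (ψ.ι-* _ _) (E.*-cong ψ-root (fixes-act x′)))) (E.sym split)))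
      where
      x′ : Fin k → Carrier
      x′ j = x (fsuc j)
      split : act x 1ⱽ E.≈ embed (x fzero) E.+ root E.* act x′ 1ⱽ
      split = E.+-congˡ (E.sym (root-* (act x′ 1ⱽ)))

-- Composition of homomorphisms, and factor rings cut out by idempotents.

idHom : ∀ {c ℓ} (R : CommutativeRing c ℓ) → RingHom R R
idHom R = record { ι = λ x → x ; ι-cong = λ p → p ; ι-+ = λ _ _ → refl ; ι-* = λ _ _ → refl ; ι-1 = refl }
  where open CommutativeRing R

infixr 9 _∘ʰ_
_∘ʰ_ : ∀ {c ℓ c′ ℓ′ c″ ℓ″} {R : CommutativeRing c ℓ} {S : CommutativeRing c′ ℓ′} {T : CommutativeRing c″ ℓ″} →
  RingHom S T → RingHom R S → RingHom R T
_∘ʰ_ {T = T} g f = record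
  { ι      = λ x → g.ι (f.ι x)
  ; ι-cong = λ p → g.ι-cong (f.ι-cong p)
  ; ι-+    = λ x y → trans (g.ι-cong (f.ι-+ x y)) (g.ι-+ _ _)
  ; ι-*    = λ x y → trans (g.ι-cong (f.ι-* x y)) (g.ι-* _ _)
  ; ι-1    = trans (g.ι-cong f.ι-1) g.ι-1
  }
  where
  open CommutativeRing T using (trans)
  module f = RingHom f
  module g = RingHom g

module Localization {c ℓ : Level} (R : CommutativeRing c ℓ) where
  open CommutativeRing R
  open SetoidReasoning setoid
  open RingProperties ring using (-‿distribʳ-*)
  open CommutativeSemigroupProperties *-commutativeSemigroup using (interchange)

  -- For an idempotent e, this is the ring eR, presented as R with equality x ~ y iff ex = ey.
  localize : ∀ e → e * e ≈ e → CommutativeRing c ℓ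
  localize e ee≈e = record
    { Carrier = Carrier
    ; _≈_ = λ x y → e * x ≈ e * y
    ; _+_ = _+_
    ; _*_ = _*_
    ; -_ = -_
    ; 0# = 0#
    ; 1# = 1#
    ; isCommutativeRing = record
      { isRing = record
        { +-isAbelianGroup = record
          { isGroup = record
            { isMonoid = record
              { isSemigroup = record
                { isMagma = record
                  { isEquivalence = record { refl = refl ; sym = sym ; trans = trans }
                  ; ∙-cong = λ p q → trans (distribˡ e _ _) (trans (+-cong p q) (sym (distribˡ e _ _)))
                  }
                ; assoc = λ x y z → *-congˡ (+-assoc x y z)
                }
              ; identity = (λ x → *-congˡ (+-identityˡ x)) , (λ x → *-congˡ (+-identityʳ x))
              }
            ; inverse = (λ x → *-congˡ (-‿inverseˡ x)) , (λ x → *-congˡ (-‿inverseʳ x))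
            ; ⁻¹-cong = λ p → trans (sym (-‿distribʳ-* e _)) (trans (-‿cong p) (-‿distribʳ-* e _))
            }
          ; comm = λ x y → *-congˡ (+-comm x y)
          }
        ; *-cong = λ p q → trans (split _ _) (trans (*-cong p q) (sym (split _ _)))
        ; *-assoc = λ x y z → *-congˡ (*-assoc x y z)
        ; *-identity = (λ x → *-congˡ (*-identityˡ x)) , (λ x → *-congˡ (*-identityʳ x))
        ; distrib = (λ x y z → *-congˡ (distribˡ x y z)) , (λ x y z → *-congˡ (distribʳ x y z))
        }
      ; *-comm = λ x y → *-congˡ (*-comm x y)
      }
    }
    where
    split : ∀ x y → e * (x * y) ≈ (e * x) * (e * y)
    split x y = trans (*-congʳ (sym ee≈e)) (interchange e e x y)

  localization : ∀ e (ee≈e : e * e ≈ e) → RingHom R (localize e ee≈e)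
  localization e ee≈e = record
    { ι = λ x → x ; ι-cong = *-congˡ ; ι-+ = λ _ _ → refl ; ι-* = λ _ _ → refl ; ι-1 = refl }

  ZeroOrUnitAt : Carrier → Carrier → Set (c ⊔ ℓ)
  ZeroOrUnitAt e x = e * x ≈ 0# ⊎ ∃[ z ] e * (x * z) ≈ e

  record PrimitiveIdempotent : Set (c ⊔ ℓ) where
    field
      e           : Carrier
      idempotent  : e * e ≈ e
      nonzero     : ¬ e ≈ 0#
      zeroOrUnit  : ∀ x → ZeroOrUnitAt e x

    -- This is the ring eR itself: the dichotomy `zeroOrUnit` already provides every inverse.
    field-of-fractions : DiscreteField c ℓ
    field-of-fractions = record
      { commutativeRing = localize e idempotent
      ; zero⊎unit = λ x → decide (zeroOrUnit x)
      ; 1≉0 = λ e1≈e0 → nonzero (trans (sym (*-identityʳ e)) (trans e1≈e0 (zeroʳ e)))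
      }
      where
      decide : ∀ {x} → ZeroOrUnitAt e x → e * x ≈ e * 0# ⊎ ∃[ y ] e * (x * y) ≈ e * 1#
      decide (inj₁ ex≈0)       = inj₁ (trans ex≈0 (sym (zeroʳ e)))
      decide (inj₂ (z , exz≈e)) = inj₂ (z , trans exz≈e (sym (*-identityʳ e)))

  -- Run through the elements of R, multiplying e by the idempotent xz attached to x
  -- whenever ex ≠ 0; dichotomies already established survive such a multiplication.
  primitive-idempotent : ∀ {n} (enumerate : Fin n → Carrier) → (∀ x → ∃[ i ] enumerate i ≈ x) →
    (∀ x → Dec (x ≈ 0#)) → ¬ 1# ≈ 0# → (∀ x → ∃[ z ] x * (x * z) ≈ x) → PrimitiveIdempotent
  primitive-idempotent enumerate surjective ≈0? 1≉0 regular = finish (process (tabulate enumerate))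
    where
    Result : List Carrier → Set (c ⊔ ℓ)
    Result xs = ∃[ e ] e * e ≈ e × ¬ e ≈ 0# × (∀ {x} → x ∈ᴸ xs → ZeroOrUnitAt e x)

    process : ∀ xs → Result xs
    process []       = 1# , *-identityʳ 1# , 1≉0 , λ ()
    process (x ∷ xs) with process xs
    ... | e , ee≈e , e≉0 , done with ≈0? (e * x) | regular x
    ... | yes ex≈0 | _ = e , ee≈e , e≉0 , λ { (here ≡.refl) → inj₁ ex≈0 ; (there x∈) → done x∈ }
    ... | no ex≉0  | z , xxz≈x = e * u , eu , nonzero , λ { (here ≡.refl) → inj₂ (z , trans (*-assoc e u u) (*-congˡ uu≈u)) ; (there x∈) → persist (done x∈) }
      where
      u = x * z
      uu≈u : u * u ≈ u
      uu≈u = begin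
        u * (x * z)     ≈⟨ *-assoc u x z ⟨
        u * x * z       ≈⟨ *-congʳ (trans (*-comm u x) xxz≈x) ⟩
        x * z           ∎
      eu : (e * u) * (e * u) ≈ e * u
      eu = trans (interchange e u e u) (*-cong ee≈e uu≈u)
      nonzero : ¬ e * u ≈ 0#
      nonzero eu≈0 = ex≉0 (begin
        e * x            ≈⟨ *-congˡ (trans (*-comm u x) xxz≈x) ⟨
        e * (u * x)      ≈⟨ *-assoc e u x ⟨
        e * u * x        ≈⟨ *-congʳ eu≈0 ⟩
        0# * x           ≈⟨ zeroˡ x ⟩
        0#               ∎)
      swap : ∀ a → e * u * a ≈ e * a * u
      swap a = trans (*-assoc e u a) (trans (*-congˡ (*-comm u a)) (sym (*-assoc e a u)))
      persist : ∀ {a} → ZeroOrUnitAt e a → ZeroOrUnitAt (e * u) a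
      persist {a} (inj₁ ea≈0)        = inj₁ (trans (swap a) (trans (*-congʳ ea≈0) (zeroˡ u)))
      persist {a} (inj₂ (b , eab≈e)) = inj₂ (b , trans (swap (a * b)) (*-congʳ eab≈e))

    finish : Result (tabulate enumerate) → PrimitiveIdempotent
    finish (e , ee≈e , e≉0 , done) = record
      { e = e ; idempotent = ee≈e ; nonzero = e≉0 ; zeroOrUnit = λ x → respond x (surjective x) }
      where
      respond : ∀ x → ∃[ i ] enumerate i ≈ x → ZeroOrUnitAt e x
      respond x (i , p) with done (∈-tabulate⁺ i)
      ... | inj₁ ex≈0       = inj₁ (trans (*-congˡ (sym p)) ex≈0)
      ... | inj₂ (z , xz≈e) = inj₂ (z , trans (*-congˡ (*-congʳ (sym p))) xz≈e)

-- The tower of extensions and the order of its Frobenius.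

record Enumeration {c ℓ : Level} (R : CommutativeRing c ℓ) : Set (c ⊔ ℓ) where
  open CommutativeRing R
  field
    size       : ℕ
    enumerate  : Fin size → Carrier
    -- Repetitions are allowed: the search for an idempotent only has to meet every element, and a
    -- surjection passes easily to tuples.
    surjective : ∀ x → ∃[ i ] enumerate i ≈ x
    ≈0?        : ∀ x → Dec (x ≈ 0#)

-- The properties that the tower uses, stated for an abstract ring so that nested tuples are never
-- unfolded from one stage to the next.
record ArtinSchreierExtension {c ℓ : Level} (S : CommutativeRing c ℓ) (q : ℕ) (s : CommutativeRing.Carrier S) : Set (lsuc (c ⊔ ℓ)) where
  field
    extension : CommutativeRing c ℓ
    embedding : RingHom S extension
  private
    module S = CommutativeRing S
  open CommutativeRing extension
  open RingHom embedding
  open SemiringExp semiring using (_^_)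
  field
    root          : Carrier
    root-equation : root ^ q ≈ root + ι s
    nontrivial    : ¬ S.1# S.≈ S.0# → ¬ 1# ≈ 0#
    enumeration   : Enumeration S → Enumeration extension
    endomorphism-id : (ψ : RingHom extension extension) → (∀ a → RingHom.ι ψ (ι a) ≈ ι a) →
      RingHom.ι ψ root ≈ root → ∀ x → RingHom.ι ψ x ≈ x

artinSchreierExtension : ∀ {c ℓ} (S : CommutativeRing c ℓ) q″ s → ArtinSchreierExtension S (suc (suc q″)) s
artinSchreierExtension S q″ s = record
  { extension       = extension
  ; embedding       = embedding
  ; root            = root
  ; root-equation   = root-equation
  ; nontrivial      = λ 1≉0 p → 1≉0 (p fzero)
  ; enumeration     = λ e → let open Enumeration e in record
    { size       = size ^ᴺ q
    ; enumerate  = λ k i → enumerate (finToFun k i)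
    ; surjective = λ x → funToFin (λ i → proj₁ (surjective (x i))) , λ i →
        trans (reflexive (≡.cong enumerate (finToFun-funToFin (λ i → proj₁ (surjective (x i))) i))) (proj₂ (surjective (x i)))
    ; ≈0?        = λ x → all? (λ i → ≈0? (x i))
    }
  ; endomorphism-id = endomorphism-id
  }
  where
  open CommutativeRing S
  open ArtinSchreier S q″ s

module Iterates {c ℓ : Level} {A : CommutativeRing c ℓ} (f : RingHom A A) where
  open CommutativeRing A
  open RingHom f using () renaming (ι to φ; ι-cong to φ-cong)

  iterate : ℕ → Carrier → Carrier
  iterate n x = fold x φ n

  iterateʰ : ℕ → RingHom A A
  iterateʰ zero    = idHom A
  iterateʰ (suc n) = f ∘ʰ iterateʰ n

  iterateʰ≈iterate : ∀ n x → RingHom.ι (iterateʰ n) x ≈ iterate n x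
  iterateʰ≈iterate zero    x = refl
  iterateʰ≈iterate (suc n) x = φ-cong (iterateʰ≈iterate n x)

  iterate-cong : ∀ n {x y} → x ≈ y → iterate n x ≈ iterate n y
  iterate-cong zero    p = p
  iterate-cong (suc n) p = φ-cong (iterate-cong n p)

  iterate-+ : ∀ n x y → iterate n (x + y) ≈ iterate n x + iterate n y
  iterate-+ zero    x y = refl
  iterate-+ (suc n) x y = trans (φ-cong (iterate-+ n x y)) (RingHom.ι-+ f _ _)

  period-multiple : ∀ T {x} → iterate T x ≈ x → ∀ j → iterate (j *ᴺ T) x ≈ x
  period-multiple T p zero    = refl
  period-multiple T {x} p (suc j) = trans (reflexive (fold-+ x φ T)) (trans (iterate-cong T (period-multiple T p j)) p)

module PeriodLifting {c ℓ : Level} {S E : CommutativeRing c ℓ} (embedding : RingHom S E)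
  (f : RingHom S S) (g : RingHom E E)
  (commutes : ∀ a → CommutativeRing._≈_ E (RingHom.ι g (RingHom.ι embedding a)) (RingHom.ι embedding (RingHom.ι f a)))
  where
  private
    module S = CommutativeRing S
    module f = RingHom f
    module g = RingHom g
    module If = Iterates f
    module Ig = Iterates g
  open CommutativeRing E
  open SetoidReasoning setoid
  open RingHom embedding
  open SemiringMult semiring using () renaming (_×_ to _·_)
  open SemiringMult S.semiring using () renaming (_×_ to _·ˢ_)

  iterate-embed : ∀ n a → Ig.iterate n (ι a) ≈ ι (If.iterate n a)
  iterate-embed zero    a = refl
  iterate-embed (suc n) a = trans (g.ι-cong (iterate-embed n a)) (commutes (If.iterate n a))

  -- Each application of `g` translates the root by an element of the embedded ring, and `g` maps
  -- that ring to itself, so the translations accumulate inside it.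
  iterate-root : ∀ {root s} → g.ι root ≈ root + ι s → ∀ n → ∃[ r ] Ig.iterate n root ≈ root + ι r
  iterate-root {root} {s} p zero    = S.0# , sym (trans (+-congˡ ι-0) (+-identityʳ root))
  iterate-root {root} {s} p (suc n) with iterate-root {root} {s} p n
  ... | r , p′ = s S.+ f.ι r , (begin
    g.ι (Ig.iterate n root)        ≈⟨ g.ι-cong p′ ⟩
    g.ι (root + ι r)               ≈⟨ g.ι-+ root (ι r) ⟩
    g.ι root + g.ι (ι r)           ≈⟨ +-cong p (commutes r) ⟩
    root + ι s + ι (f.ι r)         ≈⟨ +-assoc _ _ _ ⟩
    root + (ι s + ι (f.ι r))       ≈⟨ +-congˡ (ι-+ _ _) ⟨
    root + ι (s S.+ f.ι r)         ∎)

  iterate-multiple : ∀ T → (∀ x → If.iterate T x S.≈ x) → ∀ {root r} → Ig.iterate T root ≈ root + ι r →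
    ∀ j → Ig.iterate (j *ᴺ T) root ≈ root + j · ι r
  iterate-multiple T period {root} {r} p zero    = sym (+-identityʳ root)
  iterate-multiple T period {root} {r} p (suc j) = begin
    Ig.iterate (T +ᴺ j *ᴺ T) root                    ≡⟨ fold-+ root g.ι T ⟩
    Ig.iterate T (Ig.iterate (j *ᴺ T) root)          ≈⟨ Ig.iterate-cong T (iterate-multiple T period p j) ⟩
    Ig.iterate T (root + j · ι r)                    ≈⟨ Ig.iterate-+ T root (j · ι r) ⟩
    Ig.iterate T root + Ig.iterate T (j · ι r)       ≈⟨ +-cong p fixed ⟩
    root + ι r + j · ι r                             ≈⟨ +-assoc _ _ _ ⟩
    root + (ι r + j · ι r)                           ∎
    where
    fixed : Ig.iterate T (j · ι r) ≈ j · ι r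
    fixed = begin
      Ig.iterate T (j · ι r)    ≈⟨ Ig.iterate-cong T (ι-× j r) ⟨
      Ig.iterate T (ι (j ·ˢ r)) ≈⟨ iterate-embed T (j ·ˢ r) ⟩
      ι (If.iterate T (j ·ˢ r)) ≈⟨ ι-cong (period (j ·ˢ r)) ⟩
      ι (j ·ˢ r)                ≈⟨ ι-× j r ⟩
      j · ι r                   ∎

  -- Iterating T times translates the root by some r of the smaller ring. These T iterations fix r,
  -- so q rounds translate by q r, which is 0.
  root-period : ∀ T → (∀ x → If.iterate T x S.≈ x) → ∀ q → (∀ x → q · x ≈ 0#) →
    ∀ {root s} → g.ι root ≈ root + ι s → Ig.iterate (q *ᴺ T) root ≈ root
  root-period T period q q×≈0 {root} {s} p with iterate-root {root} {s} p T
  ... | r , p′ = trans (iterate-multiple T period p′ q) (trans (+-congˡ (q×≈0 (ι r))) (+-identityʳ root))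

module Tower {c ℓ : Level} (F : DiscreteField c ℓ) (q″ : ℕ)
  (finite : Inverse (DiscreteField.setoid F) (≡.setoid (Fin (suc (suc q″))))) where
  open FiniteDiscreteField F q″ finite using (q; fermat; module Frobenius)
  private
    module F = DiscreteField F
  open FieldLinearAlgebra F using () renaming (≈0? to F≈0?)

  module Regularity {c′ ℓ′ : Level} {A : CommutativeRing c′ ℓ′} (hom : RingHom F.commutativeRing A) where
    open CommutativeRing A
    open Frobenius hom
    open Iterates frobenius
    open SemiringExp semiring using (_^_)

    iterate-divisible : ∀ n x → ∃[ z ] iterate n x ≈ x * z
    iterate-divisible zero    x = 1# , sym (*-identityʳ x)
    iterate-divisible (suc n) x with iterate-divisible n x
    ... | z , p = z * iterate n x ^ suc q″ , trans (*-congʳ p) (*-assoc x z _)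

    -- Since q is at least 2, the last application of φ makes the factor x occur twice. For a period
    -- n + 1 this reads x = x (x z), which is von Neumann regularity.
    iterate-square-divisible : ∀ n x → ∃[ z ] iterate (suc n) x ≈ x * (x * z)
    iterate-square-divisible n x with iterate-divisible n x
    ... | z , p = z * (z * w) , (begin
        y * (y * w)             ≈⟨ *-cong p (*-congʳ p) ⟩
        x * z * (x * z * w)     ≈⟨ *-assoc x z _ ⟩
        x * (z * (x * z * w))   ≈⟨ *-congˡ (*-congˡ (*-assoc x z w)) ⟩
        x * (z * (x * (z * w))) ≈⟨ *-congˡ (x∙yz≈y∙xz z x _) ⟩
        x * (x * (z * (z * w))) ∎)
      where
      open SetoidReasoning setoid
      open CommutativeSemigroupProperties *-commutativeSemigroup using (x∙yz≈y∙xz)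
      y = iterate n x
      w = y ^ q″

  record Stage (m : ℕ) : Set (lsuc (c ⊔ ℓ)) where
    field
      algebra : CommutativeRing c ℓ
      hom     : RingHom F.commutativeRing algebra
    open CommutativeRing algebra
    open Frobenius hom using (φ; frobenius)
    open Iterates frobenius using (iterate)
    field
      finiteness : Enumeration algebra
      1≉0        : ¬ 1# ≈ 0#
      -- The period is `suc T`, hence positive, as `iterate-square-divisible` requires.
      T          : ℕ
      period     : ∀ x → iterate (suc T) x ≈ x
      y          : ℕ → Carrier
      y-zero     : y 0 ≈ 1#
      y-suc      : ∀ {i} → i < m → φ (y (suc i)) ≈ y (suc i) + y i

  base : Stage 0
  base = record
    { algebra = F.commutativeRing
    ; hom = idHom F.commutativeRing
    ; finiteness = record
      { size = q ; enumerate = from ; surjective = λ x → to x , strictlyInverseʳ x ; ≈0? = F≈0? }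
    ; 1≉0 = F.1≉0
    ; T = 0
    ; period = fermat
    ; y = λ _ → F.1#
    ; y-zero = F.refl
    ; y-suc = λ ()
    }
    where open Inverse finite

  extendStage : ∀ {m} (S : Stage m) → ArtinSchreierExtension (Stage.algebra S) q (Stage.y S m) → Stage (suc m)
  extendStage {m} S X = record
    { algebra    = extension
    ; hom        = hom′
    ; finiteness = enumeration finiteness
    ; 1≉0        = nontrivial 1≉0
    -- The successor of this number is q times `suc T`: each stage multiplies the period by q.
    ; T          = T +ᴺ suc q″ *ᴺ suc T
    ; period     = λ x → E.trans (E.sym (IE.iterateʰ≈iterate T′ x)) (endomorphism-id (IE.iterateʰ T′)
        (λ a → E.trans (IE.iterateʰ≈iterate T′ (ι a))
          (E.trans (iterate-embed T′ a) (ι-cong (IS.period-multiple (suc T) (period a) q))))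
        (E.trans (IE.iterateʰ≈iterate T′ root)
          (root-period (suc T) period q FE.q×≈0 root-equation)) x)
    ; y          = y′
    ; y-zero     = E.trans (ι-cong y-zero) ι-1
    ; y-suc      = λ {i} → y′-suc i
    }
    where
    open Stage S
    open CommutativeRing algebra
    open ArtinSchreierExtension X
    open RingHom embedding
    hom′ : RingHom F.commutativeRing extension
    hom′ = embedding ∘ʰ hom
    module E = CommutativeRing extension
    module FS = Frobenius hom
    module FE = Frobenius hom′
    module IS = Iterates FS.frobenius
    module IE = Iterates FE.frobenius
    open PeriodLifting embedding FS.frobenius FE.frobenius (λ a → E.sym (ι-^ a q))

    T′ : ℕ
    T′ = q *ᴺ suc T

    -- Beyond the old indices only the value at m + 1 matters, and it is the new root.
    y′ : ℕ → E.Carrier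
    y′ i with i ℕₚ.≤? m
    ... | yes _ = ι (y i)
    ... | no  _ = root

    y′-suc : ∀ i → i < suc m → FE.φ (y′ (suc i)) E.≈ y′ (suc i) E.+ y′ i
    y′-suc i (s≤s i≤m) with suc i ℕₚ.≤? m | i ℕₚ.≤? m
    ... | _       | no i≰m = ⊥-elim (i≰m i≤m)
    ... | yes i<m | yes _  = E.trans (E.sym (ι-^ (y (suc i)) q)) (E.trans (ι-cong (y-suc i<m)) (ι-+ _ _))
    ... | no i≮m  | yes _  = E.trans root-equation (E.+-congˡ (E.reflexive (≡.cong (λ k → ι (y k)) (ℕₚ.≤-antisym (ℕₚ.≮⇒≥ i≮m) i≤m))))

  stage : ∀ m → Stage m
  stage zero    = base
  stage (suc m) = extendStage (stage m) (artinSchreierExtension _ q″ _)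

  record ChainField (m : ℕ) : Set (lsuc (c ⊔ ℓ)) where
    field
      K   : DiscreteField c ℓ
      hom : RingHom F.commutativeRing (DiscreteField.commutativeRing K)
    open DiscreteField K
    open Frobenius hom using (φ)
    field
      y      : ℕ → Carrier
      y-zero : y 0 ≈ 1#
      y-suc  : ∀ {i} → i < m → φ (y (suc i)) ≈ y (suc i) + y i

  chainField : ∀ m → ChainField m
  chainField m = record
    { K = field-of-fractions
    ; hom = localized ∘ʰ hom
    ; y = y
    ; y-zero = *-congˡ y-zero
    ; y-suc = λ {i} i<m → K.trans (K.sym (RingHom.ι-^ localized (y (suc i)) q)) (*-congˡ (y-suc i<m))
    }
    where
    open Stage (stage m)
    open CommutativeRing algebra
    open Enumeration finiteness
    open Regularity hom
    open Localization algebra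
    regular : ∀ x → ∃[ z ] x * (x * z) ≈ x
    regular x with iterate-square-divisible T x
    ... | z , p = z , trans (sym p) (period x)
    open PrimitiveIdempotent (primitive-idempotent enumerate surjective ≈0? 1≉0 regular)
    module K = DiscreteField field-of-fractions
    localized : RingHom algebra K.commutativeRing
    localized = localization e idempotent

-- The fixed field of φ, and independence under powers of θ.

hom-injective : ∀ {c ℓ c′ ℓ′} (A : DiscreteField c ℓ) {B : CommutativeRing c′ ℓ′} (f : RingHom (DiscreteField.commutativeRing A) B) →
  ¬ CommutativeRing._≈_ B (CommutativeRing.1# B) (CommutativeRing.0# B) →
  ∀ {a} → CommutativeRing._≈_ B (RingHom.ι f a) (CommutativeRing.0# B) → DiscreteField._≈_ A a (DiscreteField.0# A)
hom-injective A {B} f 1≉0 {a} ιa≈0 with DiscreteField.zero⊎unit A a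
... | inj₁ a≈0        = a≈0
... | inj₂ (b , ab≈1) = ⊥-elim (1≉0 (trans (sym ι-1) (trans (ι-cong (DiscreteField.sym A ab≈1)) (trans (ι-* a b) (trans (*-congʳ ιa≈0) (zeroˡ _))))))
  where
  open CommutativeRing B
  open RingHom f

module FixedField {c ℓ c′ ℓ′ : Level} (F : DiscreteField c ℓ) (q″ : ℕ)
  (finite : Inverse (DiscreteField.setoid F) (≡.setoid (Fin (suc (suc q″)))))
  (K : DiscreteField c′ ℓ′) (hom : RingHom (DiscreteField.commutativeRing F) (DiscreteField.commutativeRing K)) where
  open FiniteDiscreteField F q″ finite using (q)
  open DiscreteField K
  open FieldLinearAlgebra K
  open RingHom hom
  open SemiringExp semiring using (_^_)
  open SetoidReasoning setoid
  open RingProperties ring using (-1*x≈-x)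
  private
    module F = DiscreteField F
  open Inverse finite

  monomial : ∀ k → Fin (suc k) → Carrier
  monomial zero    _        = 1#
  monomial (suc k) fzero    = 0#
  monomial (suc k) (fsuc i) = monomial k i

  monomial-last : ∀ k → monomial k (fromℕ k) ≈ 1#
  monomial-last zero    = refl
  monomial-last (suc k) = monomial-last k

  eval-monomial : ∀ k x → eval (monomial k) x ≈ x ^ k
  eval-monomial zero    x = trans (+-congˡ (zeroʳ x)) (+-identityʳ 1#)
  eval-monomial (suc k) x = trans (+-identityˡ _) (*-congˡ (eval-monomial k x))

  ι-injective : ∀ {a b} → ι a ≈ ι b → a F.≈ b
  ι-injective {a} {b} p = RingProperties.x∙y⁻¹≈ε⇒x≈y F.ring a b
    (hom-injective F hom 1≉0 (trans (ι-+ a (F.- b)) (trans (+-cong p (ι-‿ b)) (-‿inverseʳ (ι b)))))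

  -- F already supplies the q roots of X^q - X.
  fixed-field : ∀ x → x ^ q ≈ x → ∃[ a ] x ≈ ι a
  fixed-field x x^q≈x with any? (λ i → ≈? x (ι (from i)))
  ... | yes (i , p) = from i , p
  ... | no x∉F = ⊥-elim (1≉0 (trans (sym (monomial-last q″))
      (root-bound p points (λ {i} {j} → distinct i j) (λ { fzero → root x x^q≈x ; (fsuc i) → root _ (fixed i) }) (fsuc (fsuc (fromℕ q″))))))
    where
    p : Fin (suc q) → Carrier
    -- The coefficients of X^q - X: first 0, then -1, then the monomial of degree q - 2 moved up by
    -- two places. The contradiction is read off its leading coefficient.
    p = 0# ∷ᵛ - 1# ∷ᵛ monomial q″
    points : Fin (suc q) → Carrier
    points = x ∷ᵛ λ i → ι (from i)
    distinct : ∀ i j → points i ≈ points j → i ≡ j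
    distinct fzero    fzero    e = ≡.refl
    distinct fzero    (fsuc j) e = ⊥-elim (x∉F (j , e))
    distinct (fsuc i) fzero    e = ⊥-elim (x∉F (i , sym e))
    distinct (fsuc i) (fsuc j) e = ≡.cong fsuc
      (≡.trans (≡.sym (strictlyInverseˡ i)) (≡.trans (to-cong (ι-injective e)) (strictlyInverseˡ j)))
    fixed : ∀ i → ι (from i) ^ q ≈ ι (from i)
    fixed i = trans (sym (ι-^ (from i) q)) (ι-cong (FiniteDiscreteField.fermat F q″ finite (from i)))
    root : ∀ z → z ^ q ≈ z → eval p z ≈ 0#
    root z z^q≈z = begin
      0# + z * (- 1# + z * eval (monomial q″) z)  ≈⟨ +-identityˡ _ ⟩
      z * (- 1# + z * eval (monomial q″) z)       ≈⟨ distribˡ z _ _ ⟩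
      z * - 1# + z * (z * eval (monomial q″) z)   ≈⟨ +-cong (trans (*-comm z _) (-1*x≈-x z)) (*-congˡ (*-congˡ (eval-monomial q″ z))) ⟩
      - z + z ^ q                                 ≈⟨ +-congˡ z^q≈z ⟩
      - z + z                                     ≈⟨ -‿inverseˡ z ⟩
      0#                                          ∎

module TwistedDifference {c ℓ c′ ℓ′ : Level} (F : DiscreteField c ℓ) (K : DiscreteField c′ ℓ′)
  (hom : RingHom (DiscreteField.commutativeRing F) (DiscreteField.commutativeRing K))
  (frobenius : RingHom (DiscreteField.commutativeRing K) (DiscreteField.commutativeRing K))
  (φ-ι : ∀ a → DiscreteField._≈_ K (RingHom.ι frobenius (RingHom.ι hom a)) (RingHom.ι hom a))
  (fixed-field : ∀ x → DiscreteField._≈_ K (RingHom.ι frobenius x) x → ∃[ a ] DiscreteField._≈_ K x (RingHom.ι hom a))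
  where
  private
    module F = DiscreteField F
  open DiscreteField K
  open RingHom hom
  open RingHom frobenius using () renaming
    (ι to φ; ι-cong to φ-cong; ι-+ to φ-+; ι-* to φ-*; ι-1 to φ-1; ι-0 to φ-0; ι-sum to φ-sum; ι-‿ to φ-‿)
  open SetoidReasoning setoid
  open RingProperties ring using (x∙y⁻¹≈ε⇒x≈y; x≈y⇒x∙y⁻¹≈ε; x[y-z]≈xy-xz; [y-z]x≈yx-zx; -‿+-comm; //-rightDividesˡ)
  open CommutativeSemigroupProperties +-commutativeSemigroup using (interchange)
  open CommutativeSemigroupProperties *-commutativeSemigroup using (x∙yz≈y∙xz)
  open SemiringSum semiring using (sum; sum-cong-≋; ∑-distrib-+; *-distribˡ-sum; sum-replicate-zero; ∑-comm)
  open FieldLinearAlgebra K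
  open LinearMaps commutativeRing using (fromMatrix; δ; sum-δ)

  θ : Carrier → Carrier
  θ x = φ x - x

  θ-cong : ∀ {x z} → x ≈ z → θ x ≈ θ z
  θ-cong p = +-cong (φ-cong p) (-‿cong p)

  θ-+ : ∀ x z → θ (x + z) ≈ θ x + θ z
  θ-+ x z = trans (+-cong (φ-+ x z) (sym (-‿+-comm x z))) (interchange _ _ _ _)

  θ-scale : ∀ a x → θ (ι a * x) ≈ ι a * θ x
  θ-scale a x = trans (+-congʳ (trans (φ-* _ _) (*-congʳ (φ-ι a)))) (sym (x[y-z]≈xy-xz _ _ _))

  θ-0 : θ 0# ≈ 0#
  θ-0 = x≈y⇒x∙y⁻¹≈ε φ-0

  φ≈1+θ : ∀ x → φ x ≈ x + θ x
  φ≈1+θ x = sym (trans (+-comm x (θ x)) (//-rightDividesˡ x (φ x)))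

  φ-θ : ∀ x → φ (θ x) ≈ θ (φ x)
  φ-θ x = trans (φ-+ _ _) (+-congˡ (φ-‿ x))

  θ-leibniz : ∀ x z → θ (x * z) ≈ θ x * φ z + x * θ z
  θ-leibniz x z = begin
    φ (x * z) - x * z                                ≈⟨ +-congʳ (φ-* x z) ⟩
    φ x * φ z - x * z                                ≈⟨ +-congʳ (//-rightDividesˡ (x * φ z) (φ x * φ z)) ⟨
    φ x * φ z - x * φ z + x * φ z - x * z            ≈⟨ +-assoc _ _ _ ⟩
    φ x * φ z - x * φ z + (x * φ z - x * z)          ≈⟨ +-cong ([y-z]x≈yx-zx _ _ _) (x[y-z]≈xy-xz _ _ _) ⟨
    θ x * φ z + x * θ z                              ∎

  θ^ : ℕ → Carrier → Carrier
  θ^ zero    x = x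
  θ^ (suc n) x = θ^ n (θ x)

  θ^-cong : ∀ n {x z} → x ≈ z → θ^ n x ≈ θ^ n z
  θ^-cong zero    p = p
  θ^-cong (suc n) p = θ^-cong n (θ-cong p)

  θ^-0 : ∀ n → θ^ n 0# ≈ 0#
  θ^-0 zero    = refl
  θ^-0 (suc n) = trans (θ^-cong n θ-0) (θ^-0 n)

  θ^-+ : ∀ n x z → θ^ n (x + z) ≈ θ^ n x + θ^ n z
  θ^-+ zero    x z = refl
  θ^-+ (suc n) x z = trans (θ^-cong n (θ-+ x z)) (θ^-+ n _ _)

  θ^-scale : ∀ n a x → θ^ n (ι a * x) ≈ ι a * θ^ n x
  θ^-scale zero    a x = refl
  θ^-scale (suc n) a x = trans (θ^-cong n (θ-scale a x)) (θ^-scale n a _)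

  θ^-combination : ∀ n {l} (c : Fin l → F.Carrier) (v : Fin l → Carrier) →
    θ^ n (sum (λ i → ι (c i) * v i)) ≈ sum (λ i → ι (c i) * θ^ n (v i))
  θ^-combination n {zero}  c v = θ^-0 n
  θ^-combination n {suc l} c v = trans (θ^-+ n _ _) (+-cong (θ^-scale n _ _) (θ^-combination n (λ i → c (fsuc i)) (λ i → v (fsuc i))))

  φ-θ^ : ∀ n x → φ (θ^ n x) ≈ θ^ n (φ x)
  φ-θ^ zero    x = refl
  φ-θ^ (suc n) x = trans (φ-θ^ n (θ x)) (θ^-cong n (φ-θ x))

  θ-θ^ : ∀ n x → θ (θ^ n x) ≈ θ^ (suc n) x
  θ-θ^ zero    x = refl
  θ-θ^ (suc n) x = θ-θ^ n (θ x)

  θ^-homo-+ : ∀ m n x → θ^ (m +ᴺ n) x ≈ θ^ n (θ^ m x)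
  θ^-homo-+ zero    n x = refl
  θ^-homo-+ (suc m) n x = θ^-homo-+ m n (θ x)

  θ^-vanish-≤ : ∀ {m n x} → m ≤ n → θ^ m x ≈ 0# → θ^ n x ≈ 0#
  θ^-vanish-≤ {m} {n} {x} m≤n p = trans (reflexive (≡.cong (λ k → θ^ k x) (≡.sym (ℕₚ.m+[n∸m]≡n m≤n))))
    (trans (θ^-homo-+ m (n ∸ᴺ m) x) (trans (θ^-cong (n ∸ᴺ m) p) (θ^-0 (n ∸ᴺ m))))

  -- By the twisted product rule, θ(xz) is a sum of two products, each with one kernel index lowered
  -- by one. The twist is harmless: φ commutes with θ, so φ(z) lies in the same kernel as z.
  kernel-product : ∀ i j {x z} → θ^ (suc i) x ≈ 0# → θ^ (suc j) z ≈ 0# → θ^ (suc (i +ᴺ j)) (x * z) ≈ 0#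
  kernel-product i j {x} {z} p q = trans (θ^-cong (i +ᴺ j) (θ-leibniz x z))
    (trans (θ^-+ (i +ᴺ j) _ _) (trans (+-cong (left i p) (right j q)) (+-identityˡ 0#)))
    where
    left : ∀ i → θ^ (suc i) x ≈ 0# → θ^ (i +ᴺ j) (θ x * φ z) ≈ 0#
    left zero    p = trans (θ^-cong j (trans (*-congʳ p) (zeroˡ _))) (θ^-0 j)
    left (suc i) p = kernel-product i j p (trans (sym (φ-θ^ (suc j) z)) (trans (φ-cong q) φ-0))
    right : ∀ j → θ^ (suc j) z ≈ 0# → θ^ (i +ᴺ j) (x * θ z) ≈ 0#
    right zero    q = trans (θ^-cong (i +ᴺ 0) (trans (*-congˡ q) (zeroʳ x))) (θ^-0 (i +ᴺ 0))
    right (suc j) q = trans (reflexive (≡.cong (λ k → θ^ k (x * θ z)) (ℕₚ.+-suc i j))) (kernel-product i j p q)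

  Independent : ∀ {l} → (Fin l → Carrier) → Set (c ⊔ ℓ ⊔ ℓ′)
  Independent {l} v = ∀ (a : Fin l → F.Carrier) → sum (λ i → ι (a i) * v i) ≈ 0# → ∀ i → a i F.≈ F.0#

  Independent-tail : ∀ {l} {v : Fin (suc l) → Carrier} → Independent v → Independent (λ i → v (fsuc i))
  Independent-tail {v = v} ind a p i = ind (F.0# ∷ᵛ a) (trans (+-congʳ (trans (*-congʳ ι-0) (zeroˡ _))) (trans (+-identityˡ _) p)) (fsuc i)

  Independent-φ : ∀ {l} {v : Fin l → Carrier} → Independent v → Independent (λ i → φ (v i))
  Independent-φ {v = v} ind a p = ind a (hom-injective K frobenius 1≉0 (begin
    φ (sum (λ i → ι (a i) * v i))       ≈⟨ φ-sum (λ i → ι (a i) * v i) ⟩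
    sum (λ i → φ (ι (a i) * v i))       ≈⟨ sum-cong-≋ (λ i → trans (φ-* (ι (a i)) (v i)) (*-congʳ (φ-ι (a i)))) ⟩
    sum (λ i → ι (a i) * φ (v i))       ≈⟨ p ⟩
    0#                                  ∎))

  -- The two relations add up to one for φ(v) with coefficients x, because φ = 1 + θ. Subtracting it
  -- from the image of the first relation under φ leaves the coefficients θ(x). Two consecutive
  -- relations yield one, so the number of relations drops in step with the number of coefficients.
  θ-relation : ∀ {l} (x v : Fin l → Carrier) k →
    sum (λ i → x i * θ^ k (v i)) ≈ 0# → sum (λ i → x i * θ^ (suc k) (v i)) ≈ 0# →
    sum (λ i → θ (x i) * θ^ k (φ (v i))) ≈ 0#
  θ-relation x v k p q = begin
    sum (λ i → θ (x i) * θ^ k (φ (v i)))                  ≈⟨ +-identityʳ _ ⟨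
    sum (λ i → θ (x i) * θ^ k (φ (v i))) + 0#             ≈⟨ +-congˡ shifted ⟨
    sum (λ i → θ (x i) * θ^ k (φ (v i))) + sum (λ i → x i * θ^ k (φ (v i)))
                                                          ≈⟨ ∑-distrib-+ (λ i → θ (x i) * θ^ k (φ (v i))) (λ i → x i * θ^ k (φ (v i))) ⟨
    sum (λ i → θ (x i) * θ^ k (φ (v i)) + x i * θ^ k (φ (v i)))
                                                          ≈⟨ sum-cong-≋ (λ i → trans (sym (distribʳ _ (θ (x i)) (x i)))
                                                               (*-cong (//-rightDividesˡ (x i) (φ (x i))) (sym (φ-θ^ k (v i))))) ⟩
    sum (λ i → φ (x i) * φ (θ^ k (v i)))                  ≈⟨ sum-cong-≋ (λ i → φ-* (x i) _) ⟨
    sum (λ i → φ (x i * θ^ k (v i)))                      ≈⟨ φ-sum (λ i → x i * θ^ k (v i)) ⟨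
    φ (sum (λ i → x i * θ^ k (v i)))                      ≈⟨ trans (φ-cong p) φ-0 ⟩
    0#                                                    ∎
    where
    shifted : sum (λ i → x i * θ^ k (φ (v i))) ≈ 0#
    shifted = begin
      sum (λ i → x i * θ^ k (φ (v i)))                              ≈⟨ sum-cong-≋ (λ i → trans (*-congˡ (trans (θ^-cong k (φ≈1+θ (v i))) (θ^-+ k _ _))) (distribˡ (x i) _ _)) ⟩
      sum (λ i → x i * θ^ k (v i) + x i * θ^ (suc k) (v i))         ≈⟨ ∑-distrib-+ (λ i → x i * θ^ k (v i)) (λ i → x i * θ^ (suc k) (v i)) ⟩
      sum (λ i → x i * θ^ k (v i)) + sum (λ i → x i * θ^ (suc k) (v i)) ≈⟨ +-cong p q ⟩
      0# + 0#                                                       ≈⟨ +-identityˡ 0# ⟩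
      0#                                                            ∎

  -- Artin's argument: normalise a relation to have a coefficient 1; applying θ to its
  -- coefficients gives a shorter relation, so they lie in F.
  columns-independent : ∀ {l} (v x : Fin l → Carrier) → Independent v →
    (∀ {k} → k < l → sum (λ i → x i * θ^ k (v i)) ≈ 0#) → ∀ i → x i ≈ 0#
  columns-independent {suc l} v x ind rel = go (zero⊎unit (x fzero))
    where
    go : x fzero ≈ 0# ⊎ ∃[ z ] x fzero * z ≈ 1# → ∀ i → x i ≈ 0#
    go (inj₁ x₀≈0) fzero    = x₀≈0
    go (inj₁ x₀≈0) (fsuc i) = columns-independent (λ j → v (fsuc j)) (λ j → x (fsuc j)) (Independent-tail {v = v} ind)
      (λ {k} k<l → trans (sym (trans (+-congʳ (trans (*-congʳ x₀≈0) (zeroˡ _))) (+-identityˡ _))) (rel (ℕₚ.m≤n⇒m≤1+n k<l))) i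
    go (inj₂ (z , x₀z≈1)) = ⊥-elim (F.1≉0 (coefficients≈0 fzero))
      where
      x̂ : Fin (suc l) → Carrier
      x̂ i = z * x i
      x̂₀≈1 : x̂ fzero ≈ 1#
      x̂₀≈1 = trans (*-comm z _) x₀z≈1
      rel′ : ∀ {k} → k < suc l → sum (λ i → x̂ i * θ^ k (v i)) ≈ 0#
      rel′ {k} k<l = trans (sum-cong-≋ (λ i → *-assoc z (x i) (θ^ k (v i))))
        (trans (sym (*-distribˡ-sum z (λ i → x i * θ^ k (v i)))) (trans (*-congˡ (rel k<l)) (zeroʳ z)))
      θx̂₀≈0 : θ (x̂ fzero) ≈ 0#
      θx̂₀≈0 = x≈y⇒x∙y⁻¹≈ε (trans (φ-cong x̂₀≈1) (trans φ-1 (sym x̂₀≈1)))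
      tail-fixed : ∀ i → θ (x̂ (fsuc i)) ≈ 0#
      tail-fixed = columns-independent (λ i → φ (v (fsuc i))) (λ i → θ (x̂ (fsuc i))) (Independent-φ {v = λ i → v (fsuc i)} (Independent-tail {v = v} ind))
        λ {k} k<l → trans (sym (trans (+-congʳ (trans (*-congʳ θx̂₀≈0) (zeroˡ _))) (+-identityˡ _)))
          (θ-relation x̂ v k (rel′ (ℕₚ.m≤n⇒m≤1+n k<l)) (rel′ (s≤s k<l)))
      coefficient : ∀ i → ∃[ a ] x̂ i ≈ ι a
      coefficient fzero    = F.1# , trans x̂₀≈1 (sym ι-1)
      coefficient (fsuc i) = fixed-field _ (x∙y⁻¹≈ε⇒x≈y _ _ (tail-fixed i))
      coefficients≈0 : ∀ i → proj₁ (coefficient i) F.≈ F.0#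
      coefficients≈0 = ind (λ i → proj₁ (coefficient i))
        (trans (sum-cong-≋ (λ i → *-congʳ {v i} (sym (proj₂ (coefficient i))))) (rel′ (s≤s z≤n)))

  -- The Moore-type matrix with entries θ^k(v_i) is square, so by `columns-independent` it defines a
  -- surjective map. Pairing `a` with a preimage of `δ k₀` isolates `a k₀`.
  rows-independent : ∀ {l} (v a : Fin l → Carrier) → Independent v →
    (∀ i → sum (λ k → a k * θ^ (toℕ k) (v i)) ≈ 0#) → ∀ k → a k ≈ 0#
  rows-independent {l} v a ind kills k₀ with injective⇒surjective (fromMatrix {k = l} {m = l} (λ k i → θ^ (toℕ k) (v i)))
      (λ x p → columns-independent v x ind (λ {k} k<l → trans (reflexive (≡.cong (λ k → sum (λ i → x i * θ^ k (v i))) (≡.sym (toℕ-fromℕ< k<l)))) (p (fromℕ< k<l))))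
      (δ k₀)
  ... | x , Mx≈δ = begin
    a k₀                                                          ≈⟨ sum-δ a k₀ ⟨
    sum (λ k → a k * δ k₀ k)                                      ≈⟨ sum-cong-≋ (λ k → *-congˡ {a k} (sym (Mx≈δ k))) ⟩
    sum (λ k → a k * sum (λ i → x i * M k i))                     ≈⟨ sum-cong-≋ (λ k → *-distribˡ-sum (a k) (λ i → x i * M k i)) ⟩
    sum (λ k → sum (λ i → a k * (x i * M k i)))                   ≈⟨ ∑-comm (λ k i → a k * (x i * M k i)) ⟩
    sum (λ i → sum (λ k → a k * (x i * M k i)))                   ≈⟨ sum-cong-≋ (λ i → sum-cong-≋ (λ k → x∙yz≈y∙xz (a k) (x i) (M k i))) ⟩
    sum (λ i → sum (λ k → x i * (a k * M k i)))                   ≈⟨ sum-cong-≋ (λ i → *-distribˡ-sum (x i) (λ k → a k * M k i)) ⟨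
    sum (λ i → x i * sum (λ k → a k * M k i))                     ≈⟨ sum-cong-≋ (λ i → trans (*-congˡ (kills i)) (zeroʳ (x i))) ⟩
    sum {l} (λ i → 0#)                                            ≈⟨ sum-replicate-zero l ⟩
    0#                                                            ∎
    where
    M : Fin l → Fin l → Carrier
    M k i = θ^ (toℕ k) (v i)

-- The chain y_0, y_1, ... as coordinates on the kernels of powers of θ.

record FrobeniusChain {c ℓ : Level} (F : DiscreteField c ℓ) (m : ℕ) : Set (lsuc (c ⊔ ℓ)) where
  private
    module F = DiscreteField F
  field
    K         : DiscreteField c ℓ
    hom       : RingHom F.commutativeRing (DiscreteField.commutativeRing K)
    frobenius : RingHom (DiscreteField.commutativeRing K) (DiscreteField.commutativeRing K)
  open DiscreteField K
  open RingHom hom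
  open RingHom frobenius using () renaming (ι to φ)
  field
    φ-ι         : ∀ a → φ (ι a) ≈ ι a
    fixed-field : ∀ x → φ x ≈ x → ∃[ a ] x ≈ ι a
    y           : ℕ → Carrier
    y-zero      : y 0 ≈ 1#
    y-suc       : ∀ {i} → i < m → φ (y (suc i)) ≈ y (suc i) + y i

module Chain {c ℓ : Level} {F : DiscreteField c ℓ} {m : ℕ} (X : FrobeniusChain F m) where
  private
    module F = DiscreteField F
  open FrobeniusChain X
  open DiscreteField K
  open TwistedDifference F K hom frobenius φ-ι fixed-field public
  open RingHom hom
  open RingHom frobenius using () renaming (ι-cong to φ-cong; ι-1 to φ-1)
  open SetoidReasoning setoid
  open RingProperties ring using (x∙y⁻¹≈ε⇒x≈y; x≈y⇒x∙y⁻¹≈ε; //-rightDividesˡ; xyx⁻¹≈y; -1*x≈-x)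
  open SemiringSum semiring using (sum; sum-cong-≋; sum-replicate-zero)

  θ-y-zero : θ (y 0) ≈ 0#
  θ-y-zero = x≈y⇒x∙y⁻¹≈ε (trans (φ-cong y-zero) (trans φ-1 (sym y-zero)))

  θ-y-suc : ∀ {i} → i < m → θ (y (suc i)) ≈ y i
  θ-y-suc {i} i<m = trans (+-congʳ (y-suc i<m)) (xyx⁻¹≈y (y (suc i)) (y i))

  θ^-y-vanish : ∀ {b} → b ≤ m → θ^ (suc b) (y b) ≈ 0#
  θ^-y-vanish {zero}  _   = θ-y-zero
  θ^-y-vanish {suc b} b<m = trans (θ^-cong (suc b) (θ-y-suc b<m)) (θ^-y-vanish (ℕₚ.<⇒≤ b<m))

  combination : ∀ {l} → (Fin l → F.Carrier) → Carrier
  combination a = sum (λ i → ι (a i) * y (toℕ i))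

  θ-combination : ∀ {l} (a : Fin (suc l) → F.Carrier) → l ≤ m → θ (combination a) ≈ combination (λ i → a (fsuc i))
  θ-combination {l} a l≤m = begin
    θ (combination a)                                             ≈⟨ θ^-combination 1 a (λ i → y (toℕ i)) ⟩
    ι (a fzero) * θ (y 0) + sum (λ i → ι (a (fsuc i)) * θ (y (suc (toℕ i))))
      ≈⟨ +-cong (trans (*-congˡ θ-y-zero) (zeroʳ _)) (sum-cong-≋ (λ i → *-congˡ (θ-y-suc (ℕₚ.<-≤-trans (toℕ<n i) l≤m)))) ⟩
    0# + combination (λ i → a (fsuc i))                           ≈⟨ +-identityˡ _ ⟩
    combination (λ i → a (fsuc i))                                ∎

  -- Applying θ kills y_0 and shifts the other coordinates down, so induction handles all but the
  -- first; that one then remains alone.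
  y-independent : ∀ {l} → l ≤ suc m → Independent {l} (λ i → y (toℕ i))
  y-independent {suc l} (s≤s l≤m) a p = λ { fzero → head ; (fsuc i) → tail i }
    where
    tail : ∀ i → a (fsuc i) F.≈ F.0#
    tail = y-independent (ℕₚ.m≤n⇒m≤1+n l≤m) (λ i → a (fsuc i)) (trans (sym (θ-combination a l≤m)) (trans (θ-cong p) θ-0))
    head : a fzero F.≈ F.0#
    head = hom-injective F hom 1≉0 (begin
      ι (a fzero)                  ≈⟨ trans (*-congˡ y-zero) (*-identityʳ _) ⟨
      ι (a fzero) * y 0            ≈⟨ +-identityʳ _ ⟨
      ι (a fzero) * y 0 + 0#       ≈⟨ +-congˡ (trans (sum-cong-≋ (λ i → trans (*-congʳ (trans (ι-cong (tail i)) ι-0)) (zeroˡ (y (suc (toℕ i)))))) (sum-replicate-zero l)) ⟨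
      combination a                ≈⟨ p ⟩
      0#                           ∎)

  -- Raise the indices in the coordinates of θ(x) by one. The resulting `lift` has the same image
  -- under θ as x, so the difference is fixed by φ and is a multiple of y_0 = 1.
  kernel-coordinates : ∀ l → l ≤ suc m → ∀ x → θ^ l x ≈ 0# → ∃[ a ] x ≈ combination {l} a
  kernel-coordinates zero    _         x p = (λ ()) , p
  kernel-coordinates (suc l) (s≤s l≤m) x p with kernel-coordinates l (ℕₚ.m≤n⇒m≤1+n l≤m) (θ x) p
  ... | b , θx≈ = a , x≈
    where
    lift : Carrier
    lift = sum (λ i → ι (b i) * y (suc (toℕ i)))
    θ-lift : θ lift ≈ θ x
    θ-lift = trans (θ^-combination 1 b (λ i → y (suc (toℕ i))))
      (trans (sum-cong-≋ (λ i → *-congˡ (θ-y-suc (ℕₚ.<-≤-trans (toℕ<n i) l≤m)))) (sym θx≈))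
    θ-difference : θ (x - lift) ≈ 0#
    θ-difference = begin
      θ (x - lift)                        ≈⟨ θ-cong (+-congˡ (-1*x≈-x lift)) ⟨
      θ (x + - 1# * lift)                 ≈⟨ θ-cong (+-congˡ (*-congʳ (trans (ι-‿ F.1#) (-‿cong ι-1)))) ⟨
      θ (x + ι (F.- F.1#) * lift)         ≈⟨ θ-+ x _ ⟩
      θ x + θ (ι (F.- F.1#) * lift)       ≈⟨ +-congˡ (θ-scale (F.- F.1#) lift) ⟩
      θ x + ι (F.- F.1#) * θ lift         ≈⟨ +-congˡ (*-cong (trans (ι-‿ F.1#) (-‿cong ι-1)) θ-lift) ⟩
      θ x + - 1# * θ x                    ≈⟨ +-congˡ (-1*x≈-x (θ x)) ⟩
      θ x - θ x                           ≈⟨ -‿inverseʳ (θ x) ⟩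
      0#                                  ∎
    constant : ∃[ a ] x - lift ≈ ι a
    constant = fixed-field (x - lift) (x∙y⁻¹≈ε⇒x≈y _ _ θ-difference)
    a : Fin (suc l) → F.Carrier
    a = proj₁ constant ∷ᵛ b
    x≈ : x ≈ combination a
    x≈ = begin
      x                                   ≈⟨ //-rightDividesˡ lift x ⟨
      x - lift + lift                     ≈⟨ +-congʳ (proj₂ constant) ⟩
      ι (proj₁ constant) + lift           ≈⟨ +-congʳ (trans (*-congˡ y-zero) (*-identityʳ _)) ⟨
      combination a                       ∎

  coordinates-vanish : ∀ i {l} → l ≤ suc m → (a : Fin l → F.Carrier) → θ^ i (combination a) ≈ 0# → ∀ j → i ≤ toℕ j → a j F.≈ F.0#
  coordinates-vanish zero    l≤m       a p j        _         = y-independent l≤m a p j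
  coordinates-vanish (suc i) (s≤s l≤m) a p (fsuc j) (s≤s i≤j) =
    coordinates-vanish i (ℕₚ.m≤n⇒m≤1+n l≤m) (λ k → a (fsuc k)) (trans (θ^-cong i (sym (θ-combination a l≤m))) p) j i≤j

frobeniusChain : ∀ {c ℓ} (F : DiscreteField c ℓ) q″ →
  Inverse (DiscreteField.setoid F) (≡.setoid (Fin (suc (suc q″)))) → ∀ m → FrobeniusChain F m
frobeniusChain F q″ finite m = record
  { K = K
  ; hom = hom
  ; frobenius = frobenius
  ; φ-ι = φ-ι
  ; fixed-field = FixedField.fixed-field F q″ finite K hom
  ; y = y
  ; y-zero = y-zero
  ; y-suc = y-suc
  }
  where
  open Tower F q″ finite
  open ChainField (chainField m)
  open FiniteDiscreteField.Frobenius F q″ finite hom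

-- Triangular matrices from operators in θ.

-- Matrices of the operators Σ α_{k,i} y_i θ^k, with i + offset ≤ k < w, in the basis y_0, ..., y_{n-1}.
module Words {c ℓ : Level} {F : DiscreteField c ℓ} {m : ℕ} (X : FrobeniusChain F m)
  (n w offset : ℕ) (n≤m+1 : n ≤ suc m) (w≤n : w ≤ n) where
  private
    module F where
      open DiscreteField F public
      open SemiringSum semiring public
  open FrobeniusChain X
  open Chain X
  open DiscreteField K
  open RingHom hom
  open SetoidReasoning setoid
  open SemiringSum semiring using (sum; sum-cong-≋; ∑-distrib-+; *-distribˡ-sum; *-distribʳ-sum; sum-replicate-zero; ∑-comm)
  open CommutativeSemigroupProperties *-commutativeSemigroup using (x∙yz≈y∙xz)
  open LinearMap
  open LinearMaps F.commutativeRing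
  open FieldLinearAlgebra F using (kernel)

  -- θ^k lowers the index of a basis vector by k and multiplication by y_i raises it by at most i,
  -- so an admissible pair lowers indices by at least `offset`.
  Admissible : Fin w → Fin w → Set
  Admissible k i = toℕ i +ᴺ offset ≤ toℕ k

  admissible? : ∀ k i → Dec (Admissible k i)
  admissible? k i = toℕ i +ᴺ offset ℕₚ.≤? toℕ k

  private
    index≤m : ∀ {l} → l ≤ n → (i : Fin l) → toℕ i ≤ m
    index≤m l≤n i = ℕₚ.≤-pred (ℕₚ.≤-trans (toℕ<n i) (ℕₚ.≤-trans l≤n n≤m+1))

  -- For k at most b the factors lie in the kernels of θ^(i+1) and θ^(b-k+1), and admissibility
  -- bounds the exponent i + b - k + 1 that `kernel-product` gives. The truncated subtraction is
  -- safe: if `offset` exceeds b then so does k, and the product is 0.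
  operator-kernel : ∀ k i → Admissible k i → ∀ (b : Fin n) → θ^ (suc (toℕ b) ∸ᴺ offset) (y (toℕ i) * θ^ (toℕ k) (y (toℕ b))) ≈ 0#
  operator-kernel k i ad b with toℕ k ℕₚ.≤? toℕ b
  ... | no k≰b = trans (θ^-cong r (trans (*-congˡ (θ^-vanish-≤ (ℕₚ.≰⇒> k≰b) (θ^-y-vanish (index≤m ℕₚ.≤-refl b)))) (zeroʳ _))) (θ^-0 r)
    where r = suc (toℕ b) ∸ᴺ offset
  ... | yes k≤b = θ^-vanish-≤ exponent (kernel-product (toℕ i) (toℕ b ∸ᴺ toℕ k) (θ^-y-vanish (index≤m w≤n i))
      (trans (sym (θ^-homo-+ (toℕ k) (suc (toℕ b ∸ᴺ toℕ k)) (y (toℕ b))))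
        (trans (reflexive (≡.cong (λ r → θ^ r (y (toℕ b))) (≡.trans (ℕₚ.+-suc (toℕ k) _) (≡.cong suc (ℕₚ.m+[n∸m]≡n k≤b)))))
          (θ^-y-vanish (index≤m ℕₚ.≤-refl b)))))
    where
    exponent : suc (toℕ i +ᴺ (toℕ b ∸ᴺ toℕ k)) ≤ suc (toℕ b) ∸ᴺ offset
    exponent = ℕₚ.m+n≤o⇒m≤o∸n _ (s≤s (ℕₚ.≤-trans (ℕₚ.≤-reflexive eq)
      (ℕₚ.≤-trans (ℕₚ.+-monoˡ-≤ (toℕ b ∸ᴺ toℕ k) ad) (ℕₚ.≤-reflexive (ℕₚ.m+[n∸m]≡n k≤b)))))
      where
      eq : toℕ i +ᴺ (toℕ b ∸ᴺ toℕ k) +ᴺ offset ≡ toℕ i +ᴺ offset +ᴺ (toℕ b ∸ᴺ toℕ k)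
      eq = ≡.trans (ℕₚ.+-assoc (toℕ i) _ offset) (≡.trans (≡.cong (toℕ i +ᴺ_) (ℕₚ.+-comm _ offset)) (≡.sym (ℕₚ.+-assoc (toℕ i) offset _)))

  private
    coordinates : ∀ k i → Admissible k i → ∀ (b : Fin n) → ∃[ a ] y (toℕ i) * θ^ (toℕ k) (y (toℕ b)) ≈ combination {n} a
    coordinates k i ad b = kernel-coordinates n n≤m+1 _
      (θ^-vanish-≤ (ℕₚ.≤-trans (ℕₚ.m∸n≤m _ offset) (toℕ<n b)) (operator-kernel k i ad b))

  coefficient : ∀ k i → Carrier
  coefficient k i with admissible? k i
  ... | yes _ = y (toℕ i)
  ... | no  _ = 0#

  -- Inadmissible pairs get the zero matrix, so the parameters fill a whole w by w square and the
  -- admissible pairs need no enumeration of their own.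
  generator : (k i : Fin w) → Fin n → Fin n → F.Carrier
  generator k i a b with admissible? k i
  ... | yes ad = proj₁ (coordinates k i ad b) a
  ... | no  _  = F.0#

  generator-spec : ∀ k i b → combination (λ a → generator k i a b) ≈ coefficient k i * θ^ (toℕ k) (y (toℕ b))
  generator-spec k i b with admissible? k i
  ... | yes ad = sym (proj₂ (coordinates k i ad b))
  ... | no  _  = trans (sum-cong-≋ {n} (λ a → trans (*-congʳ ι-0) (zeroˡ (y (toℕ a))))) (trans (sum-replicate-zero n) (sym (zeroˡ _)))

  generator-shape : ∀ k i {a b} → ¬ toℕ a +ᴺ offset ≤ toℕ b → generator k i a b F.≈ F.0#
  generator-shape k i {a} {b} a≰b with admissible? k i
  ... | no  _  = F.refl
  ... | yes ad = coordinates-vanish (suc (toℕ b) ∸ᴺ offset) n≤m+1 (proj₁ (coordinates k i ad b))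
      (trans (θ^-cong (suc (toℕ b) ∸ᴺ offset) (sym (proj₂ (coordinates k i ad b)))) (operator-kernel k i ad b)) a
      (ℕₚ.m≤n+o⇒m∸n≤o (suc (toℕ b)) offset (ℕₚ.≤-trans (ℕₚ.≰⇒> a≰b) (ℕₚ.≤-reflexive (ℕₚ.+-comm (toℕ a) offset))))

  word : (Fin (w *ᴺ w) → F.Carrier) → Fin n → Fin n → F.Carrier
  word α a b = F.sum (λ k → F.sum (λ i → α (combine k i) F.* generator k i a b))

  word-cong : ∀ {α β} → (∀ x → α x F.≈ β x) → ∀ a b → word α a b F.≈ word β a b
  word-cong p a b = F.sum-cong-≋ (λ k → F.sum-cong-≋ (λ i → F.*-congʳ {generator k i a b} (p (combine k i))))

  word-+ : ∀ α β a b → word (λ x → α x F.+ β x) a b F.≈ word α a b F.+ word β a b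
  word-+ α β a b = F.trans (F.sum-cong-≋ (λ k → combination-+ (λ i → α (combine k i)) (λ i → β (combine k i)) (λ i → generator k i a b)))
    (F.∑-distrib-+ (λ k → F.sum (λ i → α (combine k i) F.* generator k i a b)) (λ k → F.sum (λ i → β (combine k i) F.* generator k i a b)))

  word-* : ∀ r α a b → word (λ x → r F.* α x) a b F.≈ r F.* word α a b
  word-* r α a b = F.trans (F.sum-cong-≋ (λ k → combination-* r (λ i → α (combine k i)) (λ i → generator k i a b)))
    (F.sym (F.*-distribˡ-sum r (λ k → F.sum (λ i → α (combine k i) F.* generator k i a b))))

  word-shape : ∀ α {a b} → ¬ toℕ a +ᴺ offset ≤ toℕ b → word α a b F.≈ F.0#
  word-shape α a≰b = F.trans (F.sum-cong-≋ {w} (λ k → F.trans (F.sum-cong-≋ (λ i → F.trans (F.*-congˡ {α (combine k i)} (generator-shape k i a≰b)) (F.zeroʳ (α (combine k i)))))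
    (F.sum-replicate-zero w))) (F.sum-replicate-zero w)

  word-0 : ∀ {α} → (∀ k i → Admissible k i → α (combine k i) F.≈ F.0#) → ∀ a b → word α a b F.≈ F.0#
  word-0 {α} p a b = F.trans (F.sum-cong-≋ {w} (λ k → F.trans (F.sum-cong-≋ (λ i → term k i)) (F.sum-replicate-zero w))) (F.sum-replicate-zero w)
    where
    term : ∀ k i → α (combine k i) F.* generator k i a b F.≈ F.0#
    term k i with p k i | admissible? k i
    ... | p′ | yes ad = F.trans (F.*-congʳ (p′ ad)) (F.zeroˡ _)
    ... | _  | no  _  = F.zeroʳ _

  private
    combination-cong : ∀ {l} {a b : Fin l → F.Carrier} → (∀ i → a i F.≈ b i) → combination a ≈ combination b
    combination-cong p = sum-cong-≋ (λ i → *-congʳ (ι-cong (p i)))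

    combination-0 : ∀ {l} {a : Fin l → F.Carrier} → (∀ i → a i F.≈ F.0#) → combination a ≈ 0#
    combination-0 {l} p = trans (sum-cong-≋ (λ i → trans (*-congʳ (trans (ι-cong (p i)) ι-0)) (zeroˡ (y (toℕ i))))) (sum-replicate-zero l)

    combination-sum : ∀ {l j} (a : Fin j → Fin l → F.Carrier) → combination (λ i → F.sum (λ k → a k i)) ≈ sum (λ k → combination (a k))
    combination-sum a = trans (sum-cong-≋ (λ i → trans (*-congʳ (ι-sum (λ k → a k i))) (*-distribʳ-sum (y (toℕ i)) (λ k → ι (a k i)))))
      (∑-comm (λ i k → ι (a k i) * y (toℕ i)))

    combination-scale : ∀ {l} r (a : Fin l → F.Carrier) → combination (λ i → r F.* a i) ≈ ι r * combination a
    combination-scale r a = trans (sum-cong-≋ (λ i → trans (*-congʳ (ι-* r (a i))) (*-assoc (ι r) (ι (a i)) (y (toℕ i)))))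
      (sym (*-distribˡ-sum (ι r) (λ i → ι (a i) * y (toℕ i))))

    combination-linear : ∀ {l j} (c : Fin j → F.Carrier) (a : Fin j → Fin l → F.Carrier) →
      combination (λ i → F.sum (λ k → c k F.* a k i)) ≈ sum (λ k → ι (c k) * combination (a k))
    combination-linear c a = trans (combination-sum (λ k i → c k F.* a k i)) (sum-cong-≋ (λ k → combination-scale (c k) (a k)))

  operatorCoefficient : (Fin (w *ᴺ w) → F.Carrier) → Fin w → Carrier
  operatorCoefficient α k = sum (λ i → ι (α (combine k i)) * coefficient k i)

  word-operator : ∀ α (u : Fin n → F.Carrier) → combination (λ a → F.sum (λ b → u b F.* word α a b)) ≈
    sum (λ k → operatorCoefficient α k * θ^ (toℕ k) (combination u))
  word-operator α u = begin
    combination (λ a → F.sum (λ b → u b F.* word α a b))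
      ≈⟨ combination-linear u (λ b a → word α a b) ⟩
    sum (λ b → ι (u b) * combination (λ a → word α a b))
      ≈⟨ sum-cong-≋ (λ b → *-congˡ (column b)) ⟩
    sum (λ b → ι (u b) * sum (λ k → A k * T k b))
      ≈⟨ sum-cong-≋ (λ b → *-distribˡ-sum (ι (u b)) (λ k → A k * T k b)) ⟩
    sum (λ b → sum (λ k → ι (u b) * (A k * T k b)))
      ≈⟨ ∑-comm (λ b k → ι (u b) * (A k * T k b)) ⟩
    sum (λ k → sum (λ b → ι (u b) * (A k * T k b)))
      ≈⟨ sum-cong-≋ (λ k → trans (sum-cong-≋ (λ b → x∙yz≈y∙xz (ι (u b)) (A k) (T k b))) (sym (*-distribˡ-sum (A k) (λ b → ι (u b) * T k b)))) ⟩
    sum (λ k → A k * sum (λ b → ι (u b) * T k b))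
      ≈⟨ sum-cong-≋ (λ k → *-congˡ {A k} (θ^-combination (toℕ k) u (λ b → y (toℕ b)))) ⟨
    sum (λ k → A k * θ^ (toℕ k) (combination u)) ∎
    where
    A : Fin w → Carrier
    A = operatorCoefficient α
    T : Fin w → Fin n → Carrier
    T k b = θ^ (toℕ k) (y (toℕ b))
    column : ∀ b → combination (λ a → word α a b) ≈ sum (λ k → A k * T k b)
    column b = begin
      combination (λ a → word α a b)
        ≈⟨ combination-sum (λ k a → F.sum (λ i → α (combine k i) F.* generator k i a b)) ⟩
      sum (λ k → combination (λ a → F.sum (λ i → α (combine k i) F.* generator k i a b)))
        ≈⟨ sum-cong-≋ (λ k → combination-linear (λ i → α (combine k i)) (λ i a → generator k i a b)) ⟩
      sum (λ k → sum (λ i → ι (α (combine k i)) * combination (λ a → generator k i a b)))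
        ≈⟨ sum-cong-≋ (λ k → trans (sum-cong-≋ (λ i → trans (*-congˡ (generator-spec k i b)) (sym (*-assoc (ι (α (combine k i))) (coefficient k i) (T k b)))))
             (sym (*-distribʳ-sum (T k b) (λ i → ι (α (combine k i)) * coefficient k i)))) ⟩
      sum (λ k → A k * T k b) ∎

  -- The kernel of an operator of θ-degree below w contains no w elements independent over F.
  small-rank⇒0 : ∀ α {r} (γ : LinearMap F.commutativeRing n r) → r +ᴺ w ≤ n →
    (∀ u → (∀ i → apply γ u i F.≈ F.0#) → ∀ a → F.sum (λ b → u b F.* word α a b) F.≈ F.0#) →
    ∀ k i → Admissible k i → α (combine k i) F.≈ F.0#
  small-rank⇒0 α {r} γ r+w≤n γ⇒α with kernel r w r+w≤n γ
  ... | J , J-injective , J-kernel = vanish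
    where
    v : Fin w → Carrier
    v l = combination (apply J (δ l))
    v-independent : Independent v
    v-independent a p = J-injective a λ b → F.trans (apply-basis J a b)
      (y-independent n≤m+1 (λ b → F.sum (λ l → a l F.* apply J (δ l) b)) (trans (combination-linear a (λ l → apply J (δ l))) p) b)
    A≈0 : ∀ k → operatorCoefficient α k ≈ 0#
    A≈0 = rows-independent v (operatorCoefficient α) v-independent
      (λ l → trans (sym (word-operator α (apply J (δ l)))) (combination-0 (γ⇒α _ (J-kernel (δ l)))))
    vanish : ∀ k i → Admissible k i → α (combine k i) F.≈ F.0#
    vanish k i ad = F.trans (unmask i ad) (y-independent (ℕₚ.≤-trans w≤n n≤m+1) masked (trans (sum-cong-≋ term) (A≈0 k)) i)
      where
      -- Inadmissible parameters do not reach the operator. Setting them to 0 turns the coefficient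
      -- of θ^k into a plain combination of the y_i.
      masked : Fin w → F.Carrier
      masked i with admissible? k i
      ... | yes _ = α (combine k i)
      ... | no  _ = F.0#
      unmask : ∀ i → Admissible k i → α (combine k i) F.≈ masked i
      unmask i ad with admissible? k i
      ... | yes _  = F.refl
      ... | no ¬ad = ⊥-elim (¬ad ad)
      term : ∀ i → ι (masked i) * y (toℕ i) ≈ ι (α (combine k i)) * coefficient k i
      term i with admissible? k i
      ... | yes _ = refl
      ... | no  _ = trans (*-congʳ ι-0) (trans (zeroˡ _) (sym (zeroʳ _)))

-- Words determined by their entries off s rows and j columns.

module Crossing {c ℓ : Level} (F : DiscreteField c ℓ) {n : ℕ} (s w j : ℕ) (split : s +ᴺ w +ᴺ j ≡ n) where
  open DiscreteField F
  open LinearMap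
  open LinearMaps commutativeRing
  open SemiringSum semiring using (sum; sum-cong-≋; sum-replicate-zero)

  top<n : ∀ (a : Fin s) → toℕ a < n
  top<n a = ℕₚ.<-≤-trans (toℕ<n a) (ℕₚ.≤-trans (ℕₚ.m≤m+n s w) (ℕₚ.≤-trans (ℕₚ.m≤m+n (s +ᴺ w) j) (ℕₚ.≤-reflexive split)))

  right<n : ∀ (b : Fin j) → s +ᴺ w +ᴺ toℕ b < n
  right<n b = ℕₚ.<-≤-trans (ℕₚ.+-monoʳ-< (s +ᴺ w) (toℕ<n b)) (ℕₚ.≤-reflexive split)

  -- Deleted rows become conditions on A u and deleted columns become conditions on u. Together they
  -- cost s + j equations, the rank that rows and columns so deleted can contribute.
  crossing : (Fin n → Fin n → Carrier) → LinearMap commutativeRing n (s +ᴺ j)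
  crossing A = append (fromMatrix (λ a b → A (fromℕ< (top<n a)) b)) (select (λ b → fromℕ< (right<n b)))

  -- Outside s rows and j columns, only the entries met by u contribute to A u.
  crossing-kernel : ∀ A u → (∀ i → apply (crossing A) u i ≈ 0#) →
    (∀ a b → s ≤ toℕ a → toℕ b < s +ᴺ w → u b * A a b ≈ 0#) → ∀ a → sum (λ b → u b * A a b) ≈ 0#
  crossing-kernel A u p q a with append-kernel (fromMatrix (λ a b → A (fromℕ< (top<n a)) b)) (select (λ b → fromℕ< (right<n b))) p
  ... | rows≈0 , columns≈0 with toℕ a ℕₚ.<? s
  ... | yes a<s = trans (reflexive (≡.cong (λ a → sum (λ b → u b * A a b)) (≡.sym a≡))) (rows≈0 (fromℕ< a<s))
    where
    a≡ : fromℕ< (top<n (fromℕ< a<s)) ≡ a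
    a≡ = toℕ-injective (≡.trans (toℕ-fromℕ< _) (toℕ-fromℕ< a<s))
  ... | no a≮s = trans (sum-cong-≋ term) (sum-replicate-zero n)
    where
    term : ∀ b → u b * A a b ≈ 0#
    term b with toℕ b ℕₚ.<? s +ᴺ w
    ... | yes b< = q a b (ℕₚ.≮⇒≥ a≮s) b<
    ... | no b≮  = trans (*-congʳ (trans (reflexive (≡.cong u (≡.sym b≡))) (columns≈0 (fromℕ< b-<j)))) (zeroˡ _)
      where
      s+w≤b = ℕₚ.≮⇒≥ b≮
      b-<j : toℕ b ∸ᴺ (s +ᴺ w) < j
      b-<j = ℕₚ.+-cancelˡ-< (s +ᴺ w) _ _ (≡.subst₂ _<_ (≡.sym (ℕₚ.m+[n∸m]≡n s+w≤b)) (≡.sym split) (toℕ<n b))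
      b≡ : fromℕ< (right<n (fromℕ< b-<j)) ≡ b
      b≡ = toℕ-injective (≡.trans (toℕ-fromℕ< _) (≡.trans (≡.cong (s +ᴺ w +ᴺ_) (toℕ-fromℕ< b-<j)) (ℕₚ.m+[n∸m]≡n s+w≤b)))

-- What the combinatorics of D uses of the operators; the extension field no longer appears.
record SystematicFamily {c ℓ : Level} (F : DiscreteField c ℓ) (n s w j offset : ℕ) : Set (c ⊔ ℓ) where
  open DiscreteField F
  open LinearMap
  open SemiringSum semiring using (sum)
  field
    size       : ℕ
    word       : (Fin size → Carrier) → Fin n → Fin n → Carrier
    word-0     : ∀ a b → word (λ _ → 0#) a b ≈ 0#
    word-+     : ∀ α β a b → word (λ x → α x + β x) a b ≈ word α a b + word β a b
    word-*     : ∀ r α a b → word (λ x → r * α x) a b ≈ r * word α a b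
    word-shape : ∀ α {a b} → ¬ toℕ a +ᴺ offset ≤ toℕ b → word α a b ≈ 0#
    -- Rank at most r is encoded by r linear equations `γ` whose solutions the matrix kills; a
    -- factorisation through r coordinates provides such equations.
    small-rank : ∀ α {r} (γ : LinearMap commutativeRing n r) → r ≤ s +ᴺ j →
      (∀ u → (∀ i → apply γ u i ≈ 0#) → ∀ a → sum (λ b → u b * word α a b) ≈ 0#) → ∀ a b → word α a b ≈ 0#
    prescribe  : (τ : Fin n → Fin n → Carrier) → ∃[ α ]
      (∀ a b → s ≤ toℕ a → toℕ b < s +ᴺ w → toℕ a +ᴺ offset ≤ toℕ b → word α a b ≈ τ a b)

module Systematic {c ℓ : Level} {F : DiscreteField c ℓ} {m : ℕ} (X : FrobeniusChain F m)
  (n s w j offset : ℕ) (n≤m+1 : n ≤ suc m) (split : s +ᴺ w +ᴺ j ≡ n) where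
  open DiscreteField F
  open LinearMap
  open LinearMaps commutativeRing using (Injective)
  open FieldLinearAlgebra F using (injective⇒surjective)
  open Crossing F {n} s w j split

  w≤n : w ≤ n
  w≤n = ℕₚ.≤-trans (ℕₚ.m≤n+m w s) (ℕₚ.≤-trans (ℕₚ.m≤m+n (s +ᴺ w) j) (ℕₚ.≤-reflexive split))

  open Words X n w offset n≤m+1 w≤n public

  s+j+w≡n : s +ᴺ j +ᴺ w ≡ n
  s+j+w≡n = ≡.trans (ℕₚ.+-assoc s j w) (≡.trans (≡.cong (s +ᴺ_) (ℕₚ.+-comm j w)) (≡.trans (≡.sym (ℕₚ.+-assoc s w j)) split))

  s+w≤n : s +ᴺ w ≤ n
  s+w≤n = ℕₚ.≤-trans (ℕₚ.m≤m+n (s +ᴺ w) j) (ℕₚ.≤-reflexive split)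

  -- If these entries vanish, the matrix lives on s rows and j columns, so its rank is at most s + j
  -- = n - w. A nonzero operator of θ-degree below w has larger rank.
  systematic-injective : ∀ α →
    (∀ a b → s ≤ toℕ a → toℕ b < s +ᴺ w → toℕ a +ᴺ offset ≤ toℕ b → word α a b ≈ 0#) →
    ∀ k i → Admissible k i → α (combine k i) ≈ 0#
  systematic-injective α α≈0 = small-rank⇒0 α (crossing (word α)) (ℕₚ.≤-reflexive s+j+w≡n)
    λ u p → crossing-kernel (word α) u p λ a b s≤a b<s+w → trans (*-congˡ (entry a b s≤a b<s+w)) (zeroʳ (u b))
    where
    entry : ∀ a b → s ≤ toℕ a → toℕ b < s +ᴺ w → word α a b ≈ 0#
    entry a b s≤a b<s+w with toℕ a +ᴺ offset ℕₚ.≤? toℕ b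
    ... | yes p = α≈0 a b s≤a b<s+w p
    ... | no ¬p = word-shape α ¬p

  private
    position : Fin w → Fin n
    position i = fromℕ< (ℕₚ.<-≤-trans (ℕₚ.+-monoʳ-< s (toℕ<n i)) s+w≤n)

    locate : ∀ a → s ≤ toℕ a → toℕ a < s +ᴺ w → ∃[ i ] position i ≡ a × toℕ i ≡ toℕ a ∸ᴺ s
    locate a s≤a a<s+w = fromℕ< a-s<w , toℕ-injective (≡.trans (toℕ-fromℕ< _) (≡.trans (≡.cong (s +ᴺ_) (toℕ-fromℕ< a-s<w)) (ℕₚ.m+[n∸m]≡n s≤a))) , toℕ-fromℕ< a-s<w
      where
      a-s<w : toℕ a ∸ᴺ s < w
      a-s<w = ℕₚ.+-cancelˡ-< s _ _ (≡.subst (_< s +ᴺ w) (≡.sym (ℕₚ.m+[n∸m]≡n s≤a)) a<s+w)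

    choose : ∀ {P : Set} → Dec P → Carrier → Carrier → Carrier
    choose (yes _) x z = x
    choose (no _)  x z = z

    choose-cong : ∀ {P : Set} (d : Dec P) {x x′ z z′} → x ≈ x′ → z ≈ z′ → choose d x z ≈ choose d x′ z′
    choose-cong (yes _) p q = p
    choose-cong (no _)  p q = q

    choose-+ : ∀ {P : Set} (d : Dec P) {x x′ z z′} → choose d (x + x′) (z + z′) ≈ choose d x z + choose d x′ z′
    choose-+ (yes _) = refl
    choose-+ (no _)  = refl

    choose-* : ∀ {P : Set} (d : Dec P) {r x z} → choose d (r * x) (r * z) ≈ r * choose d x z
    choose-* (yes _) = refl
    choose-* (no _)  = refl

    choose-yes : ∀ {P : Set} (d : Dec P) → P → ∀ {x z} → choose d x z ≈ x
    choose-yes (yes _) p = refl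
    choose-yes (no ¬p) p = ⊥-elim (¬p p)

    choose-no : ∀ {P : Set} (d : Dec P) → ¬ P → ∀ {x z} → choose d x z ≈ z
    choose-no (yes p) ¬p = ⊥-elim (¬p p)
    choose-no (no _)  ¬p = refl

    -- The parameter of y_i θ^k is matched with the position in row i and column k of the window
    -- that starts at s. Admissible pairs thus index both the parameters and the entries to be
    -- prescribed, which is why the counts agree.
    entry : (Fin (w *ᴺ w) → Carrier) → Fin w × Fin w → Carrier
    entry u (k , i) = choose (admissible? k i) (word u (position i) (position k)) (u (combine k i))

    -- The coordinates without influence on the word are kept, so that the system is square.
    Ψ : LinearMap commutativeRing (w *ᴺ w) (w *ᴺ w)
    Ψ = record
      { apply  = λ u x → entry u (remQuot w x)
      ; cong   = λ p x → choose-cong (dec x) (word-cong p _ _) (p _)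
      ; +-homo = λ u v x → trans (choose-cong (dec x) (word-+ u v _ _) refl) (choose-+ (dec x))
      ; *-homo = λ r u x → trans (choose-cong (dec x) (word-* r u _ _) refl) (choose-* (dec x))
      }
      where
      dec : ∀ x → Dec (Admissible (proj₁ (remQuot {w} w x)) (proj₂ (remQuot {w} w x)))
      dec x = admissible? (proj₁ (remQuot {w} w x)) (proj₂ (remQuot {w} w x))

    Ψ-combine : ∀ u k i → apply Ψ u (combine k i) ≈ entry u (k , i)
    Ψ-combine u k i = reflexive (≡.cong (entry u) (remQuot-combine k i))

    -- For a at most b, the bounds s on a and s + w on b force both indices into the window, where
    -- `locate` finds them.
    read : ∀ u (τ : Fin n → Fin n → Carrier) →
      (∀ k i → Admissible k i → entry u (k , i) ≈ τ (position i) (position k)) →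
      ∀ a b → s ≤ toℕ a → toℕ b < s +ᴺ w → toℕ a +ᴺ offset ≤ toℕ b → word u a b ≈ τ a b
    read u τ p a b s≤a b<s+w a≤b = answer (locate a s≤a a<s+w) (locate b s≤b b<s+w)
      where
      a≤b′ : toℕ a ≤ toℕ b
      a≤b′ = ℕₚ.m+n≤o⇒m≤o (toℕ a) a≤b
      a<s+w = ℕₚ.≤-<-trans a≤b′ b<s+w
      s≤b = ℕₚ.≤-trans s≤a a≤b′
      answer : ∃[ i ] position i ≡ a × toℕ i ≡ toℕ a ∸ᴺ s → ∃[ k ] position k ≡ b × toℕ k ≡ toℕ b ∸ᴺ s → word u a b ≈ τ a b
      answer (i , ≡.refl , i≡) (k , ≡.refl , k≡) = trans (sym (choose-yes (admissible? k i) ad)) (p k i ad)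
        where
        ad : Admissible k i
        ad = ≡.subst₂ (λ i k → i +ᴺ offset ≤ k) (≡.sym i≡) (≡.sym k≡)
          (ℕₚ.+-cancelˡ-≤ s _ _ (ℕₚ.≤-trans (ℕₚ.≤-reflexive (≡.trans (≡.sym (ℕₚ.+-assoc s _ offset)) (≡.cong (_+ᴺ offset) (ℕₚ.m+[n∸m]≡n s≤a))))
            (ℕₚ.≤-trans a≤b (ℕₚ.≤-reflexive (≡.sym (ℕₚ.m+[n∸m]≡n s≤b))))))

    Ψ-injective : Injective Ψ
    Ψ-injective u Ψu≈0 x = trans (reflexive (≡.cong u (≡.sym (combine-remQuot {w} w x)))) (at (proj₁ (remQuot {w} w x)) (proj₂ (remQuot {w} w x)))
      where
      entry≈0 : ∀ k i → entry u (k , i) ≈ 0#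
      entry≈0 k i = trans (sym (Ψ-combine u k i)) (Ψu≈0 (combine k i))
      at : ∀ k i → u (combine k i) ≈ 0#
      at k i with admissible? k i
      ... | yes ad = systematic-injective u (read u (λ _ _ → 0#) (λ k i _ → entry≈0 k i)) k i ad
      ... | no ¬ad = trans (sym (choose-no (admissible? k i) ¬ad)) (entry≈0 k i)

  systematic-surjective : (τ : Fin n → Fin n → Carrier) → ∃[ α ]
    (∀ a b → s ≤ toℕ a → toℕ b < s +ᴺ w → toℕ a +ᴺ offset ≤ toℕ b → word α a b ≈ τ a b)
  systematic-surjective τ with injective⇒surjective Ψ Ψ-injective (λ x → target (remQuot w x))
    where
    target : Fin w × Fin w → Carrier
    target (k , i) = τ (position i) (position k)
  ... | α , Ψα≈τ = α , read α τ λ k i _ → trans (sym (Ψ-combine α k i)) (trans (Ψα≈τ (combine k i))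
    (reflexive (≡.cong (λ (k , i) → τ (position i) (position k)) (remQuot-combine k i))))

  systematicFamily : SystematicFamily F n s w j offset
  systematicFamily = record
    { size       = w *ᴺ w
    ; word       = word
    ; word-0     = word-0 {λ _ → 0#} (λ _ _ _ → refl)
    ; word-+     = word-+
    ; word-*     = word-*
    ; word-shape = word-shape
    ; small-rank = λ α γ r≤s+j γ⇒α → word-0 {α} (small-rank⇒0 α γ (ℕₚ.≤-trans (ℕₚ.+-monoˡ-≤ w r≤s+j) (ℕₚ.≤-reflexive s+j+w≡n)) γ⇒α)
    ; prescribe  = systematic-surjective
    }

-- Counting cells by columns and by diagonals.

module Counting where
  open import Data.Nat.Base using (_+_; _*_; _∸_)
  open SemiringSum ℕₚ.+-*-semiring using (sum; sum-cong-≗; ∑-comm; ∑-distrib-+; *-distribˡ-sum)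

  χ : ∀ {P : Set} → Dec P → ℕ
  χ d = if does d then 1 else 0

  χ-yes : ∀ {P : Set} (d : Dec P) → P → χ d ≡ 1
  χ-yes (yes _) p = ≡.refl
  χ-yes (no ¬p) p = ⊥-elim (¬p p)

  χ-no : ∀ {P : Set} (d : Dec P) → ¬ P → χ d ≡ 0
  χ-no (yes p) ¬p = ⊥-elim (¬p p)
  χ-no (no _)  ¬p = ≡.refl

  χ-cong : ∀ {P Q : Set} (d : Dec P) (e : Dec Q) → (P → Q) → (Q → P) → χ d ≡ χ e
  χ-cong (yes p) e f g = ≡.sym (χ-yes e (f p))
  χ-cong (no ¬p) e f g = ≡.sym (χ-no e (λ q → ¬p (g q)))

  χ-≤1 : ∀ {P : Set} (d : Dec P) → χ d ≤ 1
  χ-≤1 (yes _) = s≤s z≤n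
  χ-≤1 (no _)  = z≤n

  χ-× : ∀ {P Q : Set} (d : Dec P) (e : Dec Q) → χ (d ×-dec e) ≡ χ d * χ e
  χ-× (yes _) (yes _) = ≡.refl
  χ-× (yes _) (no _)  = ≡.refl
  χ-× (no _)  e       = ≡.refl

  length-filter-tabulate : ∀ {n} {A : Set} {P : Pred A 0ℓ} (P? : Decidable P) (f : Fin n → A) →
    length (filter P? (tabulate f)) ≡ sum (λ i → χ (P? (f i)))
  length-filter-tabulate {zero}  P? f = ≡.refl
  length-filter-tabulate {suc n} P? f with does (P? (f fzero))
  ... | true  = ≡.cong suc (length-filter-tabulate P? (λ i → f (fsuc i)))
  ... | false = length-filter-tabulate P? (λ i → f (fsuc i))

  card≡sum : ∀ {n} {P : Pred (Fin n × Fin n) 0ℓ} (P? : Decidable P) → card P? ≡ sum (λ a → sum (λ b → χ (P? (a , b))))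
  card≡sum {n} P? = rows n (λ a → a)
    where
    rows : ∀ k (f : Fin k → Fin n) → length (filter P? (cartesianProduct (tabulate f) (allFin n))) ≡ sum (λ a → sum (λ b → χ (P? (f a , b))))
    rows zero    f = ≡.refl
    rows (suc k) f = begin
      length (filter P? (row ++ rest))                   ≡⟨ ≡.cong length (filter-++ P? row rest) ⟩
      length (filter P? row ++ filter P? rest)           ≡⟨ length-++ (filter P? row) ⟩
      length (filter P? row) + length (filter P? rest)   ≡⟨ ≡.cong₂ _+_
        (≡.trans (≡.cong (λ xs → length (filter P? xs)) (map-tabulate (λ b → b) (f fzero ,_))) (length-filter-tabulate P? (f fzero ,_)))
        (rows k (λ a → f (fsuc a))) ⟩
      sum (λ a → sum (λ b → χ (P? (f a , b))))           ∎
      where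
      open ≡.≡-Reasoning
      row rest : List (Fin n × Fin n)
      row  = map (f fzero ,_) (allFin n)
      rest = cartesianProduct (tabulate (λ a → f (fsuc a))) (allFin n)

  sum-map-allFin : ∀ n (f : Fin n → ℕ) → ListAction.sum (map f (allFin n)) ≡ sum f
  sum-map-allFin n f = general n (λ i → i)
    where
    general : ∀ k (g : Fin k → Fin n) → ListAction.sum (map f (tabulate g)) ≡ sum (λ i → f (g i))
    general zero    g = ≡.refl
    general (suc k) g = ≡.cong (f (g fzero) +_) (general k (λ i → g (fsuc i)))

  sum-map-take : ∀ n t (f : Fin n → ℕ) → ListAction.sum (map f (take t (allFin n))) ≡ sum (λ i → χ (toℕ i ℕₚ.<? t) * f i)
  sum-map-take n t f = general n t (λ i → i)
    where
    sum-0 : ∀ k (g : Fin k → Fin n) → sum (λ i → χ (toℕ i ℕₚ.<? 0) * f (g i)) ≡ 0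
    sum-0 zero    g = ≡.refl
    sum-0 (suc k) g = sum-0 k (λ i → g (fsuc i))
    general : ∀ k t (g : Fin k → Fin n) → ListAction.sum (map f (take t (tabulate g))) ≡ sum (λ i → χ (toℕ i ℕₚ.<? t) * f (g i))
    general k       zero    g = ≡.sym (sum-0 k g)
    general zero    (suc t) g = ≡.refl
    general (suc k) (suc t) g = ≡.cong₂ _+_ (≡.sym (ℕₚ.+-identityʳ (f (g fzero)))) (general k t (λ i → g (fsuc i)))

  sum-mono : ∀ {n} {f g : Fin n → ℕ} → (∀ i → f i ≤ g i) → sum f ≤ sum g
  sum-mono {zero}  p = z≤n
  sum-mono {suc n} p = ℕₚ.+-mono-≤ (p fzero) (sum-mono (λ i → p (fsuc i)))

  sum≡0⇒≡0 : ∀ {n} (f : Fin n → ℕ) → sum f ≡ 0 → ∀ i → f i ≡ 0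
  sum≡0⇒≡0 f p fzero    = ℕₚ.m+n≡0⇒m≡0 _ p
  sum≡0⇒≡0 f p (fsuc i) = sum≡0⇒≡0 (λ j → f (fsuc j)) (ℕₚ.m+n≡0⇒n≡0 (f fzero) p) i

  -- No term can have slack if the totals have none. This splits the one equation of
  -- MDS-constructibility into one for each diagonal.
  sum-≤-rigid : ∀ {n} {f g : Fin n → ℕ} → (∀ i → f i ≤ g i) → sum g ≤ sum f → ∀ i → g i ≤ f i
  sum-≤-rigid {suc n} {f} {g} p q fzero = ℕₚ.+-cancelʳ-≤ (sum (λ i → g (fsuc i))) _ _
    (ℕₚ.≤-trans q (ℕₚ.+-monoʳ-≤ (f fzero) (sum-mono (λ i → p (fsuc i)))))
  sum-≤-rigid {suc n} {f} {g} p q (fsuc i) = sum-≤-rigid (λ j → p (fsuc j))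
    (ℕₚ.+-cancelˡ-≤ (g fzero) _ _ (ℕₚ.≤-trans q (ℕₚ.+-monoˡ-≤ _ (p fzero)))) i

  sum-χ-none : ∀ {n} {P : Fin n → Set} (P? : ∀ i → Dec (P i)) → (∀ i → ¬ P i) → sum (λ i → χ (P? i)) ≡ 0
  sum-χ-none {zero}  P? ¬P = ≡.refl
  sum-χ-none {suc n} P? ¬P = ≡.cong₂ _+_ (χ-no (P? fzero) (¬P fzero)) (sum-χ-none (λ i → P? (fsuc i)) (λ i → ¬P (fsuc i)))

  sum-χ-unique : ∀ {n} {P : Fin n → Set} (P? : ∀ i → Dec (P i)) → (∀ {i j} → P i → P j → i ≡ j) → sum (λ i → χ (P? i)) ≤ 1
  sum-χ-unique {zero}  P? unique = z≤n
  sum-χ-unique {suc n} P? unique with P? fzero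
  ... | yes p = ℕₚ.≤-reflexive (≡.cong suc (sum-χ-none (λ i → P? (fsuc i)) (λ i q → absurd (unique p q))))
    where
    absurd : ∀ {i : Fin n} → ¬ fzero ≡ fsuc i
    absurd ()
  ... | no _  = sum-χ-unique (λ i → P? (fsuc i)) (λ p q → suc-injective (unique p q))

  -- For a down-closed predicate the points below s are the first ones to satisfy it.
  sum-χ-from : ∀ {n} {Q : Fin n → Set} (Q? : ∀ i → Dec (Q i)) → (∀ {i j} → toℕ i ≤ toℕ j → Q j → Q i) → ∀ s →
    sum (λ i → χ (s ℕₚ.≤? toℕ i) * χ (Q? i)) ≡ sum (λ i → χ (Q? i)) ∸ s
  sum-χ-from {zero}  Q? down s       = ≡.sym (ℕₚ.0∸n≡0 s)
  sum-χ-from {suc n} Q? down zero    = sum-cong-≗ (λ i → ℕₚ.+-identityʳ (χ (Q? i)))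
  sum-χ-from {suc n} Q? down (suc s) with Q? fzero | sum-χ-from (λ i → Q? (fsuc i)) (λ i≤j → down (s≤s i≤j)) s
  ... | yes _ | ih = ≡.trans (sum-cong-≗ (λ i → ≡.cong (_* χ (Q? (fsuc i))) (shift i))) ih
    where
    shift : ∀ (i : Fin n) → χ (suc s ℕₚ.≤? toℕ (fsuc i)) ≡ χ (s ℕₚ.≤? toℕ i)
    shift i = χ-cong (suc s ℕₚ.≤? suc (toℕ i)) (s ℕₚ.≤? toℕ i) ℕₚ.≤-pred s≤s
  ... | no ¬Q₀ | _ = ≡.trans zeros (≡.sym (≡.trans (≡.cong (_∸ suc s) none) (ℕₚ.0∸n≡0 (suc s))))
    where
    ¬Q : ∀ i → ¬ _
    ¬Q i q = ¬Q₀ (down z≤n q)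
    none : sum (λ i → χ (Q? (fsuc i))) ≡ 0
    none = sum-χ-none (λ i → Q? (fsuc i)) ¬Q
    zeros : sum (λ i → χ (suc s ℕₚ.≤? toℕ (fsuc i)) * χ (Q? (fsuc i))) ≡ 0
    zeros = ≡.trans (sum-cong-≗ (λ i → ≡.sym (χ-× (suc s ℕₚ.≤? suc (toℕ i)) (Q? (fsuc i)))))
      (sum-χ-none (λ i → (suc s ℕₚ.≤? suc (toℕ i)) ×-dec Q? (fsuc i)) (λ i pq → ¬Q i (proj₂ pq)))

  sum-χ-below : ∀ {n} s → sum {n} (λ i → χ (toℕ i ℕₚ.<? s)) ≤ s
  sum-χ-below {zero}  s       = z≤n
  sum-χ-below {suc n} zero    = ℕₚ.≤-reflexive (sum-χ-none {suc n} (λ i → toℕ i ℕₚ.<? 0) (λ i ()))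
  sum-χ-below {suc n} (suc s) = s≤s (sum-χ-below {n} s)

  sum-χ-above : ∀ t j {n} → t + j ≡ n → sum {n} (λ i → χ (t ℕₚ.≤? toℕ i)) ≤ j
  sum-χ-above t j ≡.refl = ℕₚ.≤-trans (ℕₚ.≤-reflexive (≡.trans (sum-cong-≗ {t + j} (λ i → ≡.sym (ℕₚ.*-identityʳ (χ (t ℕₚ.≤? toℕ i)))))
      -- An inhabited type serves as the predicate that always holds.
      (≡.trans (sum-χ-from {t + j} {Q = λ _ → ℕ} (λ _ → yes 0) (λ _ q → q) t) (≡.cong (_∸ t) (total (t + j))))))
    (ℕₚ.≤-reflexive (ℕₚ.m+n∸m≡n t j))
    where
    total : ∀ n → sum {n} (λ _ → 1) ≡ n
    total zero    = ≡.refl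
    total (suc n) = ≡.cong suc (total n)

  module Residue {n : ℕ} (D : FerrersDiagram n) (s w j : ℕ) (split : s + w + j ≡ n) where
    open FerrersDiagram D
    open ≡.≡-Reasoning

    Inner : Pred (Fin n × Fin n) 0ℓ
    Inner (a , b) = s ≤ toℕ a × toℕ b < s + w

    inner? : Decidable Inner
    inner? (a , b) = (s ℕₚ.≤? toℕ a) ×-dec (toℕ b ℕₚ.<? s + w)

    residue? : Decidable (λ p → Cell p × Inner p)
    residue? = cell? ∩? inner?

    d : ℕ
    d = suc (s + j)

    -- With d = s + j + 1 the summand for a column of height c is c - s, truncated. As columns are
    -- top-justified, this is the number of its cells below the first s rows.
    ν-term≡card : ν-term D d j ≡ card residue?
    ν-term≡card = begin
      ν-term D d j
        ≡⟨ sum-map-take n (n ∸ j) (λ b → (columnHeight b + 1 + j) ∸ d) ⟩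
      sum (λ b → χ (toℕ b ℕₚ.<? n ∸ j) * ((columnHeight b + 1 + j) ∸ d))
        ≡⟨ sum-cong-≗ {n} column ⟩
      sum (λ b → sum (λ a → χ (residue? (a , b))))
        ≡⟨ ∑-comm (λ a b → χ (residue? (a , b))) ⟨
      sum (λ a → sum (λ b → χ (residue? (a , b))))
        ≡⟨ card≡sum residue? ⟨
      card residue? ∎
      where
      n∸j≡s+w : n ∸ j ≡ s + w
      n∸j≡s+w = ≡.trans (≡.cong (_∸ j) (≡.sym split)) (ℕₚ.m+n∸n≡m (s + w) j)
      truncate : ∀ h → (h + 1 + j) ∸ d ≡ h ∸ s
      truncate h = ≡.trans (≡.cong (λ x → (x + j) ∸ d) (ℕₚ.+-comm h 1))
        (≡.trans (≡.cong₂ _∸_ (ℕₚ.+-comm h j) (ℕₚ.+-comm s j)) (ℕₚ.[m+n]∸[m+o]≡n∸o j h s))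
      rearrange : ∀ c r t → c * (r * t) ≡ t * (r * c)
      rearrange c r t = ≡.trans (ℕₚ.*-comm c (r * t)) (≡.trans (≡.cong (_* c) (ℕₚ.*-comm r t)) (ℕₚ.*-assoc t r c))
      column : ∀ b → χ (toℕ b ℕₚ.<? n ∸ j) * ((columnHeight b + 1 + j) ∸ d) ≡ sum (λ a → χ (residue? (a , b)))
      column b = begin
        χ (toℕ b ℕₚ.<? n ∸ j) * ((columnHeight b + 1 + j) ∸ d)
          ≡⟨ ≡.cong₂ (λ t h → χ (toℕ b ℕₚ.<? t) * h) n∸j≡s+w (≡.trans (truncate (columnHeight b))
               (≡.cong (_∸ s) (length-filter-tabulate (λ a → cell? (a , b)) (λ a → a)))) ⟩
        t * (sum (λ a → χ (cell? (a , b))) ∸ s)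
          ≡⟨ ≡.cong (t *_) (sum-χ-from (λ a → cell? (a , b)) (λ i≤j c → up-closed c i≤j) s) ⟨
        t * sum (λ a → χ (s ℕₚ.≤? toℕ a) * χ (cell? (a , b)))
          ≡⟨ *-distribˡ-sum t (λ a → χ (s ℕₚ.≤? toℕ a) * χ (cell? (a , b))) ⟩
        sum (λ a → t * (χ (s ℕₚ.≤? toℕ a) * χ (cell? (a , b))))
          ≡⟨ sum-cong-≗ (λ a → ≡.sym (≡.trans (χ-× (cell? (a , b)) (inner? (a , b)))
               (≡.trans (≡.cong (χ (cell? (a , b)) *_) (χ-× (s ℕₚ.≤? toℕ a) (toℕ b ℕₚ.<? s + w)))
                 (rearrange (χ (cell? (a , b))) (χ (s ℕₚ.≤? toℕ a)) t)))) ⟩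
        sum (λ a → χ (residue? (a , b))) ∎
        where t = χ (toℕ b ℕₚ.<? s + w)

    ∑∑ : (Fin n → Fin n → ℕ) → ℕ
    ∑∑ f = sum (λ a → sum (λ b → f a b))

    ∑∑-mono : ∀ {f g} → (∀ a b → f a b ≤ g a b) → ∑∑ f ≤ ∑∑ g
    ∑∑-mono p = sum-mono (λ a → sum-mono (p a))

    ∑∑-+ : ∀ f g → ∑∑ (λ a b → f a b + g a b) ≡ ∑∑ f + ∑∑ g
    ∑∑-+ f g = ≡.trans (sum-cong-≗ (λ a → ∑-distrib-+ (f a) (g a))) (∑-distrib-+ (λ a → sum (f a)) (λ a → sum (g a)))

    ∑∑-term : ∀ f a b → f a b ≤ ∑∑ f
    ∑∑-term f a b = ℕₚ.≤-trans (term (f a) b) (term (λ a → sum (f a)) a)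
      where
      term : ∀ {k} (g : Fin k → ℕ) i → g i ≤ sum g
      term g fzero    = ℕₚ.m≤m+n _ _
      term g (fsuc i) = ℕₚ.≤-trans (term (λ k → g (fsuc k)) i) (ℕₚ.m≤n+m _ (g fzero))

    private
      C E G : Fin n → Fin n → ℕ
      C a b = χ (cell? (a , b))
      E a b = χ (residue? (a , b))
      G a b = χ (¬? (inner? (a , b)))

      Δ : Fin n → Fin n → Fin n → ℕ
      Δ i a b = χ (diagonal? i (a , b))

      Δ-unique-column : ∀ i a → sum (λ b → Δ i a b) ≤ 1
      Δ-unique-column i a = sum-χ-unique (λ b → diagonal? i (a , b)) (λ p q → toℕ-injective (≡.trans p (≡.sym q)))

      Δ-unique-row : ∀ i b → sum (λ a → Δ i a b) ≤ 1
      Δ-unique-row i b = sum-χ-unique (λ a → diagonal? i (a , b)) (λ p q → toℕ-injective (ℕₚ.+-cancelʳ-≡ (toℕ i) _ _ (≡.trans (≡.sym p) q)))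

      -- The diagonals reach only positions on or above the main one. A position below it lies on
      -- none of them, which leaves room for the extra indicator.
      Δ-unique : ∀ a b → sum (λ i → Δ i a b) + χ (toℕ b ℕₚ.<? toℕ a) ≤ 1
      Δ-unique a b = go (toℕ b ℕₚ.<? toℕ a)
        where
        go : (b<a? : Dec (toℕ b < toℕ a)) → sum (λ i → Δ i a b) + χ b<a? ≤ 1
        go (no _)    = ℕₚ.≤-trans (ℕₚ.≤-reflexive (ℕₚ.+-identityʳ _))
          (sum-χ-unique (λ i → diagonal? i (a , b)) (λ p q → toℕ-injective (ℕₚ.+-cancelˡ-≡ (toℕ a) _ _ (≡.trans (≡.sym p) q))))
        go (yes b<a) = ℕₚ.≤-reflexive (≡.cong (_+ 1) (sum-χ-none (λ i → diagonal? i (a , b))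
          (λ i p → ℕₚ.<⇒≱ b<a (ℕₚ.≤-trans (ℕₚ.m≤m+n (toℕ a) (toℕ i)) (ℕₚ.≤-reflexive (≡.sym p))))))

      -- A diagonal meets each of the s deleted rows and each of the j deleted columns at most once.
      outer-bound : ∀ i → ∑∑ (λ a b → G a b * Δ i a b) ≤ s + j
      outer-bound i = ℕₚ.≤-trans (∑∑-mono pointwise) (ℕₚ.≤-trans (ℕₚ.≤-reflexive (∑∑-+ (λ a b → top a * Δ i a b) (λ a b → right b * Δ i a b)))
        (ℕₚ.+-mono-≤ top-bound right-bound))
        where
        top right : Fin n → ℕ
        top a   = χ (toℕ a ℕₚ.<? s)
        right b = χ (s + w ℕₚ.≤? toℕ b)
        pointwise : ∀ a b → G a b * Δ i a b ≤ top a * Δ i a b + right b * Δ i a b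
        pointwise a b = ℕₚ.≤-trans (ℕₚ.*-monoˡ-≤ (Δ i a b) cover) (ℕₚ.≤-reflexive (ℕₚ.*-distribʳ-+ (Δ i a b) (top a) (right b)))
          where
          cover : G a b ≤ top a + right b
          cover = go (toℕ a ℕₚ.<? s) (s + w ℕₚ.≤? toℕ b)
            where
            go : (d : Dec (toℕ a < s)) (e : Dec (s + w ≤ toℕ b)) → G a b ≤ χ d + χ e
            go (yes _) _       = ℕₚ.≤-trans (χ-≤1 (¬? (inner? (a , b)))) (s≤s z≤n)
            go (no _)  (yes _) = χ-≤1 (¬? (inner? (a , b)))
            go (no p)  (no q)  = ℕₚ.≤-reflexive (χ-no (¬? (inner? (a , b))) (λ ¬in → ¬in (ℕₚ.≮⇒≥ p , ℕₚ.≰⇒> q)))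
        bounded : ∀ (f : Fin n → ℕ) (g : Fin n → Fin n → ℕ) → (∀ a → sum (g a) ≤ 1) → sum (λ a → sum (λ b → f a * g a b)) ≤ sum f
        bounded f g p = sum-mono (λ a → ℕₚ.≤-trans (ℕₚ.≤-reflexive (≡.sym (*-distribˡ-sum (f a) (g a))))
          (ℕₚ.≤-trans (ℕₚ.*-monoʳ-≤ (f a) (p a)) (ℕₚ.≤-reflexive (ℕₚ.*-identityʳ (f a)))))
        top-bound : ∑∑ (λ a b → top a * Δ i a b) ≤ s
        top-bound = ℕₚ.≤-trans (bounded top (Δ i) (Δ-unique-column i)) (sum-χ-below {n} s)
        right-bound : ∑∑ (λ a b → right b * Δ i a b) ≤ j
        right-bound = ℕₚ.≤-trans (ℕₚ.≤-reflexive (∑-comm (λ a b → right b * Δ i a b)))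
          (ℕₚ.≤-trans (bounded right (λ b a → Δ i a b) (Δ-unique-row i)) (sum-χ-above (s + w) j split))

      -- On the i-th diagonal, `M` counts the cells of D, `e` those of the residue, and `hole` the
      -- deleted positions that lie outside D.
      M e hole : Fin n → ℕ
      M i    = card (cell? ∩? diagonal? i)
      e i    = ∑∑ (λ a b → E a b * Δ i a b)
      hole i = ∑∑ (λ a b → χ (¬? (cell? (a , b))) * (G a b * Δ i a b))

      -- On each diagonal the deleted region has at most s + j positions.
      M+hole≤e+s+j : ∀ i → M i + hole i ≤ e i + (s + j)
      M+hole≤e+s+j i = ℕₚ.≤-trans (ℕₚ.≤-reflexive (begin
        M i + hole i
          ≡⟨ ≡.cong (_+ hole i) (≡.trans (card≡sum (cell? ∩? diagonal? i)) (sum-cong-≗ (λ a → sum-cong-≗ (λ b → χ-× (cell? (a , b)) (diagonal? i (a , b)))))) ⟩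
        ∑∑ (λ a b → C a b * Δ i a b) + hole i
          ≡⟨ ∑∑-+ (λ a b → C a b * Δ i a b) (λ a b → χ (¬? (cell? (a , b))) * (G a b * Δ i a b)) ⟨
        ∑∑ (λ a b → C a b * Δ i a b + χ (¬? (cell? (a , b))) * (G a b * Δ i a b))
          ≡⟨ sum-cong-≗ (λ a → sum-cong-≗ (λ b → pointwise (cell? (a , b)) (inner? (a , b)) (Δ i a b))) ⟩
        ∑∑ (λ a b → E a b * Δ i a b + G a b * Δ i a b)
          ≡⟨ ∑∑-+ (λ a b → E a b * Δ i a b) (λ a b → G a b * Δ i a b) ⟩
        e i + ∑∑ (λ a b → G a b * Δ i a b) ∎))
        (ℕₚ.+-monoʳ-≤ (e i) (outer-bound i))
        where
        pointwise : ∀ {P Q : Set} (c : Dec P) (r : Dec Q) δ → χ c * δ + χ (¬? c) * (χ (¬? r) * δ) ≡ χ (c ×-dec r) * δ + χ (¬? r) * δ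
        pointwise (yes _) (yes _) δ = ≡.refl
        pointwise (yes _) (no _)  δ = ℕₚ.+-identityʳ _
        pointwise (no _)  (yes _) δ = ≡.refl
        pointwise (no _)  (no _)  δ = ℕₚ.+-identityʳ _

      below : ℕ
      below = ∑∑ (λ a b → E a b * χ (toℕ b ℕₚ.<? toℕ a))

      e-total : sum e + below ≤ card residue?
      e-total = ℕₚ.≤-trans (ℕₚ.≤-reflexive (≡.trans (≡.cong (_+ below) swap) (≡.sym (∑∑-+ (λ a b → E a b * sum (λ i → Δ i a b)) (λ a b → E a b * χ (toℕ b ℕₚ.<? toℕ a))))))
        (ℕₚ.≤-trans (∑∑-mono pointwise) (ℕₚ.≤-reflexive (≡.sym (card≡sum residue?))))
        where
        swap : sum e ≡ ∑∑ (λ a b → E a b * sum (λ i → Δ i a b))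
        swap = begin
          sum (λ i → sum (λ a → sum (λ b → E a b * Δ i a b)))  ≡⟨ ∑-comm (λ i a → sum (λ b → E a b * Δ i a b)) ⟩
          sum (λ a → sum (λ i → sum (λ b → E a b * Δ i a b)))  ≡⟨ sum-cong-≗ (λ a → ∑-comm (λ i b → E a b * Δ i a b)) ⟩
          sum (λ a → sum (λ b → sum (λ i → E a b * Δ i a b)))  ≡⟨ sum-cong-≗ (λ a → sum-cong-≗ (λ b → *-distribˡ-sum (E a b) (λ i → Δ i a b))) ⟨
          ∑∑ (λ a b → E a b * sum (λ i → Δ i a b))             ∎
        pointwise : ∀ a b → E a b * sum (λ i → Δ i a b) + E a b * χ (toℕ b ℕₚ.<? toℕ a) ≤ E a b
        pointwise a b = ℕₚ.≤-trans (ℕₚ.≤-reflexive (≡.sym (ℕₚ.*-distribˡ-+ (E a b) _ _)))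
          (ℕₚ.≤-trans (ℕₚ.*-monoʳ-≤ (E a b) (Δ-unique a b)) (ℕₚ.≤-reflexive (ℕₚ.*-identityʳ (E a b))))

    module _ (mds : card residue? ≡ sum (λ i → (card (cell? ∩? diagonal? i) + 1) ∸ d)) where
      private
        f : Fin n → ℕ
        f i = M i ∸ (s + j)

        f≤e : ∀ i → f i ≤ e i
        f≤e i = ℕₚ.m≤n+o⇒m∸n≤o (M i) (s + j) (ℕₚ.≤-trans (ℕₚ.m≤m+n (M i) (hole i)) (ℕₚ.≤-trans (M+hole≤e+s+j i) (ℕₚ.≤-reflexive (ℕₚ.+-comm (e i) (s + j)))))

        card≡sum-f : card residue? ≡ sum f
        card≡sum-f = ≡.trans mds (sum-cong-≗ (λ i → ≡.cong (_∸ d) (ℕₚ.+-comm (M i) 1)))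

        -- Closes the chain Σ f ≤ Σ e ≤ Σ e + below ≤ Σ f. Equality throughout gives e = f on each
        -- diagonal and no residue below the main one.
        e+below≤f : sum e + below ≤ sum f
        e+below≤f = ℕₚ.≤-trans e-total (ℕₚ.≤-reflexive card≡sum-f)

        e≤f : ∀ i → e i ≤ f i
        e≤f = sum-≤-rigid f≤e (ℕₚ.≤-trans (ℕₚ.m≤m+n (sum e) below) e+below≤f)

        below≡0 : below ≡ 0
        below≡0 = ℕₚ.n≤0⇒n≡0 (ℕₚ.+-cancelˡ-≤ (sum e) _ _
          (ℕₚ.≤-trans e+below≤f (ℕₚ.≤-trans (sum-mono f≤e) (ℕₚ.≤-reflexive (≡.sym (ℕₚ.+-identityʳ (sum e)))))))

      residue-above-diagonal : ∀ {a b} → Cell (a , b) → Inner (a , b) → toℕ a ≤ toℕ b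
      residue-above-diagonal {a} {b} cell inner = ℕₚ.≮⇒≥ λ b<a → ℕₚ.<⇒≱ (s≤s z≤n) (1≤0 b<a)
        where
        1≤0 : toℕ b < toℕ a → 1 ≤ 0
        1≤0 b<a = ℕₚ.≤-trans (ℕₚ.≤-reflexive (≡.sym (≡.cong₂ _*_ (χ-yes (residue? (a , b)) (cell , inner)) (χ-yes (toℕ b ℕₚ.<? toℕ a) b<a))))
          (ℕₚ.≤-trans (∑∑-term (λ a b → E a b * χ (toℕ b ℕₚ.<? toℕ a)) a b) (ℕₚ.≤-reflexive below≡0))

      -- A residue cell on the diagonal makes e = f positive, so the subtraction in f is not
      -- truncated and M = e + s + j. The bound on M + hole then leaves no room for a hole.
      deleted-diagonal : ∀ {a b} → Cell (a , b) → Inner (a , b) →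
        ∀ {a′ b′} → toℕ a′ + (toℕ b ∸ toℕ a) ≡ toℕ b′ → ¬ Inner (a′ , b′) → Cell (a′ , b′)
      deleted-diagonal {a} {b} cell inner {a′} {b′} same outer with cell? (a′ , b′)
      ... | yes p = p
      ... | no ¬p = ⊥-elim (ℕₚ.<⇒≱ (s≤s z≤n) (ℕₚ.≤-trans 1≤hole (ℕₚ.≤-reflexive hole≡0)))
        where
        a≤b = residue-above-diagonal cell inner
        i : Fin n
        i = fromℕ< (ℕₚ.≤-<-trans (ℕₚ.m∸n≤m (toℕ b) (toℕ a)) (toℕ<n b))
        i≡ : toℕ i ≡ toℕ b ∸ toℕ a
        i≡ = toℕ-fromℕ< _
        on : Diagonal i (a , b)
        on = ≡.sym (≡.trans (≡.cong (toℕ a +_) i≡) (ℕₚ.m+[n∸m]≡n a≤b))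
        on′ : Diagonal i (a′ , b′)
        on′ = ≡.sym (≡.trans (≡.cong (toℕ a′ +_) i≡) same)
        1≤e : 1 ≤ e i
        1≤e = ℕₚ.≤-trans (ℕₚ.≤-reflexive (≡.sym (≡.cong₂ _*_ (χ-yes (residue? (a , b)) (cell , inner)) (χ-yes (diagonal? i (a , b)) on))))
          (∑∑-term (λ a b → E a b * Δ i a b) a b)
        1≤hole : 1 ≤ hole i
        1≤hole = ℕₚ.≤-trans (ℕₚ.≤-reflexive (≡.sym (≡.cong₂ _*_ (χ-yes (¬? (cell? (a′ , b′))) ¬p)
            (≡.cong₂ _*_ (χ-yes (¬? (inner? (a′ , b′))) outer) (χ-yes (diagonal? i (a′ , b′)) on′)))))
          (∑∑-term (λ a b → χ (¬? (cell? (a , b))) * (G a b * Δ i a b)) a′ b′)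
        e+s+j≤M : e i + (s + j) ≤ M i
        e+s+j≤M = ℕₚ.m≤o∸n⇒m+n≤o (e i) (ℕₚ.<⇒≤ (ℕₚ.m∸n≢0⇒n<m λ p → ℕₚ.<⇒≱ 1≤e (ℕₚ.≤-trans (e≤f i) (ℕₚ.≤-reflexive p)))) (e≤f i)
        hole≡0 : hole i ≡ 0
        hole≡0 = ℕₚ.n≤0⇒n≡0 (ℕₚ.+-cancelˡ-≤ (M i) _ _ (ℕₚ.≤-trans (M+hole≤e+s+j i) (ℕₚ.≤-trans e+s+j≤M (ℕₚ.≤-reflexive (≡.sym (ℕₚ.+-identityʳ (M i)))))))

  ν-min-attained : ∀ {n} (D : FerrersDiagram n) d → ∃[ j ] j < suc d × ν-min D (suc d) ≡ ν-term D (suc d) j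
  ν-min-attained D d with Extrema.argmin-sel ℕₚ.≤-totalOrder (λ x → x) (ν-term D (suc d) 0) (map (ν-term D (suc d)) (upTo (suc d)))
  -- The default value of the minimum is the term for j = 0, which is in range because the distance
  -- is a successor.
  ... | inj₁ p = 0 , s≤s z≤n , p
  ... | inj₂ p with ∈-map⁻ (ν-term D (suc d)) p
  ... | j , j∈ , q = j , ∈-upTo⁻ j∈ , q

open Counting

-- Bases of spans.

module SpanBasis {c ℓ m ℓm : Level} (K : DiscreteField c ℓ) (M : Module (DiscreteField.commutativeRing K) m ℓm) where
  private
    module K = DiscreteField K
    module U = LinearAlgebra.Subspace
  open Module M
  open LinearAlgebra M
  open MonoidSum +ᴹ-commutativeMonoid using () renaming (sum-cong-≋ to sumᴹ-cong)

  combination-cong : ∀ {k} {a b : Fin k → K.Carrier} (v : Fin k → Carrierᴹ) → (∀ i → a i K.≈ b i) →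
    linearCombination a v ≈ᴹ linearCombination b v
  combination-cong v p = sumᴹ-cong (λ i → *ₗ-congʳ (p i))

  combination-0∷ : ∀ {k} (a : Fin k → K.Carrier) (v : Fin (suc k) → Carrierᴹ) →
    linearCombination (K.0# ∷ᵛ a) v ≈ᴹ linearCombination a (λ i → v (fsuc i))
  combination-0∷ a v = ≈ᴹ-trans (+ᴹ-congʳ (*ₗ-zeroˡ _)) (+ᴹ-identityˡ _)

  generator∈span : ∀ {k} (v : Fin k → Carrierᴹ) i → IsLinearCombination v (v i)
  generator∈span {suc k} v fzero = (K.1# ∷ᵛ λ _ → K.0#) ,
    ≈ᴹ-sym (≈ᴹ-trans (+ᴹ-cong (*ₗ-identityˡ (v fzero)) (combination-0 (λ i → v (fsuc i)))) (+ᴹ-identityʳ (v fzero)))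
  generator∈span {suc k} v (fsuc i) with generator∈span (λ i → v (fsuc i)) i
  ... | a , p = (K.0# ∷ᵛ a) , ≈ᴹ-trans p (≈ᴹ-sym (combination-0∷ a v))

  -- A generator is kept only if the ones kept so far do not span it. The membership test is a
  -- hypothesis here; over a finite field it is met by trying all coefficients. This supplies the
  -- rank that the minimum distance must exhibit.
  span-dimension : (∀ {r} (u : Fin r → Carrierᴹ) x → Dec (IsLinearCombination u x)) →
    ∀ {k} (v : Fin k → Carrierᴹ) → ∃[ r ] HasDimension (span v) r
  span-dimension inSpan? {zero} v = 0 , v , (λ ()) , (λ _ _ ()) , λ p → p
  span-dimension inSpan? {suc k} v with span-dimension inSpan? (λ i → v (fsuc i))
  ... | r , u , u∈ , u-independent , spans = extend (inSpan? u (v fzero))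
    where
    tail : Fin k → Carrierᴹ
    tail i = v (fsuc i)
    weaken : ∀ {x} → IsLinearCombination tail x → IsLinearCombination v x
    weaken (a , p) = (K.0# ∷ᵛ a) , ≈ᴹ-trans p (≈ᴹ-sym (combination-0∷ a v))
    tail-combination : ∀ (a : Fin (suc k) → K.Carrier) → IsLinearCombination u (linearCombination (λ i → a (fsuc i)) tail)
    tail-combination a = spans ((λ i → a (fsuc i)) , ≈ᴹ-refl)
    extend : Dec (IsLinearCombination u (v fzero)) → ∃[ r ] HasDimension (span v) r
    extend (yes v₀∈) = r , u , (λ i → weaken (u∈ i)) , u-independent ,
      λ (a , p) → U.≈ᴹ-closed (span u) (≈ᴹ-sym p) (U.+ᴹ-closed (span u) (U.*ₗ-closed (span u) (a fzero) v₀∈) (tail-combination a))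
    extend (no v₀∉) = suc r , (v fzero ∷ᵛ u) , members , independent , spanning
      where
      members : ∀ i → IsLinearCombination v ((v fzero ∷ᵛ u) i)
      members fzero    = generator∈span v fzero
      members (fsuc i) = weaken (u∈ i)
      independent : LinearlyIndependent (v fzero ∷ᵛ u)
      independent a p with K.zero⊎unit (a fzero)
      ... | inj₁ a₀≈0 = λ { fzero → a₀≈0 ; (fsuc i) → u-independent (λ i → a (fsuc i)) rest≈0 i }
        where
        rest≈0 : linearCombination (λ i → a (fsuc i)) u ≈ᴹ 0ᴹ
        rest≈0 = ≈ᴹ-trans (≈ᴹ-sym (≈ᴹ-trans (+ᴹ-congʳ (≈ᴹ-trans (*ₗ-congʳ a₀≈0) (*ₗ-zeroˡ _))) (+ᴹ-identityˡ _))) p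
      ... | inj₂ (z , a₀z≈1) = ⊥-elim (v₀∉ (U.≈ᴹ-closed (span u) v₀≈ (U.*ₗ-closed (span u) z
              (U.*ₗ-closed (span u) (K.- K.1#) ((λ i → a (fsuc i)) , ≈ᴹ-refl)))))
        where
        w = linearCombination (λ i → a (fsuc i)) u
        -w≈a₀v₀ : (K.- K.1#) *ₗ w ≈ᴹ a fzero *ₗ v fzero
        -w≈a₀v₀ = begin
          (K.- K.1#) *ₗ w                                       ≈⟨ +ᴹ-identityˡ _ ⟨
          0ᴹ +ᴹ (K.- K.1#) *ₗ w                                 ≈⟨ +ᴹ-congʳ p ⟨
          a fzero *ₗ v fzero +ᴹ w +ᴹ (K.- K.1#) *ₗ w            ≈⟨ +ᴹ-assoc _ _ _ ⟩
          a fzero *ₗ v fzero +ᴹ (w +ᴹ (K.- K.1#) *ₗ w)          ≈⟨ +ᴹ-congˡ (+ᴹ-congʳ (*ₗ-identityˡ w)) ⟨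
          a fzero *ₗ v fzero +ᴹ (K.1# *ₗ w +ᴹ (K.- K.1#) *ₗ w)  ≈⟨ +ᴹ-congˡ (*ₗ-distribʳ w K.1# (K.- K.1#)) ⟨
          a fzero *ₗ v fzero +ᴹ (K.1# K.+ K.- K.1#) *ₗ w        ≈⟨ +ᴹ-congˡ (≈ᴹ-trans (*ₗ-congʳ (K.-‿inverseʳ K.1#)) (*ₗ-zeroˡ w)) ⟩
          a fzero *ₗ v fzero +ᴹ 0ᴹ                              ≈⟨ +ᴹ-identityʳ _ ⟩
          a fzero *ₗ v fzero                                    ∎
          where open SetoidReasoning ≈ᴹ-setoid
        v₀≈ : z *ₗ ((K.- K.1#) *ₗ w) ≈ᴹ v fzero
        v₀≈ = ≈ᴹ-trans (*ₗ-congˡ -w≈a₀v₀) (≈ᴹ-trans (≈ᴹ-sym (*ₗ-assoc z (a fzero) (v fzero)))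
          (≈ᴹ-trans (*ₗ-congʳ (K.trans (K.*-comm z (a fzero)) a₀z≈1)) (*ₗ-identityˡ (v fzero))))
      spanning : ∀ {x} → IsLinearCombination v x → IsLinearCombination (v fzero ∷ᵛ u) x
      spanning (a , p) with tail-combination a
      ... | b , q = (a fzero ∷ᵛ b) , ≈ᴹ-trans p (+ᴹ-congˡ q)

private module ℕSum = SemiringSum ℕₚ.+-*-semiring

lookup-injective : ∀ {A : Set} {xs : List A} → Unique xs → ∀ i j → lookup xs i ≡ lookup xs j → i ≡ j
lookup-injective (_ ∷ _)   fzero    fzero    p = ≡.refl
lookup-injective (x∉ ∷ _)  fzero    (fsuc j) p = ⊥-elim (All.lookup x∉ (∈-lookup j) p)
lookup-injective (x∉ ∷ _)  (fsuc i) fzero    p = ⊥-elim (All.lookup x∉ (∈-lookup i) (≡.sym p))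
lookup-injective (_ ∷ xs!) (fsuc i) (fsuc j) p = ≡.cong fsuc (lookup-injective xs! i j p)

atLeastTwo : ∀ {c ℓ} (K : DiscreteField c ℓ) o → Inverse (DiscreteField.setoid K) (≡.setoid (Fin o)) →
  ∃[ q″ ] Inverse (DiscreteField.setoid K) (≡.setoid (Fin (suc (suc q″))))
atLeastTwo K zero finite with () ← Inverse.to finite (DiscreteField.0# K)
atLeastTwo K (suc zero) finite = ⊥-elim (1≉0 (trans (sym (strictlyInverseʳ 1#)) (trans (from-cong (unique (to 1#) (to 0#))) (strictlyInverseʳ 0#))))
  where
  open DiscreteField K
  open Inverse finite
  unique : ∀ (i j : Fin 1) → i ≡ j
  unique fzero fzero = ≡.refl
atLeastTwo K (suc (suc q″)) finite = q″ , finite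

-- The residue and the lowest diagonal that meets it.

module ResidueCells {n : ℕ} (D : FerrersDiagram n) (s w j : ℕ) (split : s +ᴺ w +ᴺ j ≡ n)
  (mds : card (Residue.residue? D s w j split) ≡
    ℕSum.sum {n} (λ i → (card (FerrersDiagram.cell? D ∩? diagonal? i) +ᴺ 1) ∸ᴺ suc (s +ᴺ j)))
  where
  open FerrersDiagram D
  open Residue D s w j split

  cells : List (Fin n × Fin n)
  cells = filter residue? (cartesianProduct (allFin n) (allFin n))

  dimension : ℕ
  dimension = length cells

  cell : Fin dimension → Fin n × Fin n
  cell = lookup cells

  cell-residue : ∀ x → Cell (cell x) × Inner (cell x)
  cell-residue x = proj₂ (∈-filter⁻ residue? {xs = cartesianProduct (allFin n) (allFin n)} (∈-lookup x))

  cell-injective : ∀ x z → cell x ≡ cell z → x ≡ z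
  cell-injective = lookup-injective (filter⁺ residue? (cartesianProduct⁺ (allFin⁺ n) (allFin⁺ n)))

  gap : Fin n × Fin n → ℕ
  gap (a , b) = toℕ b ∸ᴺ toℕ a

  -- The default n exceeds every gap. For an empty residue it leaves no position on or above the
  -- offset diagonal, so all words vanish.
  offset : ℕ
  offset = Extrema.min ℕₚ.≤-totalOrder n (map gap cells)

  offset≤gap : ∀ {p} → p ∈ᴸ cells → offset ≤ gap p
  offset≤gap p∈ = All.lookup (Extrema.min≤xs ℕₚ.≤-totalOrder n (map gap cells)) (∈-map⁺ gap p∈)

  -- The argument witnesses that the residue is nonempty; since gaps stay below n, the minimum is
  -- then not the default.
  extremal-cell : Fin dimension → ∃[ p ] p ∈ᴸ cells × gap p ≡ offset
  extremal-cell x with Extrema.argmin-sel ℕₚ.≤-totalOrder (λ k → k) n (map gap cells)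
  ... | inj₁ offset≡n = ⊥-elim (ℕₚ.<⇒≱ (toℕ<n (proj₂ (cell x))) (ℕₚ.≤-trans (ℕₚ.≤-reflexive (≡.sym offset≡n))
    (ℕₚ.≤-trans (offset≤gap (∈-lookup x)) (ℕₚ.m∸n≤m _ (toℕ (proj₁ (cell x)))))))
  ... | inj₂ offset∈ with ∈-map⁻ gap offset∈
  ... | p , p∈ , offset≡ = p , p∈ , ≡.sym offset≡

  cell-above : ∀ {p} → p ∈ᴸ cells → toℕ (proj₁ p) +ᴺ offset ≤ toℕ (proj₂ p)
  cell-above {a , b} p∈ with ∈-filter⁻ residue? {xs = cartesianProduct (allFin n) (allFin n)} p∈
  ... | _ , p-cell , p-inner = ℕₚ.≤-trans (ℕₚ.+-monoʳ-≤ (toℕ a) (offset≤gap p∈))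
    (ℕₚ.≤-reflexive (ℕₚ.m+[n∸m]≡n (residue-above-diagonal mds p-cell p-inner)))

  -- By right- and up-closure it suffices to look at the lowest diagonal that meets the residue.
  deleted-cell : Fin dimension → ∀ {a b} → toℕ a +ᴺ offset ≤ toℕ b → ¬ Inner (a , b) → Cell (a , b)
  deleted-cell x {a} {b} a≤b outer with extremal-cell x
  ... | (a₀ , b₀) , p∈ , gap≡offset with ∈-filter⁻ residue? {xs = cartesianProduct (allFin n) (allFin n)} p∈
  ... | _ , p-cell , p-inner with s ℕₚ.≤? toℕ a
  -- In a deleted row the lowest diagonal is met in the same row, at or to the left of column b.
  ... | no s≰a = right-closed (deleted-diagonal mds p-cell p-inner {b′ = b′} same (λ inner → s≰a (proj₁ inner))) (ℕₚ.≤-trans (ℕₚ.≤-reflexive b′≡) a≤b)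
    where
    b′ : Fin n
    b′ = fromℕ< (ℕₚ.≤-<-trans a≤b (toℕ<n b))
    b′≡ : toℕ b′ ≡ toℕ a +ᴺ offset
    b′≡ = toℕ-fromℕ< _
    same : toℕ a +ᴺ gap (a₀ , b₀) ≡ toℕ b′
    same = ≡.trans (≡.cong (toℕ a +ᴺ_) gap≡offset) (≡.sym b′≡)
  -- Otherwise column b is deleted, and the lowest diagonal is met in it, at or below row a.
  ... | yes s≤a = up-closed (deleted-diagonal mds p-cell p-inner {a′ = a′} same (λ inner → b≮ (proj₂ inner))) (ℕₚ.≤-trans (ℕₚ.m+n≤o⇒m≤o∸n (toℕ a) a≤b) (ℕₚ.≤-reflexive (≡.sym a′≡)))
    where
    b≮ : ¬ toℕ b < s +ᴺ w
    b≮ b< = outer (s≤a , b<)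
    a′ : Fin n
    a′ = fromℕ< (ℕₚ.≤-<-trans (ℕₚ.m∸n≤m (toℕ b) offset) (toℕ<n b))
    a′≡ : toℕ a′ ≡ toℕ b ∸ᴺ offset
    a′≡ = toℕ-fromℕ< _
    same : toℕ a′ +ᴺ gap (a₀ , b₀) ≡ toℕ b
    same = ≡.trans (≡.cong₂ _+ᴺ_ a′≡ gap≡offset) (ℕₚ.m∸n+n≡m (ℕₚ.≤-trans (ℕₚ.m≤n+m offset (toℕ a)) a≤b))

-- The code, its dimension and its minimum distance.

module Construction {c ℓ₁ ℓ₂ : Level} (F : FiniteField c ℓ₁ ℓ₂) {n : ℕ} (D : FerrersDiagram n)
  (s w j : ℕ) (split : s +ᴺ w +ᴺ j ≡ n)
  (mds : card (Residue.residue? D s w j split) ≡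
    ℕSum.sum {n} (λ i → (card (FerrersDiagram.cell? D ∩? diagonal? i) +ᴺ 1) ∸ᴺ suc (s +ᴺ j)))
  (family : SystematicFamily (FiniteFieldIsDiscrete.discreteField F) n s w j (ResidueCells.offset D s w j split mds))
  where
  K₀ : DiscreteField c ℓ₁
  K₀ = FiniteFieldIsDiscrete.discreteField F

  open FiniteField F using (finite)
  open DiscreteField K₀
  open FerrersDiagram D
  open Residue D s w j split
  open ResidueCells D s w j split mds
  open SystematicFamily family
  open LinearMap
  open LinearMaps commutativeRing
  open FieldLinearAlgebra K₀ using (≈?; kernel)
  open SemiringSum semiring using (sum; sum-cong-≋; sum-replicate-zero; *-distribˡ-sum; *-distribʳ-sum; ∑-comm)
  open Codes F n
  private
    module Vec = LinearAlgebra column-module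
    module Mat = LinearAlgebra matrix-module
    module VecSpan = SpanBasis K₀ column-module
    module MatSpan = SpanBasis K₀ matrix-module

  open Crossing K₀ {n} s w j split

  indicator : ∀ {P : Set} → Dec P → Carrier
  indicator (yes _) = 1#
  indicator (no _)  = 0#

  indicator-yes : ∀ {P : Set} (d : Dec P) → P → indicator d ≈ 1#
  indicator-yes (yes _) p = refl
  indicator-yes (no ¬p) p = ⊥-elim (¬p p)

  indicator-no : ∀ {P : Set} (d : Dec P) → ¬ P → indicator d ≈ 0#
  indicator-no (yes p) ¬p = ⊥-elim (¬p p)
  indicator-no (no _)  ¬p = refl

  isCell? : ∀ x a b → Dec ((a ≡ proj₁ (cell x)) × (b ≡ proj₂ (cell x)))
  isCell? x a b = (a ≟ᶠ proj₁ (cell x)) ×-dec (b ≟ᶠ proj₂ (cell x))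

  -- A unit at one residue cell: these targets make the code systematic on the residue, which gives
  -- both independence and words of small rank.
  target : Fin dimension → Fin n → Fin n → Carrier
  target x a b = indicator (isCell? x a b)

  coefficients : Fin dimension → Fin size → Carrier
  coefficients x = proj₁ (prescribe (target x))

  codeword : Fin dimension → Matrix
  codeword x = word (coefficients x)

  codeword-inner : ∀ x a b → Inner (a , b) → toℕ a +ᴺ offset ≤ toℕ b → codeword x a b ≈ target x a b
  codeword-inner x a b (s≤a , b<) a≤b = proj₂ (prescribe (target x)) a b s≤a b< a≤b

  codeword-cell : ∀ x z → codeword x (proj₁ (cell z)) (proj₂ (cell z)) ≈ target x (proj₁ (cell z)) (proj₂ (cell z))
  codeword-cell x z = codeword-inner x (proj₁ (cell z)) (proj₂ (cell z)) (proj₂ (cell-residue z)) (cell-above (∈-lookup z))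

  -- Below the offset diagonal every word vanishes, and at the other inner positions outside D the
  -- value 0 was prescribed. Deleted positions on or above that diagonal belong to D by
  -- MDS-constructibility.
  codeword-supported : ∀ x → SupportedOn D (codeword x)
  codeword-supported x a b ∉D with toℕ a +ᴺ offset ℕₚ.≤? toℕ b
  ... | no a≰b = word-shape (coefficients x) a≰b
  ... | yes a≤b with inner? (a , b)
  ... | no outer = ⊥-elim (∉D (deleted-cell x a≤b outer))
  ... | yes inner = trans (codeword-inner x a b inner a≤b) (indicator-no (isCell? x a b)
    (λ (a≡ , b≡) → ∉D (≡.subst Cell (≡.sym (≡.cong₂ _,_ a≡ b≡)) (proj₁ (cell-residue x)))))

  code : Code
  code = Mat.span codeword

  matrix-combination : ∀ {k} (α : Fin k → Carrier) (v : Fin k → Matrix) a b → Mat.linearCombination α v a b ≡ sum (λ x → α x * v x a b)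
  matrix-combination {zero}  α v a b = ≡.refl
  matrix-combination {suc k} α v a b = ≡.cong (α fzero * v fzero a b +_) (matrix-combination (λ x → α (fsuc x)) (λ x → v (fsuc x)) a b)

  vector-combination : ∀ {k} (α : Fin k → Carrier) (v : Fin k → Fin n → Carrier) a → Vec.linearCombination α v a ≡ sum (λ x → α x * v x a)
  vector-combination {zero}  α v a = ≡.refl
  vector-combination {suc k} α v a = ≡.cong (α fzero * v fzero a +_) (vector-combination (λ x → α (fsuc x)) (λ x → v (fsuc x)) a)

  word-combination : ∀ {k} (α : Fin k → Carrier) (β : Fin k → Fin size → Carrier) a b →
    sum (λ x → α x * word (β x) a b) ≈ word (λ z → sum (λ x → α x * β x z)) a b
  word-combination {zero}  α β a b = sym (word-0 a b)
  word-combination {suc k} α β a b = trans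
    (+-cong (sym (word-* (α fzero) (β fzero) a b)) (word-combination (λ x → α (fsuc x)) (λ x → β (fsuc x)) a b))
    (sym (word-+ (λ z → α fzero * β fzero z) (λ z → sum (λ x → α (fsuc x) * β (fsuc x) z)) a b))

  member-entry : ∀ (A : Matrix) (α : Fin dimension → Carrier) → (∀ a b → A a b ≈ Mat.linearCombination α codeword a b) →
    ∀ a b → A a b ≈ sum (λ x → α x * codeword x a b)
  member-entry A α p a b = trans (p a b) (reflexive (matrix-combination α codeword a b))

  member-word : ∀ {A : Matrix} → Mat.IsLinearCombination codeword A → ∃[ ω ] (∀ a b → A a b ≈ word ω a b)
  member-word {A} (α , p) = (λ z → sum (λ x → α x * coefficients x z)) ,
    λ a b → trans (member-entry A α p a b) (word-combination α coefficients a b)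

  code-supported : ∀ {A : Matrix} → Mat.IsLinearCombination codeword A → SupportedOn D A
  code-supported {A} (α , p) a b ∉D = trans (member-entry A α p a b)
    (trans (sum-cong-≋ (λ x → trans (*-congˡ {α x} (codeword-supported x a b ∉D)) (zeroʳ (α x)))) (sum-replicate-zero dimension))

  δ-diagonal : ∀ {k} (x : Fin k) → δ x x ≈ 1#
  δ-diagonal fzero    = refl
  δ-diagonal (fsuc x) = δ-diagonal x

  δ-off : ∀ {k} (x z : Fin k) → ¬ x ≡ z → δ x z ≈ 0#
  δ-off fzero    fzero    x≢z = ⊥-elim (x≢z ≡.refl)
  δ-off fzero    (fsuc z) x≢z = refl
  δ-off (fsuc x) fzero    x≢z = refl
  δ-off (fsuc x) (fsuc z) x≢z = δ-off x z (λ p → x≢z (≡.cong fsuc p))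

  target-cell : ∀ x z → target z (proj₁ (cell x)) (proj₂ (cell x)) ≈ δ x z
  target-cell x z with x ≟ᶠ z
  ... | yes ≡.refl = trans (indicator-yes (isCell? x _ _) (≡.refl , ≡.refl)) (sym (δ-diagonal x))
  ... | no x≢z     = trans (indicator-no (isCell? z _ _) (λ (p , q) → x≢z (cell-injective x z (≡.cong₂ _,_ p q)))) (sym (δ-off x z x≢z))

  codewords-independent : Mat.LinearlyIndependent codeword
  codewords-independent α p x = begin
    α x                                                                       ≈⟨ sum-δ α x ⟨
    sum (λ z → α z * δ x z)                                                   ≈⟨ sum-cong-≋ (λ z → *-congˡ {α z} (trans (codeword-cell z x) (target-cell x z))) ⟨
    sum (λ z → α z * codeword z (proj₁ (cell x)) (proj₂ (cell x)))            ≡⟨ matrix-combination α codeword (proj₁ (cell x)) (proj₂ (cell x)) ⟨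
    Mat.linearCombination α codeword (proj₁ (cell x)) (proj₂ (cell x))        ≈⟨ p (proj₁ (cell x)) (proj₂ (cell x)) ⟩
    0#                                                                        ∎
    where open SetoidReasoning setoid

  code-dimension : Mat.HasDimension code dimension
  code-dimension = codeword , MatSpan.generator∈span codeword , codewords-independent , λ p → p

  columns : Matrix → Fin n → Fin n → Carrier
  columns A b a = A a b

  -- A basis of the column space factors the matrix through r coordinates `γ`, and any vector with
  -- zero coordinates is killed by the matrix. For r at most s + j this is the situation of
  -- `small-rank`.
  rank-lower-bound : ∀ {A r} → Mat.IsLinearCombination codeword A → ¬ (∀ a b → A a b ≈ 0#) → HasRank A r → suc (s +ᴺ j) ≤ r
  rank-lower-bound {A} {r} A∈ A≉0 (u , u∈ , _ , spans) = ℕₚ.≮⇒≥ λ r<d → A≉0 (A≈0 (ℕₚ.≤-pred r<d))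
    where
    open SetoidReasoning setoid
    ω = proj₁ (member-word A∈)
    A≈word = proj₂ (member-word A∈)
    coordinates : ∀ b → ∃[ g ] (∀ a → A a b ≈ sum (λ l → g l * u l a))
    coordinates b with spans (VecSpan.generator∈span (columns A) b)
    ... | g , p = g , λ a → trans (p a) (reflexive (vector-combination g u a))
    g : Fin n → Fin r → Carrier
    g b = proj₁ (coordinates b)
    γ : LinearMap commutativeRing n r
    γ = fromMatrix (λ l b → g b l)
    γ⇒A : ∀ z → (∀ l → apply γ z l ≈ 0#) → ∀ a → sum (λ b → z b * word ω a b) ≈ 0#
    γ⇒A z γz≈0 a = begin
      sum (λ b → z b * word ω a b)                          ≈⟨ sum-cong-≋ (λ b → *-congˡ {z b} (trans (sym (A≈word a b)) (proj₂ (coordinates b) a))) ⟩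
      sum (λ b → z b * sum (λ l → g b l * u l a))           ≈⟨ sum-cong-≋ (λ b → *-distribˡ-sum (z b) (λ l → g b l * u l a)) ⟩
      sum (λ b → sum (λ l → z b * (g b l * u l a)))         ≈⟨ ∑-comm (λ b l → z b * (g b l * u l a)) ⟩
      sum (λ l → sum (λ b → z b * (g b l * u l a)))         ≈⟨ sum-cong-≋ (λ l → trans (sum-cong-≋ (λ b → sym (*-assoc (z b) (g b l) (u l a)))) (sym (*-distribʳ-sum (u l a) (λ b → z b * g b l)))) ⟩
      sum (λ l → apply γ z l * u l a)                       ≈⟨ sum-cong-≋ (λ l → trans (*-congʳ (γz≈0 l)) (zeroˡ (u l a))) ⟩
      sum {r} (λ _ → 0#)                                    ≈⟨ sum-replicate-zero r ⟩
      0#                                                    ∎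
    A≈0 : r ≤ s +ᴺ j → ∀ a b → A a b ≈ 0#
    A≈0 r≤s+j a b = trans (A≈word a b) (small-rank ω γ r≤s+j γ⇒A a b)

  -- A codeword attached to a cell vanishes outside s rows, j columns and that cell.
  rank-upper-bound : ∀ x {r} → HasRank (codeword x) r → r ≤ suc (s +ᴺ j)
  rank-upper-bound x {r} (u , u∈ , independent , _) = ℕₚ.≮⇒≥ λ d<r → contradiction d<r
    where
    open SetoidReasoning setoid
    A = codeword x
    b* = proj₂ (cell x)
    β : Fin r → Fin n → Carrier
    β l = proj₁ (u∈ l)
    u≈ : ∀ l a → u l a ≈ sum (λ b → β l b * A a b)
    u≈ l a = trans (proj₂ (u∈ l) a) (reflexive (vector-combination (β l) (columns A) a))
    -- Each basis vector is a combination of columns, so `pull` turns coefficients of basis vectors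
    -- into coefficients of columns, on which `crossing` imposes its conditions.
    pull : LinearMap commutativeRing r n
    pull = fromMatrix (λ b l → β l b)
    conditions : LinearMap commutativeRing r (suc (s +ᴺ j))
    conditions = cons (select (λ _ → b*) ∘ₗ pull) (crossing A ∘ₗ pull)
    contradiction : ¬ (suc (s +ᴺ j) < r)
    contradiction d<r with kernel (suc (s +ᴺ j)) 1 (ℕₚ.≤-trans (ℕₚ.≤-reflexive (ℕₚ.+-comm (suc (s +ᴺ j)) 1)) d<r) conditions
    ... | J , J-injective , J-kernel = 1≉0 (J-injective e₀ (independent κ combination≈0) fzero)
      where
      κ = apply J e₀
      z = apply pull κ
      killed : ∀ a b → s ≤ toℕ a → toℕ b < s +ᴺ w → z b * A a b ≈ 0#
      killed a b s≤a b< with toℕ a +ᴺ offset ℕₚ.≤? toℕ b | b ≟ᶠ b*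
      ... | no a≰b  | _          = trans (*-congˡ (word-shape (coefficients x) a≰b)) (zeroʳ _)
      ... | yes a≤b | yes ≡.refl = trans (*-congʳ (J-kernel e₀ fzero)) (zeroˡ _)
      ... | yes a≤b | no b≢b*    = trans (*-congˡ (trans (codeword-inner x a b (s≤a , b<) a≤b) (indicator-no (isCell? x a b) (λ (_ , b≡) → b≢b* b≡)))) (zeroʳ _)
      Az≈0 : ∀ a → sum (λ b → z b * A a b) ≈ 0#
      Az≈0 = crossing-kernel A z (λ i → J-kernel e₀ (fsuc i)) killed
      combination≈0 : ∀ a → Vec.linearCombination κ u a ≈ 0#
      combination≈0 a = begin
        Vec.linearCombination κ u a                              ≡⟨ vector-combination κ u a ⟩
        sum (λ l → κ l * u l a)                                  ≈⟨ sum-cong-≋ (λ l → *-congˡ {κ l} (u≈ l a)) ⟩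
        sum (λ l → κ l * sum (λ b → β l b * A a b))              ≈⟨ sum-cong-≋ (λ l → *-distribˡ-sum (κ l) (λ b → β l b * A a b)) ⟩
        sum (λ l → sum (λ b → κ l * (β l b * A a b)))            ≈⟨ ∑-comm (λ l b → κ l * (β l b * A a b)) ⟩
        sum (λ b → sum (λ l → κ l * (β l b * A a b)))            ≈⟨ sum-cong-≋ (λ b → trans (sum-cong-≋ (λ l → sym (*-assoc (κ l) (β l b) (A a b)))) (sym (*-distribʳ-sum (A a b) (λ l → κ l * β l b)))) ⟩
        sum (λ b → z b * A a b)                                  ≈⟨ Az≈0 a ⟩
        0#                                                       ∎

  inSpan? : ∀ {r} (u : Fin r → Fin n → Carrier) x → Dec (Vec.IsLinearCombination u x)
  inSpan? {r} u x = map′ (λ (k , p) → (λ l → from (finToFun k l)) , p) complete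
    (any? (λ k → all? (λ a → ≈? (x a) (Vec.linearCombination (λ l → from (finToFun k l)) u a))))
    where
    open Inverse finite using (to; from; from-cong; strictlyInverseʳ)
    complete : Vec.IsLinearCombination u x → ∃[ k ] (∀ a → x a ≈ Vec.linearCombination (λ l → from (finToFun k l)) u a)
    complete (α , p) = k , λ a → trans (p a) (VecSpan.combination-cong u (λ l → sym
        (trans (from-cong (finToFun-funToFin (λ l → to (α l)) l)) (strictlyInverseʳ (α l)))) a)
      where k = funToFin (λ l → to (α l))

  minimum-distance : Fin dimension → HasMinimumRankDistance code (suc (s +ᴺ j))
  minimum-distance x = (codeword x , x∈ , x≉0 , hasRank) , λ (A , A∈ , A≉0 , rank) → rank-lower-bound A∈ A≉0 rank
    where
    x∈ : Mat.IsLinearCombination codeword (codeword x)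
    x∈ = MatSpan.generator∈span codeword x
    x≉0 : ¬ (∀ a b → codeword x a b ≈ 0#)
    x≉0 p = 1≉0 (trans (sym (trans (codeword-cell x x) (trans (target-cell x x) (δ-diagonal x)))) (p _ _))
    hasRank : HasRank (codeword x) (suc (s +ᴺ j))
    hasRank with VecSpan.span-dimension inSpan? (columns (codeword x))
    ... | r , rank = ≡.subst (HasRank (codeword x)) (ℕₚ.≤-antisym (rank-upper-bound x rank) (rank-lower-bound x∈ x≉0 rank)) rank

  isCode : IsCode code D dimension (suc (s +ᴺ j))
  isCode = code-supported , code-dimension , distance dimension minimum-distance
    where
    -- The dimension is generalised to a variable so that it can be split; the value 0 falls under
    -- the convention for the zero code.
    distance : ∀ k → (Fin k → HasMinimumRankDistance code (suc (s +ᴺ j))) → k ≡ 0 ⊎ HasMinimumRankDistance code (suc (s +ᴺ j))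
    distance zero    _ = inj₁ ≡.refl
    distance (suc k) f = inj₂ (f fzero)

  codeExists : ∃[ C ] IsCode C D (card residue?) (suc (s +ᴺ j))
  codeExists = code , isCode

-- Choice of parameters and conclusion.

mfdCode : ∀ {n} (D : FerrersDiagram n) s j → suc (s +ᴺ j) ≤ n → MDSConstructible D (suc (s +ᴺ j)) →
  ν-min D (suc (s +ᴺ j)) ≡ ν-term D (suc (s +ᴺ j)) j →
  ∀ {c ℓ₁ ℓ₂ : Level} (F : FiniteField c ℓ₁ ℓ₂) →
  ∃[ C ] Codes.IsMFDCode F n C D (ν-min D (suc (s +ᴺ j))) (suc (s +ᴺ j))
mfdCode {n} D s j d≤n mds ν≡ {c} {ℓ₁} F = finish (Construction.codeExists F D s w j split mds′ (Systematic.systematicFamily chain n s w j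
    (ResidueCells.offset D s w j split mds′) (ℕₚ.n≤1+n n) split))
  where
  K₀ : DiscreteField c ℓ₁
  K₀ = FiniteFieldIsDiscrete.discreteField F

  chain : FrobeniusChain K₀ n
  chain with atLeastTwo K₀ (FiniteField.order F) (FiniteField.finite F)
  ... | q″ , finite = frobeniusChain K₀ q″ finite n

  -- For d = s + j + 1 this is n - d + 1: a θ-degree below `w` is one of at most n - d, and `w` is
  -- also the side of the window that holds the prescribed entries.
  w : ℕ
  w = n ∸ᴺ (s +ᴺ j)

  split : s +ᴺ w +ᴺ j ≡ n
  split = ≡.trans (ℕₚ.+-assoc s w j) (≡.trans (≡.cong (s +ᴺ_) (ℕₚ.+-comm w j)) (≡.trans (≡.sym (ℕₚ.+-assoc s j w))
    (ℕₚ.m+[n∸m]≡n (ℕₚ.≤-trans (ℕₚ.n≤1+n (s +ᴺ j)) d≤n))))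

  ν≡card : ν-min D (suc (s +ᴺ j)) ≡ card (Residue.residue? D s w j split)
  ν≡card = ≡.trans ν≡ (Residue.ν-term≡card D s w j split)

  mds′ : card (Residue.residue? D s w j split) ≡
    ℕSum.sum {n} (λ i → (card (FerrersDiagram.cell? D ∩? diagonal? i) +ᴺ 1) ∸ᴺ suc (s +ᴺ j))
  mds′ = ≡.trans (≡.sym ν≡card) (≡.trans mds (sum-map-allFin n (λ i → (card (FerrersDiagram.cell? D ∩? diagonal? i) +ᴺ 1) ∸ᴺ suc (s +ᴺ j))))

  finish : ∃[ C ] Codes.IsCode F n C D (card (Residue.residue? D s w j split)) (suc (s +ᴺ j)) →
    ∃[ C ] Codes.IsMFDCode F n C D (ν-min D (suc (s +ᴺ j))) (suc (s +ᴺ j))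
  finish (C , isCode) = C , ≡.subst (λ k → Codes.IsCode F n C D k (suc (s +ᴺ j))) (≡.sym ν≡card) isCode , ≡.refl

theorem4p22 : ∀ (n d : ℕ) → 2 ≤ d → d ≤ n → (D : FerrersDiagram n) → MDSConstructible D d →
    ∀ {c ℓ₁ ℓ₂ : Level} (F : FiniteField c ℓ₁ ℓ₂) →
    ∃[ C ] Codes.IsMFDCode F n C D (ν-min D d) d
theorem4p22 n (suc d′) _ d≤n D mds F = at (ν-min-attained D d′)
  where
  at : ∃[ j ] j < suc d′ × ν-min D (suc d′) ≡ ν-term D (suc d′) j → ∃[ C ] Codes.IsMFDCode F n C D (ν-min D (suc d′)) (suc d′)
  at (j , s≤s j≤d′ , ν≡) = split-d (d′ ∸ᴺ j) (ℕₚ.m∸n+n≡m j≤d′) d≤n mds ν≡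
    where
    -- Generalising d′ lets the equation s + j = d′ be matched, so that the distance becomes
    -- literally s + j + 1.
    split-d : ∀ s {d′} → s +ᴺ j ≡ d′ → suc d′ ≤ n → MDSConstructible D (suc d′) → ν-min D (suc d′) ≡ ν-term D (suc d′) j →
      ∃[ C ] Codes.IsMFDCode F n C D (ν-min D (suc d′)) (suc d′)
    split-d s ≡.refl d≤n mds ν≡ = mfdCode D s j d≤n mds ν≡ F
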